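{- There exists an absolute constant $n_0$ such that the following holds. Let $n,s$ be positive integers with $n\ge 5s$ and $n\ge n_0$, and let $H$ be an $n$-vertex $4$-uniform hypergraph with matching number $\nu(H)\le s$. Then $e(H)\le \binom{n}{4}-\binom{n-s}{4}$.
   Context: A $4$-uniform hypergraph ($4$-graph) $H$ is a vertex set $V(H)$ with an edge set $E(H)\subseteq\binom{V(H)}{4}$; $e(H)=|E(H)|$. A matching is a set of pairwise disjoint edges, and $\nu(H)$ is the maximum size of a matching in $H$. -}

module Defs where

open import Data.Nat using (ℕ; _≤_)
open import Data.List using (List; length)
open import Data.List.Relation.Unary.All using (All)
open import Data.List.Relation.Unary.AllPairs using (AllPairs)
open import Data.List.Relation.Unary.Unique.Propositional using (Unique)
open import Data.List.Membership.Propositional using (_∈_)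
open import Data.Fin.Subset using (Subset; ∣_∣; _∩_; Empty)
open import Data.Product using (_×_)
open import Relation.Binary.PropositionalEquality using (_≡_)

record FourGraph (n : ℕ) : Set where
  field
    edges   : List (Subset n)
    unique  : Unique edges
    uniform : All (λ e → ∣ e ∣ ≡ 4) edges

open FourGraph public

e : ∀ {n} → FourGraph n → ℕ
e H = length (edges H)

Disjoint : ∀ {n} → Subset n → Subset n → Set
Disjoint a b = Empty (a ∩ b)

IsMatching : ∀ {n} → FourGraph n → List (Subset n) → Set
IsMatching H M = All (_∈ edges H) M × Unique M × AllPairs Disjoint M

νAtMost : ∀ {n} → FourGraph n → ℕ → Set
νAtMost H s = ∀ M → IsMatching H M → length M ≤ s

{-# OPTIONS --safe #-}

-- Shift the family and compare it with the family of all edges meeting the first s vertices 0, …, s − 1.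
-- An optimal fractional matching and an optimal fractional cover w, scaled to integers with demand t,
-- satisfy complementary slackness: up to a small error the vertices split into blocks of five with
-- weights x₁, …, x₄, 0 and x₁ + … + x₄ = t, one for each edge of the matching, while every edge of the
-- family weighs at least t. Among the 5⁴ transversals of four blocks at least 4⁴ weigh less than t, and
-- strictly more do unless each of the four blocks contains a vertex of weight t. So a family with as
-- many edges as the extremal one has almost s vertices of weight t, almost no weight elsewhere, and
-- hence almost all edges through the first s vertices. For shifted families the fractional matching
-- number exceeds the integral one only slightly: sort the edges by the intervals containing their
-- vertices, round down within each type, and move every edge one interval to the left.
-- Near the extremal family the bound is exact. Choose disjoint triples greedily for the heads s, s − 1, …;
-- as no s + 1 disjoint edges exist, this gets stuck after few steps, say a. Then every edge avoiding the
-- first s vertices has two vertices in a set of size 3a + 1, which allows O(a²n²) such edges, whereas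
-- order a n³ edges through the vertices s − a, …, s − 1 are missing.
module Submission where

-- The hypothesis n ≥ 5 s enters as a supply of zeros: a fractional matching of size about s leaves
-- enough vertices of weight 0 to give each of its edges a fifth one. Four stars have 256 low
-- transversals out of 625, any other four blocks at least 257, and this gap of one, independent of
-- `t`, is what converts a count of edges into structure. Errors are measured by κ = q⁴ + L, where
-- at most q intervals of length L cover the vertices: each of the q⁴ types loses at most one edge's
-- worth in rounding, and the first interval loses L. So κ is not bounded; it is only a small
-- fraction of n, and stability gives no more than a = O(κ). The last comparison tolerates exactly
-- this, as a² n² is below a n³ once a is a small fraction of n; `q` is chosen for that purpose, and
-- `n₀` makes q⁴ negligible. Edges are counted as ordered quadruples, where sums factorise and n⁴
-- replaces the binomial coefficient at a cost of order n³. All weights are scaled to natural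
-- numbers, with `t` in place of 1.

module Indicators where

  open import Data.Bool using (Bool; true; false)
  open import Data.Nat
  open import Data.Nat.Properties
  open import Data.Fin using (Fin; zero; suc)
  import Data.Fin as Fin
  open import Data.Empty using (⊥-elim)
  open import Function using (_∘_)
  open import Relation.Nullary using (¬_; Dec; yes; no; does)
  open import Relation.Binary.PropositionalEquality
  open import Algebra.Properties.Semiring.Sum +-*-semiring using () renaming (sum to ∑)

  private variable
    n : ℕ

  ⟦_⟧ : Bool → ℕ
  ⟦ true ⟧ = 1
  ⟦ false ⟧ = 0

  ⟦⟧≤1 : ∀ b → ⟦ b ⟧ ≤ 1
  ⟦⟧≤1 true = ≤-refl
  ⟦⟧≤1 false = z≤n

  ≤-via : ∀ {a b l r} → a ≤ b → l + b ≤ r + a → l ≤ r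
  ≤-via {a} {b} {l} {r} a≤b p = +-cancelʳ-≤ b l r (≤-trans p (+-monoʳ-≤ r a≤b))

  ∑-mono : {f g : Fin n → ℕ} → (∀ i → f i ≤ g i) → ∑ f ≤ ∑ g
  ∑-mono {zero} h = z≤n
  ∑-mono {suc n} h = +-mono-≤ (h zero) (∑-mono (h ∘ suc))

  ∑-const : ∀ n c → ∑ {n} (λ _ → c) ≡ n * c
  ∑-const zero c = refl
  ∑-const (suc n) c = cong (c +_) (∑-const n c)

  term≤∑ : ∀ (f : Fin n → ℕ) i → f i ≤ ∑ f
  term≤∑ f zero = m≤m+n _ _
  term≤∑ f (suc i) = ≤-trans (term≤∑ (f ∘ suc) i) (m≤n+m _ _)

  _==_ : Fin n → Fin n → Bool
  i == j = does (i Fin.≟ j)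

  ==-refl : ∀ (i : Fin n) → (i == i) ≡ true
  ==-refl i with i Fin.≟ i
  ... | yes _ = refl
  ... | no ¬p = ⊥-elim (¬p refl)

  ==-sym : ∀ (i j : Fin n) → (i == j) ≡ (j == i)
  ==-sym i j with i Fin.≟ j | j Fin.≟ i
  ... | yes _ | yes _ = refl
  ... | yes p | no q = ⊥-elim (q (sym p))
  ... | no p | yes q = ⊥-elim (p (sym q))
  ... | no _ | no _ = refl

  ==-≢ : ∀ {i j : Fin n} → i ≢ j → (i == j) ≡ false
  ==-≢ {i = i} {j} ne with i Fin.≟ j
  ... | yes p = ⊥-elim (ne p)
  ... | no _ = refl

  ⟦⟧-yes : ∀ {ℓ} {A : Set ℓ} (d : Dec A) → A → ⟦ does d ⟧ ≡ 1
  ⟦⟧-yes (yes _) _ = refl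
  ⟦⟧-yes (no ¬a) a = ⊥-elim (¬a a)

-- Farkas' lemma and linear programming duality over the integers

module LinearProgramming where

  open Indicators
  import Data.Nat as ℕ
  import Data.Nat.Properties as ℕₚ
  open ℕ using (ℕ; zero; suc; z≤n; s≤s)
  open import Data.Integer hiding (suc)
  open import Data.Integer.Properties
  open import Data.Integer.Tactic.RingSolver using (solve-∀)
  open import Data.Fin using (Fin; zero; suc; splitAt; _↑ˡ_; _↑ʳ_)
  import Data.Fin as Fin
  import Data.Fin.Properties as Finₚ
  open import Data.Empty using (⊥-elim)
  open import Data.Product using (∃; _×_; _,_)
  open import Data.Sum using (_⊎_; inj₁; inj₂; [_,_]′)
  open import Function using (_∘_)
  open import Relation.Nullary using (yes; no)
  open import Relation.Binary.PropositionalEquality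
  open import Algebra.Properties.Semiring.Sum ℕₚ.+-*-semiring using () renaming (sum to ∑)
  open import Algebra.Properties.Semiring.Sum +-*-semiring
    using (sum-cong-≗; ∑-distrib-+; *-distribˡ-sum; *-distribʳ-sum) renaming (sum to ∑ᶻ)

  private variable
    n m : ℕ

  nonneg-* : ∀ {i j} → 0ℤ ≤ i → 0ℤ ≤ j → 0ℤ ≤ i * j
  nonneg-* {+ a} {+ b} _ _ = ≤-trans (+≤+ z≤n) (≤-reflexive (pos-* a b))

  pos-*′ : ∀ {i j} → 0ℤ < i → 0ℤ < j → 0ℤ < i * j
  pos-*′ {+[1+ a ]} {+[1+ b ]} _ _ = +<+ (s≤s z≤n)
  pos-*′ {+0} (+<+ ()) _
  pos-*′ {+[1+ a ]} {+0} _ (+<+ ())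

  ∑ᶻ-nonneg : {f : Fin n → ℤ} → (∀ i → 0ℤ ≤ f i) → 0ℤ ≤ ∑ᶻ f
  ∑ᶻ-nonneg {zero} h = ≤-refl
  ∑ᶻ-nonneg {suc n} h = +-mono-≤ (h zero) (∑ᶻ-nonneg (h ∘ suc))

  dot : (Fin n → ℤ) → (Fin n → ℤ) → ℤ
  dot a x = ∑ᶻ λ p → a p * x p

  dot-linʳ : ∀ (a x y : Fin n → ℤ) u v → dot a (λ p → u * x p + v * y p) ≡ u * dot a x + v * dot a y
  dot-linʳ a x y u v = trans (sum-cong-≗ (λ p → e (a p) (x p) (y p) u v))
    (trans (∑-distrib-+ (λ p → u * (a p * x p)) (λ p → v * (a p * y p)))
      (sym (cong₂ _+_ (*-distribˡ-sum u (λ p → a p * x p)) (*-distribˡ-sum v (λ p → a p * y p)))))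
    where
    e : ∀ a x y u v → a * (u * x + v * y) ≡ u * (a * x) + v * (a * y)
    e = solve-∀

  dot-comm : ∀ (a x : Fin n → ℤ) → dot a x ≡ dot x a
  dot-comm a x = sum-cong-≗ (λ p → *-comm (a p) (x p))

  dot-linˡ : ∀ (a b y : Fin n → ℤ) u v → dot (λ p → u * a p + v * b p) y ≡ u * dot a y + v * dot b y
  dot-linˡ a b y u v = trans (dot-comm (λ p → u * a p + v * b p) y) (trans (dot-linʳ y a b u v) (cong₂ (λ s t → u * s + v * t) (dot-comm y a) (dot-comm y b)))

  unit : Fin n → Fin n → ℤ
  unit p q = + ⟦ p == q ⟧

  ∑ᶻ-0 : ∀ n → ∑ᶻ {n} (λ _ → 0ℤ) ≡ 0ℤ
  ∑ᶻ-0 zero = refl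
  ∑ᶻ-0 (suc n) = trans (+-identityˡ _) (∑ᶻ-0 n)

  dot-unit : ∀ (p : Fin n) x → dot (unit p) x ≡ x p
  dot-unit {suc n} zero x = trans (cong₂ _+_ (*-identityˡ (x zero)) (trans (sum-cong-≗ (λ q → *-zeroˡ (x (suc q)))) (∑ᶻ-0 n))) (+-identityʳ _)
  dot-unit {suc n} (suc p) x = trans (cong (_+ dot (unit p) (x ∘ suc)) (*-zeroˡ (x zero))) (trans (+-identityˡ _) (dot-unit p (x ∘ suc)))

  Certificate : ∀ {m n} → (Fin m → Fin n → ℤ) → (Fin n → ℤ) → Set
  Certificate {m} a b = ∃ λ (c : Fin m → ℤ) → ∃ λ k → (∀ i → 0ℤ ≤ c i) × 0ℤ < k
    × (∀ p → ∑ᶻ (λ i → c i * a i p) ≡ k * b p)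

  Separator : ∀ {m n} → (Fin m → Fin n → ℤ) → (Fin n → ℤ) → Set
  Separator {m} {n} a b = ∃ λ (x : Fin n → ℤ) → (∀ i → 0ℤ ≤ dot (a i) x) × dot b x < 0ℤ

  -- Induction on the number of generators. If a separator `x` of the others fails on `a zero`, a
  -- projection sends `a zero` to 0 and makes all other vectors orthogonal to `x`; either
  -- alternative for the projected system lifts back. Nothing is divided: the multiplier `k` of a
  -- certificate takes the place of denominators.
  farkas : ∀ m {n} (a : Fin m → Fin n → ℤ) (b : Fin n → ℤ) → Certificate a b ⊎ Separator a b
  farkas zero {n} a b with Finₚ.all? (λ p → b p ≟ 0ℤ)
  ... | yes z = inj₁ ((λ ()) , 1ℤ , (λ ()) , +<+ (s≤s z≤n) , λ p → sym (trans (*-identityˡ (b p)) (z p)))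
  ... | no nz with Finₚ.¬∀⟶∃¬ n (λ p → b p ≡ 0ℤ) (λ p → b p ≟ 0ℤ) nz
  -- The summand with coefficient 0 only gives the vector the shape that `dot-linʳ` expects.
  ... | p , bp≢0 = inj₂ ((λ q → - b p * unit p q + 0ℤ * unit p q) , (λ ()) ,
          subst (_< 0ℤ) (sym eq) (negsq (b p) bp≢0))
    where
    negsq : ∀ z → z ≢ 0ℤ → - z * z < 0ℤ
    negsq +0 h = ⊥-elim (h refl)
    negsq +[1+ a ] h = -<+
    negsq -[1+ a ] h = -<+
    eq : dot b (λ q → - b p * unit p q + 0ℤ * unit p q) ≡ - b p * b p
    eq = trans (dot-linʳ b (unit p) (unit p) (- b p) 0ℤ) (trans (+-identityʳ _) (cong (- b p *_) (trans (dot-comm b (unit p)) (dot-unit p b))))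
  farkas (suc m) {n} a b with farkas m (a ∘ suc) b
  ... | inj₁ (c , k , c≥0 , k>0 , eq) = inj₁ ((λ { zero → 0ℤ ; (suc i) → c i }) , k , (λ { zero → ≤-refl ; (suc i) → c≥0 i }) , k>0 ,
        λ p → trans (cong (_+ ∑ᶻ (λ i → c i * a (suc i) p)) (*-zeroˡ (a zero p))) (trans (+-identityˡ _) (eq p)))
  ... | inj₂ (x , ax≥0 , bx<0) with 0ℤ ≤? dot (a zero) x
  ... | yes p = inj₂ (x , (λ { zero → p ; (suc i) → ax≥0 i }) , bx<0)
  ... | no ¬p = project (farkas m a′ b′)
    where
    -- Project along a zero onto the hyperplane orthogonal to x.
    s = a zero
    σ = - dot s x
    σ>0 : 0ℤ < σ
    σ>0 = neg-mono-< (≰⇒> ¬p)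
    α : Fin m → ℤ
    α i = dot (a (suc i)) x
    β = dot b x
    a′ : Fin m → Fin n → ℤ
    a′ i p = α i * s p + σ * a (suc i) p
    b′ : Fin n → ℤ
    b′ p = β * s p + σ * b p
    project : Certificate a′ b′ ⊎ Separator a′ b′ → Certificate a b ⊎ Separator a b
    project (inj₁ (c , k , c≥0 , k>0 , eq)) = inj₁ (c′ , k * σ , c′≥0 , pos-*′ k>0 σ>0 , eq′)
      where
      -- Collecting the multiples of `s` on both sides yields this coefficient. It is nonnegative
      -- because every `α i` is, while `β` is negative.
      c₀ = ∑ᶻ (λ i → c i * α i) + k * (- β)
      c′ : Fin (suc m) → ℤ
      c′ zero = c₀
      c′ (suc i) = σ * c i
      c′≥0 : ∀ i → 0ℤ ≤ c′ i
      c′≥0 zero = +-mono-≤ (∑ᶻ-nonneg (λ i → nonneg-* (c≥0 i) (ax≥0 i))) (nonneg-* (<⇒≤ k>0) (<⇒≤ (neg-mono-< bx<0)))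
      c′≥0 (suc i) = nonneg-* (<⇒≤ σ>0) (c≥0 i)
      expand : ∀ p → ∑ᶻ (λ i → c i * a′ i p) ≡ ∑ᶻ (λ i → c i * α i) * s p + ∑ᶻ (λ i → σ * c i * a (suc i) p)
      expand p = trans (sum-cong-≗ (λ i → e (c i) (α i) (s p) σ (a (suc i) p)))
        (trans (∑-distrib-+ (λ i → c i * α i * s p) (λ i → σ * c i * a (suc i) p))
          (cong (_+ ∑ᶻ (λ i → σ * c i * a (suc i) p)) (sym (*-distribʳ-sum (s p) (λ i → c i * α i)))))
        where
        e : ∀ c α s σ a → c * (α * s + σ * a) ≡ c * α * s + σ * c * a
        e = solve-∀
      eq′ : ∀ p → c₀ * s p + ∑ᶻ (λ i → σ * c i * a (suc i) p) ≡ k * σ * b p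
      eq′ p = trans (e₁ (∑ᶻ (λ i → c i * α i)) k β (s p) _) (trans (cong (_+ k * (- β) * s p) (trans (sym (expand p)) (eq p))) (e₂ k β (s p) σ (b p)))
        where
        e₁ : ∀ A k β s B → (A + k * (- β)) * s + B ≡ (A * s + B) + k * (- β) * s
        e₁ = solve-∀
        e₂ : ∀ k β s σ b → k * (β * s + σ * b) + k * (- β) * s ≡ k * σ * b
        e₂ = solve-∀
    project (inj₂ (y , ay≥0 , by<0)) = inj₂ (x′ , ax′≥0 , subst (_< 0ℤ) (sym (val b β refl)) (subst (_< 0ℤ) (dot-linˡ s b y β σ) by<0))
      where
      x′ : Fin n → ℤ
      -- Orthogonal to `s`, while its product with any `v` equals that of `y` with the projection of
      -- `v`.
      x′ p = dot s y * x p + σ * y p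
      val : ∀ v ω → ω ≡ dot v x → dot v x′ ≡ ω * dot s y + σ * dot v y
      val v ω refl = trans (dot-linʳ v x y (dot s y) σ) (cong (_+ σ * dot v y) (*-comm (dot s y) ω))
      ax′≥0 : ∀ i → 0ℤ ≤ dot (a i) x′
      ax′≥0 zero = ≤-reflexive (sym (trans (val s (dot s x) refl) (e (dot s x) (dot s y))))
        where
        e : ∀ u v → u * v + (- u) * v ≡ 0ℤ
        e = solve-∀
      ax′≥0 (suc i) = subst (0ℤ ≤_) (trans (dot-linˡ s (a (suc i)) y (α i) σ) (sym (val (a (suc i)) (α i) refl))) (ay≥0 i)

  ∑ᶻ-split : ∀ m {n} (f : Fin (m ℕ.+ n) → ℤ) → ∑ᶻ f ≡ ∑ᶻ (λ i → f (i ↑ˡ n)) + ∑ᶻ (λ j → f (m ↑ʳ j))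
  ∑ᶻ-split zero f = sym (+-identityˡ _)
  ∑ᶻ-split (suc m) f = trans (cong (_+_ (f zero)) (∑ᶻ-split m (f ∘ suc))) (sym (+-assoc (f zero) _ _))

  -- Farkas for the target `- unit r` and the generators `unit p` and `A p`. A separator is itself a
  -- solution, positive at `r`. In a certificate the coefficients `u` of the rows of `A` form a
  -- solution: by skewness, `A` applied to `u` is the vector of the other coefficients plus `k`
  -- times `unit r`, hence positive at `r`.
  tucker : (A : Fin n → Fin n → ℤ) → (∀ p q → A p q ≡ - A q p) → ∀ r →
    ∃ λ (z : Fin n → ℤ) → (∀ p → 0ℤ ≤ z p) × (∀ p → 0ℤ ≤ dot (A p) z) × (0ℤ < z r ⊎ 0ℤ < dot (A r) z)
  tucker {n} A skew r = go (farkas (n ℕ.+ n) rows (λ p → - unit r p))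
    where
    rows : Fin (n ℕ.+ n) → Fin n → ℤ
    rows i = [ unit , A ]′ (splitAt n i)
    rowsˡ : ∀ p → rows (p ↑ˡ n) ≡ unit p
    rowsˡ p = cong [ unit , A ]′ (Finₚ.splitAt-↑ˡ n p n)
    rowsʳ : ∀ p → rows (n ↑ʳ p) ≡ A p
    rowsʳ p = cong [ unit , A ]′ (Finₚ.splitAt-↑ʳ n n p)
    dot-neg : ∀ (a x : Fin n → ℤ) → dot (λ p → - a p) x ≡ - dot a x
    dot-neg a x = trans (sum-cong-≗ (λ p → e (a p) (x p))) (trans (sym (*-distribˡ-sum (- 1ℤ) (λ p → a p * x p))) (-1*i≡-i (dot a x)))
      where
      e : ∀ a x → - a * x ≡ - 1ℤ * (a * x)
      e = solve-∀
    go : Certificate rows (λ p → - unit r p) ⊎ Separator rows (λ p → - unit r p) → _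
    go (inj₂ (x , h , lt)) = x , (λ p → subst (0ℤ ≤_) (trans (cong (λ a → dot a x) (rowsˡ p)) (dot-unit p x)) (h (p ↑ˡ n)))
      , (λ p → subst (0ℤ ≤_) (cong (λ a → dot a x) (rowsʳ p)) (h (n ↑ʳ p)))
      , inj₁ (subst (0ℤ <_) (trans (cong -_ (trans (dot-neg (unit r) x) (cong -_ (dot-unit r x)))) (neg-involutive (x r))) (neg-mono-< lt))
    go (inj₁ (c , k , c≥0 , k>0 , eq)) = u , (λ p → c≥0 (n ↑ʳ p))
      , (λ p → subst (0ℤ ≤_) (sym (val p)) (+-mono-≤ (c≥0 (p ↑ˡ n)) (nonneg-* (<⇒≤ k>0) (+≤+ z≤n))))
      , inj₂ (subst (0ℤ <_) (sym (val r)) (+-mono-≤-< (c≥0 (r ↑ˡ n)) (pos-*′ k>0 (subst (λ b → 0ℤ < + ⟦ b ⟧) (sym (==-refl r)) (+<+ (s≤s z≤n))))))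
      where
      u μ : Fin n → ℤ
      u p = c (n ↑ʳ p)
      μ p = c (p ↑ˡ n)
      eqn : ∀ p → μ p + dot u (λ q → A q p) ≡ k * (- unit r p)
      eqn p = trans (sym (cong₂ _+_ (trans (sum-cong-≗ (λ q → trans (cong (λ v → μ q * v p) (rowsˡ q)) (trans (*-comm (μ q) _) (cong (λ b → + ⟦ b ⟧ * μ q) (==-sym q p)))))
          (dot-unit p μ))
        (sum-cong-≗ (λ q → cong (λ v → u q * v p) (rowsʳ q))))) (trans (sym (∑ᶻ-split n (λ i → c i * rows i p))) (eq p))
      val : ∀ p → dot (A p) u ≡ μ p + k * unit r p
      val p = trans (sum-cong-≗ (λ q → trans (cong (_* u q) (skew p q)) (*-comm (- A q p) (u q)))) (trans (sum-cong-≗ (λ q → e₁ (u q) (A q p)))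
        (trans (sym (*-distribˡ-sum (- 1ℤ) (λ q → u q * A q p))) (trans (-1*i≡-i _) (e₂ (μ p) (dot u (λ q → A q p)) k (unit r p) (eqn p)))))
        where
        e₁ : ∀ u a → u * - a ≡ - 1ℤ * (u * a)
        e₁ = solve-∀
        e₃ : ∀ m d → - d ≡ m + - (m + d)
        e₃ = solve-∀
        e₄ : ∀ m k b → m + - (k * (- b)) ≡ m + k * b
        e₄ = solve-∀
        e₂ : ∀ m d k b → m + d ≡ k * (- b) → - d ≡ m + k * b
        e₂ m d k b h = trans (e₃ m d) (trans (cong (λ w → m + - w) h) (e₄ m k b))

  ∑ᶻ-pos : ∀ (f : Fin n → ℕ) → ∑ᶻ (λ i → + f i) ≡ + ∑ f
  ∑ᶻ-pos {zero} f = refl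
  ∑ᶻ-pos {suc n} f = cong (λ s → + f zero + s) (∑ᶻ-pos (f ∘ suc))

  ∑ᶻ-neg : ∀ (f : Fin n → ℕ) → ∑ᶻ (λ i → - + f i) ≡ - + ∑ f
  ∑ᶻ-neg {zero} f = refl
  ∑ᶻ-neg {suc n} f = trans (cong (λ s → - + f zero + s) (∑ᶻ-neg (f ∘ suc))) (sym (neg-distrib-+ (+ f zero) (+ ∑ (f ∘ suc))))

  pos-≤ : ∀ {a b} → 0ℤ ≤ + b + - + a → a ℕ.≤ b
  pos-≤ {a} {b} h = drop‿+≤+ (≤-trans (≤-reflexive (sym (+-identityˡ (+ a)))) (≤-trans (+-monoˡ-≤ (+ a) h) (≤-reflexive (e (+ b) (+ a)))))
    where
    e : ∀ b a → b + - a + a ≡ b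
    e = solve-∀

  -- Fractional matchings and covers of a hypergraph, scaled to be integral: y is a matching with
  -- capacity t at every vertex and w a cover with demand t on every edge. The constraints together
  -- with "the cover weighs at most the matching" form a skew-symmetric system.
  lp-duality : ∀ n E (inc : Fin E → Fin n → ℕ) → (∀ e → ∃ λ v → 1 ℕ.≤ inc e v) →
    ∃ λ (t : ℕ) → ∃ λ (w : Fin n → ℕ) → ∃ λ (y : Fin E → ℕ) → 0 ℕ.< t
      × (∀ e → t ℕ.≤ ∑ (λ v → inc e v ℕ.* w v))
      × (∀ v → ∑ (λ e → inc e v ℕ.* y e) ℕ.≤ t)
      × ∑ w ℕ.≤ ∑ y
  lp-duality n E inc hit = extract (tucker A skew zero)
    where
    M : Fin n ⊎ Fin E → Fin n ⊎ Fin E → ℤ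
    M (inj₁ v) (inj₁ v′) = 0ℤ
    M (inj₁ v) (inj₂ e) = - + inc e v
    M (inj₂ e) (inj₁ v) = + inc e v
    M (inj₂ e) (inj₂ e′) = 0ℤ
    obj : Fin n ⊎ Fin E → ℤ
    obj (inj₁ v) = - 1ℤ
    obj (inj₂ e) = 1ℤ
    A : Fin (suc (n ℕ.+ E)) → Fin (suc (n ℕ.+ E)) → ℤ
    A zero zero = 0ℤ
    A zero (suc q) = obj (splitAt n q)
    A (suc p) zero = - obj (splitAt n p)
    A (suc p) (suc q) = M (splitAt n p) (splitAt n q)
    M-skew : ∀ p q → M p q ≡ - M q p
    M-skew (inj₁ v) (inj₁ v′) = refl
    M-skew (inj₁ v) (inj₂ e) = refl
    M-skew (inj₂ e) (inj₁ v) = sym (neg-involutive _)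
    M-skew (inj₂ e) (inj₂ e′) = refl
    skew : ∀ p q → A p q ≡ - A q p
    skew zero zero = refl
    skew zero (suc q) = sym (neg-involutive _)
    skew (suc p) zero = refl
    skew (suc p) (suc q) = M-skew (splitAt n p) (splitAt n q)
    extract : (∃ λ z → (∀ p → 0ℤ ≤ z p) × (∀ p → 0ℤ ≤ dot (A p) z) × (0ℤ < z zero ⊎ 0ℤ < dot (A zero) z)) → _
    extract (z , z≥0 , Az≥0 , strict) = t , w , y , t>0 , cover , matching , value
      where
      t = ∣ z zero ∣
      w : Fin n → ℕ
      w v = ∣ z (suc (v ↑ˡ E)) ∣
      y : Fin E → ℕ
      y e = ∣ z (suc (n ↑ʳ e)) ∣
      dotA : ∀ p (g : Fin n ⊎ Fin E → ℤ) → (∀ q → A p (suc q) ≡ g (splitAt n q)) →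
        dot (A p) z ≡ A p zero * + t + (∑ᶻ (λ v → g (inj₁ v) * + w v) + ∑ᶻ (λ e → g (inj₂ e) * + y e))
      dotA p g h = cong₂ _+_ (cong (A p zero *_) (sym (0≤i⇒+∣i∣≡i (z≥0 zero)))) (trans (∑ᶻ-split n (λ q → A p (suc q) * z (suc q)))
        (cong₂ _+_ (sum-cong-≗ (λ v → cong₂ _*_ (trans (h (v ↑ˡ E)) (cong g (Finₚ.splitAt-↑ˡ n v E))) (sym (0≤i⇒+∣i∣≡i (z≥0 (suc (v ↑ˡ E)))))))
                   (sum-cong-≗ (λ e → cong₂ _*_ (trans (h (n ↑ʳ e)) (cong g (Finₚ.splitAt-↑ʳ n E e))) (sym (0≤i⇒+∣i∣≡i (z≥0 (suc (n ↑ʳ e)))))))))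
      ones : ∀ {k} (f : Fin k → ℕ) → ∑ᶻ (λ i → 1ℤ * + f i) ≡ + ∑ f
      ones f = trans (sum-cong-≗ (λ i → *-identityˡ (+ f i))) (∑ᶻ-pos f)
      minus : ∀ {k} (f : Fin k → ℕ) → ∑ᶻ (λ i → - 1ℤ * + f i) ≡ - + ∑ f
      minus f = trans (sum-cong-≗ (λ i → -1*i≡-i (+ f i))) (∑ᶻ-neg f)
      zeros : ∀ {k} (f : Fin k → ℕ) → ∑ᶻ (λ i → 0ℤ * + f i) ≡ 0ℤ
      zeros {k} f = trans (sum-cong-≗ (λ i → *-zeroˡ (+ f i))) (∑ᶻ-0 k)
      weighted : ∀ {k} (c f : Fin k → ℕ) → ∑ᶻ (λ i → + c i * + f i) ≡ + ∑ (λ i → c i ℕ.* f i)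
      weighted c f = trans (sum-cong-≗ (λ i → sym (pos-* (c i) (f i)))) (∑ᶻ-pos (λ i → c i ℕ.* f i))
      weighted⁻ : ∀ {k} (c f : Fin k → ℕ) → ∑ᶻ (λ i → - + c i * + f i) ≡ - + ∑ (λ i → c i ℕ.* f i)
      weighted⁻ c f = trans (sum-cong-≗ (λ i → trans (sym (neg-distribˡ-* (+ c i) (+ f i))) (cong -_ (sym (pos-* (c i) (f i)))))) (∑ᶻ-neg (λ i → c i ℕ.* f i))
      d₀ : dot (A zero) z ≡ + ∑ y + - + ∑ w
      d₀ = trans (dotA zero obj (λ _ → refl)) (trans (cong₂ _+_ (*-zeroˡ (+ t)) (cong₂ _+_ (minus w) (ones y))) (trans (+-identityˡ (- + ∑ w + + ∑ y)) (+-comm (- + ∑ w) (+ ∑ y))))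
      dᵥ : ∀ v → dot (A (suc (v ↑ˡ E))) z ≡ + t + - + ∑ (λ e → inc e v ℕ.* y e)
      dᵥ v = trans (dotA (suc (v ↑ˡ E)) (M (inj₁ v)) (λ q → cong (λ s → M s (splitAt n q)) (Finₚ.splitAt-↑ˡ n v E)))
        (cong₂ _+_ (trans (cong (λ s → - obj s * + t) (Finₚ.splitAt-↑ˡ n v E)) (*-identityˡ (+ t))) (trans (cong₂ _+_ (zeros w) (weighted⁻ (λ e → inc e v) y)) (+-identityˡ (- + ∑ (λ e → inc e v ℕ.* y e)))))
      dₑ : ∀ e → dot (A (suc (n ↑ʳ e))) z ≡ + ∑ (λ v → inc e v ℕ.* w v) + - + t
      dₑ e = trans (dotA (suc (n ↑ʳ e)) (M (inj₂ e)) (λ q → cong (λ s → M s (splitAt n q)) (Finₚ.splitAt-↑ʳ n E e)))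
        (trans (cong₂ _+_ (trans (cong (λ s → - obj s * + t) (Finₚ.splitAt-↑ʳ n E e)) (-1*i≡-i (+ t))) (trans (cong₂ _+_ (weighted (inc e) w) (zeros y)) (+-identityʳ _)))
          (+-comm (- + t) (+ ∑ (λ v → inc e v ℕ.* w v))))
      cover : ∀ e → t ℕ.≤ ∑ (λ v → inc e v ℕ.* w v)
      cover e = pos-≤ (subst (0ℤ ≤_) (dₑ e) (Az≥0 (suc (n ↑ʳ e))))
      matching : ∀ v → ∑ (λ e → inc e v ℕ.* y e) ℕ.≤ t
      matching v = pos-≤ (subst (0ℤ ≤_) (dᵥ v) (Az≥0 (suc (v ↑ˡ E))))
      value : ∑ w ℕ.≤ ∑ y
      value = pos-≤ (subst (0ℤ ≤_) d₀ (Az≥0 zero))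
      -- Strictness is requested at the objective row. Either it says that `t` is positive, or that
      -- `∑ y` exceeds `∑ w`; but for t = 0 the capacities would force `y` to vanish, every edge
      -- having a vertex by `hit`.
      t>0 : 0 ℕ.< t
      t>0 = [ (λ p → drop‿+<+ (subst (0ℤ <_) (sym (0≤i⇒+∣i∣≡i (z≥0 zero))) p)) , from-value ]′ strict
        where
        from-value : 0ℤ < dot (A zero) z → 0 ℕ.< t
        from-value p = ℕₚ.n≢0⇒n>0 λ t≡0 → <-irrefl refl (<-≤-trans p (subst (_≤ 0ℤ) (sym d₀)
          (≤-trans (+-monoˡ-≤ (- + ∑ w) (≤-reflexive (cong (λ s → + s) (y≡0 t≡0)))) (≤-trans (≤-reflexive (+-identityˡ (- + ∑ w))) (neg-mono-≤ (+≤+ (z≤n {∑ w})))))))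
          where
          each : t ≡ 0 → ∀ e → y e ≡ 0
          each t≡0 e with hit e
          ... | v , h = ℕₚ.n≤0⇒n≡0 (ℕₚ.≤-trans (ℕₚ.≤-trans (ℕₚ.≤-reflexive (sym (ℕₚ.*-identityˡ (y e)))) (ℕₚ.*-monoˡ-≤ (y e) h))
                (ℕₚ.≤-trans (term≤∑ (λ e → inc e v ℕ.* y e) e) (ℕₚ.≤-trans (matching v) (ℕₚ.≤-reflexive t≡0))))
          y≡0 : t ≡ 0 → ∑ y ≡ 0
          y≡0 t≡0 = ℕₚ.n≤0⇒n≡0 (ℕₚ.≤-trans (∑-mono (λ e → ℕₚ.≤-reflexive (each t≡0 e))) (ℕₚ.≤-reflexive (trans (∑-const E 0) (ℕₚ.*-zeroʳ E))))

open Indicators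
open LinearProgramming using (lp-duality)
open import Data.Bool using (Bool; true; false; _∧_; _∨_; not)
import Data.Bool.Properties as Boolₚ
open import Data.Nat
open import Data.Nat.Properties
open import Data.Nat.DivMod
open import Data.Nat.Induction using (<-wellFounded)
open import Data.Nat.Tactic.RingSolver using (solve-∀)
open import Induction.WellFounded using (Acc; acc)
open import Data.Fin using (Fin; zero; suc; toℕ; fromℕ<)
open import Data.Fin.Patterns
import Data.Fin as Fin
import Data.Fin.Properties as Finₚ
import Data.Fin.Permutation as Perm
open import Data.Fin.Permutation.Components using (transpose)
import Data.List as List
open import Data.List using (List; []; _∷_; length; map; _++_; concatMap; filter; replicate; cartesianProduct; upTo; allFin)
import Data.List.Properties as Listₚ
open import Data.List.Membership.Propositional using (_∈_; _∉_; find)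
open import Data.List.Membership.Propositional.Properties
  using (∈-++⁺ˡ; ∈-++⁺ʳ; ∈-cartesianProduct⁺; ∈-upTo⁺; ∈-allFin; ∈-filter⁺; ∈-lookup)
open import Data.List.Relation.Unary.Any as Any using (here; there; any?)
open import Data.List.Relation.Unary.Any.Properties using (lookup-index)
open import Data.List.Relation.Unary.All as All using (All; []; _∷_)
import Data.List.Relation.Unary.All.Properties as Allₚ
open import Data.List.Relation.Unary.AllPairs using (AllPairs; []; _∷_)
open import Data.List.Relation.Unary.Unique.Propositional using (Unique)
import Data.List.Relation.Unary.Unique.Propositional.Properties as Uniqueₚ
open import Data.Empty using (⊥; ⊥-elim)
open import Data.Product using (Σ; ∃; _×_; _,_; proj₁; proj₂)
open import Data.Product.Properties using (≡-dec)
open import Data.Sum using (_⊎_; inj₁; inj₂; [_,_]′)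
open import Function using (_∘_)
open import Relation.Nullary using (¬_; Dec; yes; no; does; ¬?; ofʸ; ofⁿ)
open import Relation.Nullary.Decidable using (_×-dec_)
open import Relation.Binary.Definitions using (DecidableEquality; tri<; tri≈; tri>)
open import Relation.Binary.PropositionalEquality
open import Algebra.Properties.Semiring.Sum +-*-semiring
  using (sum-cong-≗; ∑-distrib-+; ∑-comm; sum-permute; *-distribˡ-sum; *-distribʳ-sum)
  renaming (sum to ∑)

private variable
  n m : ℕ

-- Four-uniform relations and shifting

∑-mono-< : {f g : Fin n → ℕ} → (∀ i → f i ≤ g i) → ∀ i → f i < g i → ∑ f < ∑ g
∑-mono-< h zero p = +-mono-<-≤ p (∑-mono (h ∘ suc))
∑-mono-< h (suc i) p = +-mono-≤-< (h zero) (∑-mono-< (h ∘ suc) i p)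

Tup : ℕ → Set
Tup n = Fin n × Fin n × Fin n × Fin n

entries : Tup n → List (Fin n)
entries (a , b , c , d) = a ∷ b ∷ c ∷ d ∷ []

flat : List (Tup n) → List (Fin n)
flat = concatMap entries

mapT : (Fin n → Fin m) → Tup n → Tup m
mapT f (a , b , c , d) = f a , f b , f c , f d

Στ : (Tup n → ℕ) → ℕ
Στ f = ∑ λ a → ∑ λ b → ∑ λ c → ∑ λ d → f (a , b , c , d)

Στ-cong : {f g : Tup n → ℕ} → (∀ τ → f τ ≡ g τ) → Στ f ≡ Στ g
Στ-cong h = sum-cong-≗ λ a → sum-cong-≗ λ b → sum-cong-≗ λ c → sum-cong-≗ λ d → h (a , b , c , d)

Στ-mono : {f g : Tup n → ℕ} → (∀ τ → f τ ≤ g τ) → Στ f ≤ Στ g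
Στ-mono h = ∑-mono λ a → ∑-mono λ b → ∑-mono λ c → ∑-mono λ d → h (a , b , c , d)

Στ-mono-< : {f g : Tup n → ℕ} → (∀ τ → f τ ≤ g τ) → ∀ τ → f τ < g τ → Στ f < Στ g
Στ-mono-< h (a , b , c , d) p =
  ∑-mono-< (λ a → ∑-mono λ b → ∑-mono λ c → ∑-mono λ d → h (a , b , c , d)) a
  (∑-mono-< (λ b → ∑-mono λ c → ∑-mono λ d → h (a , b , c , d)) b
  (∑-mono-< (λ c → ∑-mono λ d → h (a , b , c , d)) c
  (∑-mono-< (λ d → h (a , b , c , d)) d p)))

Στ-+ : (f g : Tup n → ℕ) → Στ (λ τ → f τ + g τ) ≡ Στ f + Στ g
Στ-+ f g =
  trans (sum-cong-≗ λ a → trans (sum-cong-≗ λ b → trans (sum-cong-≗ λ c →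
    ∑-distrib-+ (λ d → f (a , b , c , d)) (λ d → g (a , b , c , d)))
    (∑-distrib-+ (λ c → ∑ λ d → f (a , b , c , d)) (λ c → ∑ λ d → g (a , b , c , d))))
    (∑-distrib-+ (λ b → ∑ λ c → ∑ λ d → f (a , b , c , d)) (λ b → ∑ λ c → ∑ λ d → g (a , b , c , d))))
    (∑-distrib-+ (λ a → ∑ λ b → ∑ λ c → ∑ λ d → f (a , b , c , d)) (λ a → ∑ λ b → ∑ λ c → ∑ λ d → g (a , b , c , d)))

∑-transpose : ∀ i j (f : Fin n → ℕ) → ∑ f ≡ ∑ (f ∘ transpose i j)
∑-transpose i j f = sum-permute f (Perm.transpose i j)

Στ-transpose : ∀ i j (f : Tup n → ℕ) → Στ f ≡ Στ (f ∘ mapT (transpose i j))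
Στ-transpose i j f =
  trans (∑-transpose i j (λ a → ∑ λ b → ∑ λ c → ∑ λ d → f (a , b , c , d))) (sum-cong-≗ λ a →
  trans (∑-transpose i j (λ b → ∑ λ c → ∑ λ d → f (π a , b , c , d))) (sum-cong-≗ λ b →
  trans (∑-transpose i j (λ c → ∑ λ d → f (π a , π b , c , d))) (sum-cong-≗ λ c →
  ∑-transpose i j (λ d → f (π a , π b , π c , d)))))
  where π = transpose i j

Rel : ℕ → Set
Rel n = Tup n → Bool

∣_∣ᵣ : Rel n → ℕ
∣ F ∣ᵣ = Στ (⟦_⟧ ∘ F)

-- A 4-graph as the relation of all orderings of its edges, so ∣ F ∣ᵣ is 24 times the number of edges.
record FourSets (F : Rel n) : Set where
  field
    sym₁₂ : ∀ a b c d → F (a , b , c , d) ≡ F (b , a , c , d)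
    sym₂₃ : ∀ a b c d → F (a , b , c , d) ≡ F (a , c , b , d)
    sym₃₄ : ∀ a b c d → F (a , b , c , d) ≡ F (a , b , d , c)
    distinct : ∀ τ → F τ ≡ true → Unique (entries τ)
open FourSets public

-- Uniqueness of the concatenated list says at once that the tuples are pairwise disjoint and that
-- each has four different entries.
νRel : Rel n → ℕ → Set
νRel {n} F s = ∀ (M : List (Tup n)) → All (λ τ → F τ ≡ true) M → Unique (flat M) → length M ≤ s

has : Fin n → Tup n → Bool
has x (a , b , c , d) = (x == a) ∨ ((x == b) ∨ ((x == c) ∨ (x == d)))

Shifted : Rel n → Set
Shifted {n} F = ∀ i j τ → i Fin.< j → F τ ≡ true → has j τ ≡ true → has i τ ≡ false → F (mapT (transpose i j) τ) ≡ true

transpose-ˡ : ∀ (i j : Fin n) → transpose i j i ≡ j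
transpose-ˡ i j rewrite ==-refl i = refl

transpose-ʳ : ∀ (i j : Fin n) → transpose i j j ≡ i
transpose-ʳ i j with j Fin.≟ i
... | yes p = p
... | no _ rewrite ==-refl j = refl

transpose-else : ∀ {i j k : Fin n} → k ≢ i → k ≢ j → transpose i j k ≡ k
transpose-else p q rewrite ==-≢ p | ==-≢ q = refl

data View (i j : Fin n) : Fin n → Set where
  left : View i j i
  right : View i j j
  other : ∀ {k} → k ≢ i → k ≢ j → View i j k

view : ∀ (i j k : Fin n) → View i j k
view i j k with k Fin.≟ i | k Fin.≟ j
... | yes refl | _ = left
... | no p | yes refl = right
... | no p | no q = other p q

transpose-invol : ∀ (i j k : Fin n) → transpose i j (transpose i j k) ≡ k
transpose-invol i j k with view i j k
... | left = trans (cong (transpose i j) (transpose-ˡ i j)) (transpose-ʳ i j)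
... | right = trans (cong (transpose i j) (transpose-ʳ i j)) (transpose-ˡ i j)
... | other p q = trans (cong (transpose i j) (transpose-else p q)) (transpose-else p q)

==-transpose : ∀ (i j k : Fin n) → (i == transpose i j k) ≡ (j == k)
==-transpose i j k with view i j k
... | left rewrite transpose-ˡ i j = ==-sym i j
... | right rewrite transpose-ʳ i j = trans (==-refl i) (sym (==-refl j))
... | other p q rewrite transpose-else p q = trans (==-≢ (p ∘ sym)) (sym (==-≢ (q ∘ sym)))

==-transpose′ : ∀ (i j k : Fin n) → (j == transpose i j k) ≡ (i == k)
==-transpose′ i j k with view i j k
... | left rewrite transpose-ˡ i j = trans (==-refl j) (sym (==-refl i))
... | right rewrite transpose-ʳ i j = ==-sym j i
... | other p q rewrite transpose-else p q = trans (==-≢ (q ∘ sym)) (sym (==-≢ (p ∘ sym)))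

has-transpose : ∀ (i j : Fin n) τ → has i (mapT (transpose i j) τ) ≡ has j τ
has-transpose i j (a , b , c , d) = cong₂ _∨_ (==-transpose i j a) (cong₂ _∨_ (==-transpose i j b) (cong₂ _∨_ (==-transpose i j c) (==-transpose i j d)))

has-transpose′ : ∀ (i j : Fin n) τ → has j (mapT (transpose i j) τ) ≡ has i τ
has-transpose′ i j (a , b , c , d) = cong₂ _∨_ (==-transpose′ i j a) (cong₂ _∨_ (==-transpose′ i j b) (cong₂ _∨_ (==-transpose′ i j c) (==-transpose′ i j d)))

mapT-invol : ∀ (i j : Fin n) τ → mapT (transpose i j) (mapT (transpose i j) τ) ≡ τ
mapT-invol i j (a , b , c , d) = cong₂ _,_ (transpose-invol i j a) (cong₂ _,_ (transpose-invol i j b) (cong₂ _,_ (transpose-invol i j c) (transpose-invol i j d)))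

has⇒∈ : ∀ (x : Fin n) τ → has x τ ≡ true → x ∈ entries τ
has⇒∈ x (a , b , c , d) h with x Fin.≟ a | x Fin.≟ b | x Fin.≟ c | x Fin.≟ d
... | yes refl | _ | _ | _ = here refl
... | no _ | yes refl | _ | _ = there (here refl)
... | no _ | no _ | yes refl | _ = there (there (here refl))
... | no _ | no _ | no _ | yes refl = there (there (there (here refl)))
has⇒∈ x (a , b , c , d) () | no _ | no _ | no _ | no _

∈⇒has : ∀ (x : Fin n) τ → x ∈ entries τ → has x τ ≡ true
∈⇒has x (a , b , c , d) (here refl) rewrite ==-refl x = refl
∈⇒has x (a , b , c , d) (there (here refl)) rewrite ==-refl x = Boolₚ.∨-zeroʳ (x == a)
∈⇒has x (a , b , c , d) (there (there (here refl))) rewrite ==-refl x | Boolₚ.∨-zeroʳ (x == b) = Boolₚ.∨-zeroʳ (x == a)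
∈⇒has x (a , b , c , d) (there (there (there (here refl)))) rewrite ==-refl x | Boolₚ.∨-zeroʳ (x == c) | Boolₚ.∨-zeroʳ (x == b) = Boolₚ.∨-zeroʳ (x == a)

absent : ∀ {x : Fin n} {τ} → has x τ ≡ false → x ∈ entries τ → ⊥
absent {x = x} {τ} h p with trans (sym h) (∈⇒has x τ p)
... | ()

∨-swap : ∀ a b c → a ∨ (b ∨ c) ≡ b ∨ (a ∨ c)
∨-swap true true c = refl
∨-swap true false c = refl
∨-swap false b c = refl

Unique-++-disjoint : ∀ {xs ys : List (Fin n)} {x} → Unique (xs ++ ys) → x ∈ xs → x ∈ ys → ⊥
Unique-++-disjoint {xs = x ∷ xs} (h ∷ u) (here refl) q = All.lookup h (∈-++⁺ʳ xs q) refl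
Unique-++-disjoint {xs = x ∷ xs} (h ∷ u) (there p) q = Unique-++-disjoint u p q

Unique-++ʳ : ∀ (xs : List (Fin n)) {ys} → Unique (xs ++ ys) → Unique ys
Unique-++ʳ [] u = u
Unique-++ʳ (x ∷ xs) (_ ∷ u) = Unique-++ʳ xs u

∈-flat : ∀ {τ : Tup n} {M x} → τ ∈ M → x ∈ entries τ → x ∈ flat M
∈-flat {τ = τ} {.τ ∷ M} (here refl) q = ∈-++⁺ˡ q
∈-flat {τ = τ} {σ ∷ M} (there p) q = ∈-++⁺ʳ (entries σ) (∈-flat p q)

owner : ∀ {M : List (Tup n)} {τ σ x} → Unique (flat M) → τ ∈ M → σ ∈ M → x ∈ entries τ → x ∈ entries σ → τ ≡ σ
owner u (here refl) (here refl) p q = refl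
owner {M = ρ ∷ M} u (here refl) (there s) p q = ⊥-elim (Unique-++-disjoint {xs = entries ρ} u p (∈-flat s q))
owner {M = ρ ∷ M} u (there t) (here refl) p q = ⊥-elim (Unique-++-disjoint {xs = entries ρ} u q (∈-flat t p))
owner {M = ρ ∷ M} u (there t) (there s) p q = owner (Unique-++ʳ (entries ρ) u) t s p q

flat-map : ∀ (f : Fin n → Fin n) M → flat (map (mapT f) M) ≡ map f (flat M)
flat-map f [] = refl
flat-map f (τ ∷ M) = cong (entries (mapT f τ) ++_) (flat-map f M)

module _ (i j : Fin n) where

  private
    π : Fin n → Fin n
    π = transpose i j

  -- The arguments tell whether `j` is in the tuple, whether `i` is, and whether the tuple and its
  -- transpose belong to the family. A tuple with `j` but not `i` stays only if its transpose was
  -- there too; one with `i` but not `j` is there afterwards if either was.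
  mix : Bool → Bool → Bool → Bool → Bool
  mix true false f g = f ∧ g
  mix false true f g = f ∨ g
  mix true true f g = f
  mix false false f g = f

  shift : Rel n → Rel n
  shift F τ = mix (has j τ) (has i τ) (F τ) (F (mapT π τ))

  shift-π : ∀ F τ → shift F (mapT π τ) ≡ mix (has i τ) (has j τ) (F (mapT π τ)) (F τ)
  shift-π F τ rewrite has-transpose i j τ | has-transpose′ i j τ | mapT-invol i j τ = refl

  mix-sum : ∀ p q f g → ⟦ mix p q f g ⟧ + ⟦ mix q p g f ⟧ ≡ ⟦ f ⟧ + ⟦ g ⟧
  mix-sum true true f g = refl
  mix-sum false false f g = refl
  mix-sum true false true true = refl
  mix-sum true false true false = refl
  mix-sum true false false true = refl
  mix-sum true false false false = refl
  mix-sum false true true true = refl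
  mix-sum false true true false = refl
  mix-sum false true false true = refl
  mix-sum false true false false = refl

  double : ∀ (f : Tup n → ℕ) → Στ f + Στ f ≡ Στ (λ τ → f τ + f (mapT π τ))
  double f = trans (cong (Στ f +_) (Στ-transpose i j f)) (sym (Στ-+ f (f ∘ mapT π)))

  double-cancel : ∀ {a b} → a + a ≡ b + b → a ≡ b
  double-cancel {a} {b} h = *-cancelˡ-≡ a b 2 (trans (cong (a +_) (+-identityʳ a)) (trans h (cong (b +_) (sym (+-identityʳ b)))))

  -- Doubling the sum pairs every tuple with its transpose, and `mix` only moves membership within
  -- such a pair.
  ∣shift∣ : ∀ F → ∣ shift F ∣ᵣ ≡ ∣ F ∣ᵣ
  ∣shift∣ F = double-cancel (trans (double (⟦_⟧ ∘ shift F)) (trans (Στ-cong (λ τ →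
    trans (cong (λ b → ⟦ shift F τ ⟧ + ⟦ b ⟧) (shift-π F τ)) (mix-sum (has j τ) (has i τ) (F τ) (F (mapT π τ))))) (sym (double (⟦_⟧ ∘ F)))))

  shift-sets : ∀ {F} → FourSets F → FourSets (shift F)
  shift-sets {F} S = record
    { sym₁₂ = λ a b c d → mix-cong (∨-swap (j == a) (j == b) _) (∨-swap (i == a) (i == b) _) (sym₁₂ S a b c d) (sym₁₂ S (π a) (π b) (π c) (π d))
    ; sym₂₃ = λ a b c d → mix-cong (cong ((j == a) ∨_) (∨-swap (j == b) (j == c) _)) (cong ((i == a) ∨_) (∨-swap (i == b) (i == c) _)) (sym₂₃ S a b c d) (sym₂₃ S (π a) (π b) (π c) (π d))
    ; sym₃₄ = λ a b c d → mix-cong (cong (λ z → (j == a) ∨ ((j == b) ∨ z)) (Boolₚ.∨-comm (j == c) (j == d))) (cong (λ z → (i == a) ∨ ((i == b) ∨ z)) (Boolₚ.∨-comm (i == c) (i == d))) (sym₃₄ S a b c d) (sym₃₄ S (π a) (π b) (π c) (π d))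
    ; distinct = λ τ h → [ distinct S τ , (λ q → Uniqueₚ.map⁻ {f = π} (distinct S (mapT π τ) q)) ]′ (mix-true (has j τ) (has i τ) (F τ) (F (mapT π τ)) h)
    }
    where
    mix-cong : ∀ {p p′ q q′ f f′ g g′} → p ≡ p′ → q ≡ q′ → f ≡ f′ → g ≡ g′ → mix p q f g ≡ mix p′ q′ f′ g′
    mix-cong refl refl refl refl = refl
    mix-true : ∀ p q f g → mix p q f g ≡ true → f ≡ true ⊎ g ≡ true
    mix-true true true f g h = inj₁ h
    mix-true false false f g h = inj₁ h
    mix-true true false true g h = inj₁ refl
    mix-true false true true g h = inj₁ refl
    mix-true false true false g h = inj₂ h

  -- If an edge of the matching is new, it contains i; transposing the whole matching then lands in F.
  shift-ν : ∀ {F s} → νRel F s → νRel (shift F) s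
  shift-ν {F} {s} ν M all u with All.all? (λ τ → F τ Boolₚ.≟ true) M
  ... | yes old = ν M old u
  ... | no new with find (Allₚ.¬All⇒Any¬ (λ τ → F τ Boolₚ.≟ true) M new)
  ... | e , e∈M , Fe≢ = ≤-trans (≤-reflexive (sym (Listₚ.length-map (mapT π) M)))
          (ν (map (mapT π) M) (Allₚ.map⁺ (All.tabulate moved)) (subst Unique (sym (flat-map π M)) (Uniqueₚ.map⁺ π-inj u)))
    where
    π-inj : ∀ {x y} → π x ≡ π y → x ≡ y
    π-inj {x} {y} h = trans (sym (transpose-invol i j x)) (trans (cong π h) (transpose-invol i j y))
    new-edge : ∀ p q f g → mix p q f g ≡ true → f ≢ true → q ≡ true × g ≡ true
    new-edge true true f g h nf = ⊥-elim (nf h)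
    new-edge false false f g h nf = ⊥-elim (nf h)
    new-edge true false true g h nf = ⊥-elim (nf refl)
    new-edge false true true g h nf = ⊥-elim (nf refl)
    new-edge false true false g h nf = refl , h
    e-facts = new-edge (has j e) (has i e) (F e) (F (mapT π e)) (All.lookup all e∈M) Fe≢
    fixed : ∀ τ → has j τ ≡ false → has i τ ≡ false → mapT π τ ≡ τ
    fixed (a , b , c , d) hj hi = cong₂ _,_ (fx (here refl)) (cong₂ _,_ (fx (there (here refl)))
      (cong₂ _,_ (fx (there (there (here refl)))) (fx (there (there (there (here refl)))))))
      where
      fx : ∀ {x} → x ∈ a ∷ b ∷ c ∷ d ∷ [] → π x ≡ x
      fx x∈ = transpose-else (λ { refl → absent hi x∈ }) (λ { refl → absent hj x∈ })
    moved : ∀ {τ} → τ ∈ M → F (mapT π τ) ≡ true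
    moved {τ} τ∈M = go (has j τ) (has i τ) refl refl (All.lookup all τ∈M)
      where
      go : ∀ p q → has j τ ≡ p → has i τ ≡ q → mix (has j τ) (has i τ) (F τ) (F (mapT π τ)) ≡ true → F (mapT π τ) ≡ true
      -- By disjointness only one tuple of `M` contains `i`, namely the new edge `e`, and its
      -- transpose lies in `F`.
      go p true hj hi h with owner u τ∈M e∈M (has⇒∈ i τ hi) (has⇒∈ i e (proj₁ e-facts))
      ... | refl = proj₂ e-facts
      go true false hj hi h rewrite hj | hi = ∧ʳ (F τ) h
        where
        ∧ʳ : ∀ f {g} → f ∧ g ≡ true → g ≡ true
        ∧ʳ true h = h
      go false false hj hi h = trans (cong F (fixed τ hj hi)) (subst₂ (λ p q → mix p q (F τ) (F (mapT π τ)) ≡ true) hj hi h)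

weight : Tup n → ℕ
weight (a , b , c , d) = toℕ a + (toℕ b + (toℕ c + toℕ d))

potential : Rel n → ℕ
potential F = Στ λ τ → ⟦ F τ ⟧ * weight τ

module _ (i j : Fin n) (i<j : i Fin.< j) where

  private
    π : Fin n → Fin n
    π = transpose i j

  entry-≤ : ∀ {x} → x ≢ i → toℕ (π x) ≤ toℕ x
  entry-≤ {x} ne with view i j x
  ... | left = ⊥-elim (ne refl)
  ... | right rewrite transpose-ʳ i j = <⇒≤ i<j
  ... | other p q rewrite transpose-else p q = ≤-refl

  weight-< : ∀ τ → has j τ ≡ true → has i τ ≡ false → weight (mapT π τ) < weight τ
  weight-< τ@(a , b , c , d) hj hi = go (has⇒∈ j τ hj)
    where
    le : ∀ {x} → x ∈ entries τ → toℕ (π x) ≤ toℕ x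
    le x∈ = entry-≤ λ { refl → absent {τ = τ} hi x∈ }
    lt : toℕ (π j) < toℕ j
    lt rewrite transpose-ʳ i j = i<j
    la = le {a} (here refl)
    lb = le {b} (there (here refl))
    lc = le {c} (there (there (here refl)))
    ld = le {d} (there (there (there (here refl))))
    go : j ∈ entries τ → weight (mapT π τ) < weight τ
    go (here refl) = +-mono-<-≤ lt (+-mono-≤ lb (+-mono-≤ lc ld))
    go (there (here refl)) = +-mono-≤-< la (+-mono-<-≤ lt (+-mono-≤ lc ld))
    go (there (there (here refl))) = +-mono-≤-< la (+-mono-≤-< lb (+-mono-<-≤ lt ld))
    go (there (there (there (here refl)))) = +-mono-≤-< la (+-mono-≤-< lb (+-mono-≤-< lc lt))

  private
    mixed : ∀ p q f g {u v} → (p ≡ true → q ≡ false → v < u) → (q ≡ true → p ≡ false → u < v) →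
      ⟦ mix i j p q f g ⟧ * u + ⟦ mix i j q p g f ⟧ * v ≤ ⟦ f ⟧ * u + ⟦ g ⟧ * v
    mixed true true f g h k = ≤-refl
    mixed false false f g h k = ≤-refl
    mixed true false true true h k = ≤-refl
    mixed true false true false {u} {v} h k = ≤-trans (+-monoˡ-≤ 0 (<⇒≤ (h refl refl))) (≤-reflexive (sym (+-identityʳ (u + 0))))
    mixed true false false true h k = ≤-refl
    mixed true false false false h k = ≤-refl
    mixed false true true true h k = ≤-refl
    mixed false true true false h k = ≤-refl
    mixed false true false true {u} {v} h k = ≤-trans (≤-reflexive (+-identityʳ (u + 0))) (+-monoˡ-≤ 0 (<⇒≤ (k refl refl)))
    mixed false true false false h k = ≤-refl

    mixed-< : ∀ {u v} → v < u → ⟦ mix i j true false true false ⟧ * u + ⟦ mix i j false true false true ⟧ * v < ⟦ true ⟧ * u + ⟦ false ⟧ * v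
    mixed-< {u} {v} h = ≤-trans (+-monoˡ-< 0 h) (≤-reflexive (sym (+-identityʳ (u + 0))))

  -- Within a transposed pair, membership can only move to the tuple with `i` in place of `j`, whose
  -- entries have the smaller sum; at `τ` it does move. This makes repeated shifting terminate.
  shift-potential : ∀ F τ → F τ ≡ true → has j τ ≡ true → has i τ ≡ false → F (mapT π τ) ≡ false → potential (shift i j F) < potential F
  shift-potential F τ Fτ hj hi Fπ = *-cancelˡ-< 2 _ _ (begin-strict
      2 * potential (shift i j F) ≡⟨ cong (potential (shift i j F) +_) (+-identityʳ _) ⟩
      potential (shift i j F) + potential (shift i j F) ≡⟨ double i j _ ⟩
      Στ (λ σ → ⟦ shift i j F σ ⟧ * weight σ + ⟦ shift i j F (mapT π σ) ⟧ * weight (mapT π σ))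
        <⟨ Στ-mono-< le τ lt ⟩
      Στ (λ σ → ⟦ F σ ⟧ * weight σ + ⟦ F (mapT π σ) ⟧ * weight (mapT π σ)) ≡⟨ double i j _ ⟨
      potential F + potential F ≡⟨ cong (potential F +_) (+-identityʳ _) ⟨
      2 * potential F ∎)
    where
    open ≤-Reasoning
    le : ∀ σ → ⟦ shift i j F σ ⟧ * weight σ + ⟦ shift i j F (mapT π σ) ⟧ * weight (mapT π σ) ≤ ⟦ F σ ⟧ * weight σ + ⟦ F (mapT π σ) ⟧ * weight (mapT π σ)
    le σ rewrite shift-π i j F σ = mixed (has j σ) (has i σ) (F σ) (F (mapT π σ)) (weight-< σ)
      (λ hi hj → subst (λ ρ → weight ρ < weight (mapT π σ)) (mapT-invol i j σ) (weight-< (mapT π σ) (trans (has-transpose′ i j σ) hi) (trans (has-transpose i j σ) hj)))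
    lt : ⟦ shift i j F τ ⟧ * weight τ + ⟦ shift i j F (mapT π τ) ⟧ * weight (mapT π τ) < ⟦ F τ ⟧ * weight τ + ⟦ F (mapT π τ) ⟧ * weight (mapT π τ)
    lt rewrite shift-π i j F τ | hj | hi | Fτ | Fπ = mixed-< (weight-< τ hj hi)

anyT? : {P : Tup n → Set} → (∀ τ → Dec (P τ)) → Dec (∃ P)
anyT? {n} {P} P? with Finₚ.any? (λ a → Finₚ.any? λ b → Finₚ.any? λ c → Finₚ.any? λ d → P? (a , b , c , d))
... | yes (a , b , c , d , p) = yes ((a , b , c , d) , p)
... | no ¬p = no λ { ((a , b , c , d) , p) → ¬p (a , b , c , d , p) }

shifted-exists : ∀ {F : Rel n} {s} → FourSets F → νRel F s →
  ∃ λ (G : Rel n) → FourSets G × νRel G s × Shifted G × ∣ G ∣ᵣ ≡ ∣ F ∣ᵣ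
shifted-exists {n} {F} {s} S ν = go F S ν (<-wellFounded (potential F))
  where
  go : ∀ F → FourSets F → νRel F s → Acc _<_ (potential F) → ∃ λ (G : Rel n) → FourSets G × νRel G s × Shifted G × ∣ G ∣ᵣ ≡ ∣ F ∣ᵣ
  go F S ν (acc rec) with Finₚ.any? (λ i → Finₚ.any? λ j → anyT? λ τ →
      (i Fin.<? j) ×-dec ((F τ Boolₚ.≟ true) ×-dec ((has j τ Boolₚ.≟ true) ×-dec ((has i τ Boolₚ.≟ false) ×-dec (F (mapT (transpose i j) τ) Boolₚ.≟ false)))))
  ... | yes (i , j , τ , i<j , Fτ , hj , hi , Fπ) with go (shift i j F) (shift-sets i j S) (shift-ν i j ν) (rec (shift-potential i j i<j F τ Fτ hj hi Fπ))
  ... | G , S′ , ν′ , sh , eq = G , S′ , ν′ , sh , trans eq (∣shift∣ i j F)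
  go F S ν (acc rec) | no ok = F , S , ν , stable , refl
    where
    stable : Shifted F
    stable i j τ i<j Fτ hj hi with F (mapT (transpose i j) τ) in Fπ
    ... | true = refl
    ... | false = ⊥-elim (ok (i , j , τ , i<j , Fτ , hj , hi , Fπ))

-- Rounding fractional matchings of shifted families

Distinct : (a b c d : Fin n) → Set
Distinct a b c d = a ≢ b × a ≢ c × a ≢ d × b ≢ c × b ≢ d × c ≢ d

unique⇒distinct : ∀ {a b c d : Fin n} → Unique (a ∷ b ∷ c ∷ d ∷ []) → Distinct a b c d
unique⇒distinct ((p ∷ q ∷ r ∷ []) ∷ (s ∷ t ∷ []) ∷ (u ∷ []) ∷ [] ∷ []) = p , q , r , s , t , u

sort-wlog : (P : Fin n → Fin n → Fin n → Fin n → Set) →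
  (∀ {a b c d} → P a b c d → P b a c d) → (∀ {a b c d} → P a b c d → P a c b d) → (∀ {a b c d} → P a b c d → P a b d c) →
  (∀ {a b c d} → a Fin.< b → b Fin.< c → c Fin.< d → P a b c d) →
  ∀ {a b c d} → Distinct a b c d → P a b c d
sort-wlog {n} P s₁₂ s₂₃ s₃₄ base {a} {b} {c} {d} (ab , ac , ad , bc , bd , cd) = insert₂ (Finₚ.<-cmp a b)
  where
  insert₄ : ∀ {a b c} → a Fin.< b → b Fin.< c → a ≢ d → b ≢ d → c ≢ d → P a b c d
  insert₄ {a} {b} {c} p q ad bd cd with Finₚ.<-cmp c d
  ... | tri< r _ _ = base p q r
  ... | tri≈ _ r _ = ⊥-elim (cd r)
  ... | tri> _ _ d<c with Finₚ.<-cmp b d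
  ... | tri< r _ _ = s₃₄ (base p r d<c)
  ... | tri≈ _ r _ = ⊥-elim (bd r)
  ... | tri> _ _ d<b with Finₚ.<-cmp a d
  ... | tri< r _ _ = s₃₄ (s₂₃ (base r d<b q))
  ... | tri≈ _ r _ = ⊥-elim (ad r)
  ... | tri> _ _ d<a = s₃₄ (s₂₃ (s₁₂ (base d<a p q)))
  insert₃ : ∀ {a b} → a Fin.< b → a ≢ c → b ≢ c → a ≢ d → b ≢ d → P a b c d
  insert₃ {a} {b} p ac bc ad bd with Finₚ.<-cmp b c
  ... | tri< r _ _ = insert₄ p r ad bd cd
  ... | tri≈ _ r _ = ⊥-elim (bc r)
  ... | tri> _ _ c<b with Finₚ.<-cmp a c
  ... | tri< r _ _ = s₂₃ (insert₄ r c<b ad cd bd)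
  ... | tri≈ _ r _ = ⊥-elim (ac r)
  ... | tri> _ _ c<a = s₂₃ (s₁₂ (insert₄ c<a p cd ad bd))
  insert₂ : _ → P a b c d
  insert₂ (tri< r _ _) = insert₃ r ac bc ad bd
  insert₂ (tri≈ _ r _) = ⊥-elim (ab r)
  insert₂ (tri> _ _ r) = s₁₂ (insert₃ r bc ac bd ad)

module Shift {F : Rel n} (S : FourSets F) (sh : Shifted F) where

  F-distinct : ∀ {a b c d} → F (a , b , c , d) ≡ true → Distinct a b c d
  F-distinct h = unique⇒distinct (distinct S _ h)

  step₁ : ∀ {a b c d} a′ → a′ Fin.≤ a → a′ ≢ b → a′ ≢ c → a′ ≢ d → F (a , b , c , d) ≡ true → F (a′ , b , c , d) ≡ true
  step₁ {a} {b} {c} {d} a′ le nb nc nd h with a′ Fin.≟ a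
  ... | yes refl = h
  ... | no ne with F-distinct h
  ... | ab , ac , ad , _ = trans (cong F eq) (sh a′ a (a , b , c , d) (Finₚ.≤∧≢⇒< le ne) h (∈⇒has a (a , b , c , d) (here refl)) has-a′)
    where
    eq : (a′ , b , c , d) ≡ mapT (transpose a′ a) (a , b , c , d)
    eq = sym (cong₂ _,_ (transpose-ʳ a′ a) (cong₂ _,_ (transpose-else (nb ∘ sym) (ab ∘ sym)) (cong₂ _,_ (transpose-else (nc ∘ sym) (ac ∘ sym)) (transpose-else (nd ∘ sym) (ad ∘ sym)))))
    has-a′ : has a′ (a , b , c , d) ≡ false
    has-a′ rewrite ==-≢ ne | ==-≢ nb | ==-≢ nc | ==-≢ nd = refl

  step₂ : ∀ {a b c d} b′ → b′ Fin.≤ b → b′ ≢ a → b′ ≢ c → b′ ≢ d → F (a , b , c , d) ≡ true → F (a , b′ , c , d) ≡ true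
  step₂ b′ le na nc nd h = trans (sym₁₂ S _ _ _ _) (step₁ b′ le na nc nd (trans (sym₁₂ S _ _ _ _) h))

  step₃ : ∀ {a b c d} c′ → c′ Fin.≤ c → c′ ≢ a → c′ ≢ b → c′ ≢ d → F (a , b , c , d) ≡ true → F (a , b , c′ , d) ≡ true
  step₃ c′ le na nb nd h = trans (sym₂₃ S _ _ _ _) (step₂ c′ le na nb nd (trans (sym₂₃ S _ _ _ _) h))

  step₄ : ∀ {a b c d} d′ → d′ Fin.≤ d → d′ ≢ a → d′ ≢ b → d′ ≢ c → F (a , b , c , d) ≡ true → F (a , b , c , d′) ≡ true
  step₄ d′ le na nb nc h = trans (sym₃₄ S _ _ _ _) (step₃ d′ le na nb nc (trans (sym₃₄ S _ _ _ _) h))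

  private
    P : Fin n → Fin n → Fin n → Fin n → Set
    P a b c d = F (a , b , c , d) ≡ true → ∀ a′ b′ c′ d′ → a′ Fin.≤ a → b′ Fin.≤ b → c′ Fin.≤ c → d′ Fin.≤ d →
      Distinct a′ b′ c′ d′ → F (a′ , b′ , c′ , d′) ≡ true

    ≤<⇒≢ : ∀ {x y z : Fin n} → x Fin.≤ y → y Fin.< z → x ≢ z
    ≤<⇒≢ p q refl = <⇒≱ q p

    -- Entries are lowered from the smallest to the largest. Those already lowered are different
    -- from the new entry by assumption, those still to come are larger than it, so every
    -- intermediate tuple has distinct entries.
    sorted : ∀ {a b c d} → a Fin.< b → b Fin.< c → c Fin.< d → P a b c d
    sorted p q r h a′ b′ c′ d′ pa pb pc pd (ab , ac , ad , bc , bd , cd) =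
      step₄ d′ pd (ad ∘ sym) (bd ∘ sym) (cd ∘ sym)
      (step₃ c′ pc (ac ∘ sym) (bc ∘ sym) (≤<⇒≢ pc r)
      (step₂ b′ pb (ab ∘ sym) (≤<⇒≢ pb q) (≤<⇒≢ pb (Finₚ.<-trans q r))
      (step₁ a′ pa (≤<⇒≢ pa p) (≤<⇒≢ pa (Finₚ.<-trans p q)) (≤<⇒≢ pa (Finₚ.<-trans p (Finₚ.<-trans q r))) h)))

    p₁₂ : ∀ {a b c d} → P a b c d → P b a c d
    p₁₂ f h a′ b′ c′ d′ pa pb pc pd (ab , ac , ad , bc , bd , cd) =
      trans (sym₁₂ S _ _ _ _) (f (trans (sym₁₂ S _ _ _ _) h) b′ a′ c′ d′ pb pa pc pd ((ab ∘ sym) , bc , bd , ac , ad , cd))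

    p₂₃ : ∀ {a b c d} → P a b c d → P a c b d
    p₂₃ f h a′ b′ c′ d′ pa pb pc pd (ab , ac , ad , bc , bd , cd) =
      trans (sym₂₃ S _ _ _ _) (f (trans (sym₂₃ S _ _ _ _) h) a′ c′ b′ d′ pa pc pb pd (ac , ab , ad , (bc ∘ sym) , cd , bd))

    p₃₄ : ∀ {a b c d} → P a b c d → P a b d c
    p₃₄ f h a′ b′ c′ d′ pa pb pc pd (ab , ac , ad , bc , bd , cd) =
      trans (sym₃₄ S _ _ _ _) (f (trans (sym₃₄ S _ _ _ _) h) a′ b′ d′ c′ pa pb pd pc (ab , ad , ac , bd , bc , (cd ∘ sym)))

  dominated : ∀ {a b c d} → F (a , b , c , d) ≡ true → ∀ {a′ b′ c′ d′} → a′ Fin.≤ a → b′ Fin.≤ b → c′ Fin.≤ c → d′ Fin.≤ d →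
    Distinct a′ b′ c′ d′ → F (a′ , b′ , c′ , d′) ≡ true
  dominated h pa pb pc pd = sort-wlog P p₁₂ p₂₃ p₃₄ sorted (F-distinct h) h _ _ _ _ pa pb pc pd

sumL : {A : Set} → (A → ℕ) → List A → ℕ
sumL f [] = 0
sumL f (x ∷ xs) = f x + sumL f xs

sumL-++ : ∀ {A : Set} (f : A → ℕ) xs ys → sumL f (xs ++ ys) ≡ sumL f xs + sumL f ys
sumL-++ f [] ys = refl
sumL-++ f (x ∷ xs) ys = trans (cong (f x +_) (sumL-++ f xs ys)) (sym (+-assoc (f x) _ _))

sumL-replicate : ∀ {A : Set} (f : A → ℕ) k x → sumL f (replicate k x) ≡ k * f x
sumL-replicate f zero x = refl
sumL-replicate f (suc k) x = cong (f x +_) (sumL-replicate f k x)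

sumL-1 : ∀ {A : Set} (xs : List A) → sumL (λ _ → 1) xs ≡ length xs
sumL-1 [] = refl
sumL-1 (x ∷ xs) = cong suc (sumL-1 xs)

sumL-mono : ∀ {A : Set} {f g : A → ℕ} xs → (∀ x → f x ≤ g x) → sumL f xs ≤ sumL g xs
sumL-mono [] h = z≤n
sumL-mono (x ∷ xs) h = +-mono-≤ (h x) (sumL-mono xs h)

sumL-∑ : ∀ {A : Set} (f : A → Fin n → ℕ) xs → sumL (λ x → ∑ (f x)) xs ≡ ∑ (λ i → sumL (λ x → f x i) xs)
sumL-∑ {n} f [] = sym (trans (∑-const n 0) (*-zeroʳ n))
sumL-∑ f (x ∷ xs) = trans (cong (∑ (f x) +_) (sumL-∑ f xs)) (sym (∑-distrib-+ (f x) (λ i → sumL (λ x → f x i) xs)))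

sumL-*ˡ : ∀ {A : Set} c (f : A → ℕ) xs → sumL (λ x → c * f x) xs ≡ c * sumL f xs
sumL-*ˡ c f [] = sym (*-zeroʳ c)
sumL-*ˡ c f (x ∷ xs) = trans (cong (c * f x +_) (sumL-*ˡ c f xs)) (sym (*-distribˡ-+ c (f x) _))

sumL-partition : ∀ {A : Set} {P : A → Set} (P? : ∀ x → Dec (P x)) (f : A → ℕ) xs →
  sumL f xs ≡ sumL f (filter P? xs) + sumL f (filter (λ x → ¬? (P? x)) xs)
sumL-partition P? f [] = refl
sumL-partition P? f (x ∷ xs) with P? x
... | yes p = trans (cong (f x +_) (sumL-partition P? f xs)) (sym (+-assoc (f x) _ _))
... | no p = trans (cong (f x +_) (sumL-partition P? f xs)) (e (f x) (sumL f (filter P? xs)) _)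
  where
  e : ∀ a b c → a + (b + c) ≡ b + (a + c)
  e = solve-∀

-- Keep one element out of every t with the same key.
thin : ∀ {A K : Set} (_≟ᴷ_ : DecidableEquality K) (key : A → K) (t : ℕ) .{{_ : NonZero t}} {P : A → Set} (ks : List K) (B : List A) →
  All P B → All (λ x → key x ∈ ks) B →
  ∃ λ R → All P R × length B ≤ t * length R + t * length ks × (∀ (g : K → ℕ) → t * sumL (g ∘ key) R ≤ sumL (g ∘ key) B)
thin _≟ᴷ_ key t [] [] [] [] = [] , [] , z≤n , λ g → ≤-reflexive (*-zeroʳ t)
thin _≟ᴷ_ key t [] (x ∷ B) pB (() ∷ kB)
thin _≟ᴷ_ key t {P} (k ∷ ks) B pB kB = go (thin _≟ᴷ_ key t ks rest (Allₚ.filter⁺ (λ x → ¬? (key x ≟ᴷ k)) pB) rest∈)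
  where
  group rest : List _
  group = filter (λ x → key x ≟ᴷ k) B
  rest = filter (λ x → ¬? (key x ≟ᴷ k)) B
  rest∈ : All (λ x → key x ∈ ks) rest
  rest∈ = All.map drop-head (All.zip (Allₚ.filter⁺ (λ x → ¬? (key x ≟ᴷ k)) kB , Allₚ.all-filter (λ x → ¬? (key x ≟ᴷ k)) B))
    where
    drop-head : ∀ {x} → (key x ∈ k ∷ ks) × (key x ≢ k) → key x ∈ ks
    drop-head (here p , q) = ⊥-elim (q p)
    drop-head (there p , q) = p
  groupkey : All (λ x → key x ≡ k) group
  groupkey = Allₚ.all-filter (λ x → key x ≟ᴷ k) B
  constant : ∀ (g : _ → ℕ) xs → All (λ x → key x ≡ k) xs → sumL (g ∘ key) xs ≡ length xs * g k
  constant g [] [] = refl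
  constant g (x ∷ xs) (h ∷ hs) = cong₂ _+_ (cong g h) (constant g xs hs)
  splitlen : length B ≡ length group + length rest
  splitlen = trans (sym (sumL-1 B)) (trans (sumL-partition (λ x → key x ≟ᴷ k) (λ _ → 1) B) (cong₂ _+_ (sumL-1 group) (sumL-1 rest)))
  go : _ → _
  go (R , pR , len , bnd) = choose group (Allₚ.filter⁺ (λ x → key x ≟ᴷ k) pB) groupkey refl
    where
    choose : ∀ G → All P G → All (λ x → key x ≡ k) G → G ≡ group →
      ∃ λ R → All P R × length B ≤ t * length R + t * length (k ∷ ks) × (∀ (g : _ → ℕ) → t * sumL (g ∘ key) R ≤ sumL (g ∘ key) B)
    choose [] _ _ eq = R , pR , ≤-trans (≤-reflexive (trans splitlen (cong (λ G → length G + length rest) (sym eq)))) (≤-trans len (+-monoʳ-≤ (t * length R) (*-monoʳ-≤ t (n≤1+n _))))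
      , λ g → ≤-trans (bnd g) (≤-trans (m≤n+m _ _) (≤-reflexive (sym (sumL-partition (λ x → key x ≟ᴷ k) (g ∘ key) B))))
    -- Any member can represent its group, as only keys are counted afterwards. The remainder of the
    -- division by `t` is lost, and the summand `t` for the key `k` pays for it.
    choose (x ∷ G) (px ∷ pG) (kx ∷ kG) eq = replicate c x ++ R , Allₚ.++⁺ (Allₚ.replicate⁺ c px) pR , len′ , bnd′
      where
      l = length (x ∷ G)
      c = l / t
      l≤ : l ≤ t + t * c
      l≤ = ≤-trans (≤-reflexive (m≡m%n+[m/n]*n l t)) (+-mono-≤ (<⇒≤ (m%n<n l t)) (≤-reflexive (*-comm c t)))
      len′ : length B ≤ t * length (replicate c x ++ R) + t * suc (length ks)
      len′ = begin
        length B ≡⟨ splitlen ⟩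
        length group + length rest ≡⟨ cong (λ G → length G + length rest) (sym eq) ⟩
        l + length rest ≤⟨ +-mono-≤ l≤ len ⟩
        (t + t * c) + (t * length R + t * length ks) ≡⟨ e t c (length R) (length ks) ⟩
        t * (c + length R) + t * suc (length ks) ≡⟨ cong (λ z → t * z + t * suc (length ks)) (sym (trans (Listₚ.length-++ (replicate c x)) (cong (_+ length R) (Listₚ.length-replicate c)))) ⟩
        t * length (replicate c x ++ R) + t * suc (length ks) ∎
        where
        open ≤-Reasoning
        e : ∀ t c r k → (t + t * c) + (t * r + t * k) ≡ t * (c + r) + t * suc k
        e = solve-∀
      bnd′ : ∀ (g : _ → ℕ) → t * sumL (g ∘ key) (replicate c x ++ R) ≤ sumL (g ∘ key) B
      bnd′ g = begin
        t * sumL (g ∘ key) (replicate c x ++ R) ≡⟨ cong (t *_) (trans (sumL-++ (g ∘ key) (replicate c x) R) (cong (_+ sumL (g ∘ key) R) (sumL-replicate (g ∘ key) c x))) ⟩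
        t * (c * g (key x) + sumL (g ∘ key) R) ≡⟨ e t c (g (key x)) (sumL (g ∘ key) R) ⟩
        (c * t) * g (key x) + t * sumL (g ∘ key) R ≤⟨ +-mono-≤ (*-monoˡ-≤ (g (key x)) (m/n*n≤m l t)) (bnd g) ⟩
        l * g (key x) + sumL (g ∘ key) rest ≡⟨ cong (λ z → l * g z + sumL (g ∘ key) rest) kx ⟩
        l * g k + sumL (g ∘ key) rest ≡⟨ cong (_+ sumL (g ∘ key) rest) (constant g (x ∷ G) (kx ∷ kG)) ⟨
        sumL (g ∘ key) (x ∷ G) + sumL (g ∘ key) rest ≡⟨ cong (λ G → sumL (g ∘ key) G + sumL (g ∘ key) rest) eq ⟩
        sumL (g ∘ key) group + sumL (g ∘ key) rest ≡⟨ sumL-partition (λ x → key x ≟ᴷ k) (g ∘ key) B ⟨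
        sumL (g ∘ key) B ∎
        where
        open ≤-Reasoning
        e : ∀ t c g s → t * (c * g + s) ≡ (c * t) * g + t * s
        e = solve-∀

∑-toℕ-≡ : ∀ {n} m → ∑ {n} (λ v → ⟦ toℕ v ≡ᵇ m ⟧) ≤ 1
∑-toℕ-≡ {zero} m = z≤n
∑-toℕ-≡ {suc n} zero = s≤s (≤-reflexive (trans (∑-const n 0) (*-zeroʳ n)))
∑-toℕ-≡ {suc n} (suc m) = ∑-toℕ-≡ {n} m

≡ᵇ-refl : ∀ m → (m ≡ᵇ m) ≡ true
≡ᵇ-refl zero = refl
≡ᵇ-refl (suc m) = ≡ᵇ-refl m

≡ᵇ-true : ∀ m k → (m ≡ᵇ k) ≡ true → m ≡ k
≡ᵇ-true zero zero h = refl
≡ᵇ-true (suc m) (suc k) h = cong suc (≡ᵇ-true m k h)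

cnt : Fin n → Tup n → ℕ
cnt v (a , b , c , d) = ⟦ v == a ⟧ + (⟦ v == b ⟧ + (⟦ v == c ⟧ + ⟦ v == d ⟧))

wt : (Fin n → ℕ) → Tup n → ℕ
wt w (a , b , c , d) = w a + (w b + (w c + w d))

∑-pick : ∀ (a : Fin n) (w : Fin n → ℕ) → ∑ (λ v → ⟦ v == a ⟧ * w v) ≡ w a
∑-pick {suc n} zero w = trans (cong₂ _+_ (+-identityʳ (w zero)) (trans (∑-const n 0) (*-zeroʳ n))) (+-identityʳ (w zero))
∑-pick {suc n} (suc a) w = ∑-pick a (w ∘ suc)

∑-cnt : ∀ (w : Fin n → ℕ) τ → ∑ (λ v → cnt v τ * w v) ≡ wt w τ
∑-cnt w (a , b , c , d) = begin
  ∑ (λ v → (⟦ v == a ⟧ + (⟦ v == b ⟧ + (⟦ v == c ⟧ + ⟦ v == d ⟧))) * w v)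
    ≡⟨ sum-cong-≗ (λ v → e ⟦ v == a ⟧ ⟦ v == b ⟧ ⟦ v == c ⟧ ⟦ v == d ⟧ (w v)) ⟩
  ∑ (λ v → f a v + (f b v + (f c v + f d v)))
    ≡⟨ ∑-distrib-+ (f a) (λ v → f b v + (f c v + f d v)) ⟩
  ∑ (f a) + ∑ (λ v → f b v + (f c v + f d v))
    ≡⟨ cong (∑ (f a) +_) (trans (∑-distrib-+ (f b) (λ v → f c v + f d v)) (cong (∑ (f b) +_) (∑-distrib-+ (f c) (f d)))) ⟩
  ∑ (f a) + (∑ (f b) + (∑ (f c) + ∑ (f d)))
    ≡⟨ cong₂ _+_ (∑-pick a w) (cong₂ _+_ (∑-pick b w) (cong₂ _+_ (∑-pick c w) (∑-pick d w))) ⟩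
  w a + (w b + (w c + w d)) ∎
  where
  open ≡-Reasoning
  f : Fin _ → Fin _ → ℕ
  f x v = ⟦ v == x ⟧ * w v
  e : ∀ p q r s w → (p + (q + (r + s))) * w ≡ p * w + (q * w + (r * w + s * w))
  e = solve-∀

load : List (Tup n) → Fin n → ℕ
load B v = sumL (cnt v) B

sumL-wt : ∀ (w : Fin n → ℕ) B → sumL (wt w) B ≡ ∑ (λ v → load B v * w v)
sumL-wt w B = trans (go B) (trans (sumL-∑ (λ τ v → cnt v τ * w v) B) (sum-cong-≗ (λ v → comm v B)))
  where
  go : ∀ B → sumL (wt w) B ≡ sumL (λ τ → ∑ (λ v → cnt v τ * w v)) B
  go [] = refl
  go (τ ∷ B) = cong₂ _+_ (sym (∑-cnt w τ)) (go B)
  comm : ∀ v B → sumL (λ τ → cnt v τ * w v) B ≡ load B v * w v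
  comm v [] = refl
  comm v (τ ∷ B) = trans (cong (cnt v τ * w v +_) (comm v B)) (sym (*-distribʳ-+ (w v) (cnt v τ) _))

module Rounding (L : ℕ) .{{_ : NonZero L}} where

  blk : Fin n → ℕ
  blk v = toℕ v / L

  inblk : ℕ → Fin n → ℕ
  inblk j v = ⟦ blk v ≡ᵇ j ⟧

  ∑-inblk : ∀ {n} j → ∑ {n} (inblk j) ≤ L
  ∑-inblk {n} j = begin
      ∑ {n} (inblk j) ≤⟨ ∑-mono cover ⟩
      ∑ {n} (λ v → ∑ {L} (λ r → ⟦ toℕ v ≡ᵇ toℕ r + j * L ⟧)) ≡⟨ ∑-comm {n} {L} (λ v r → ⟦ toℕ v ≡ᵇ toℕ r + j * L ⟧) ⟩
      ∑ {L} (λ r → ∑ {n} (λ v → ⟦ toℕ v ≡ᵇ toℕ r + j * L ⟧)) ≤⟨ ∑-mono {L} (λ r → ∑-toℕ-≡ {n} (toℕ r + j * L)) ⟩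
      ∑ {L} (λ r → 1) ≡⟨ trans (∑-const L 1) (*-identityʳ L) ⟩
      L ∎
    where
    open ≤-Reasoning
    cover : ∀ (v : Fin n) → inblk j v ≤ ∑ {L} (λ r → ⟦ toℕ v ≡ᵇ toℕ r + j * L ⟧)
    cover v with blk v ≡ᵇ j in eq
    ... | false = z≤n
    ... | true = ≤-trans (≤-reflexive (sym (cong ⟦_⟧ hit))) (term≤∑ (λ r → ⟦ toℕ v ≡ᵇ toℕ r + j * L ⟧) r)
      where
      r : Fin L
      r = fromℕ< (m%n<n (toℕ v) L)
      same : toℕ v ≡ toℕ r + j * L
      same = trans (m≡m%n+[m/n]*n (toℕ v) L) (cong₂ _+_ (sym (Finₚ.toℕ-fromℕ< (m%n<n (toℕ v) L))) (cong (_* L) (≡ᵇ-true (blk v) j eq)))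
      hit : (toℕ v ≡ᵇ toℕ r + j * L) ≡ true
      hit = trans (cong (toℕ v ≡ᵇ_) (sym same)) (≡ᵇ-refl (toℕ v))

  occ : ℕ → List (Fin n) → ℕ
  occ j = sumL (inblk j)

  -- Since `a` lies in the next interval, interval `j` is complete: it has `L` vertices, more than
  -- `X` occupies.
  fresh : ∀ (X : List (Fin n)) (a : Fin n) j → blk a ≡ suc j → occ j X < L →
    ∃ λ a′ → blk a′ ≡ j × a′ ∉ X × a′ Fin.≤ a
  fresh {n} X a j ba few with Finₚ.any? (λ v → (blk v ≟ j) ×-dec ¬? (any? (v Fin.≟_) X))
  ... | yes (v , bv , v∉X) = v , bv , v∉X , <⇒≤ (≰⇒> λ a≤v → <⇒≱ (n<1+n j) (≤-trans (≤-reflexive (sym ba)) (≤-trans (/-monoˡ-≤ L a≤v) (≤-reflexive bv))))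
  ... | no none = ⊥-elim (<⇒≱ few (begin
      L ≡⟨ trans (∑-const L 1) (*-identityʳ L) ⟨
      ∑ {L} (λ r → 1) ≤⟨ ∑-mono full ⟩
      ∑ {L} (λ r → sumL (λ x → ⟦ toℕ x ≡ᵇ toℕ r + j * L ⟧) X) ≡⟨ sumL-∑ {L} (λ x r → ⟦ toℕ x ≡ᵇ toℕ r + j * L ⟧) X ⟨
      sumL (λ x → ∑ {L} (λ r → ⟦ toℕ x ≡ᵇ toℕ r + j * L ⟧)) X ≤⟨ sumL-mono X one ⟩
      occ j X ∎))
    where
    open ≤-Reasoning
    in-range : ∀ (r : Fin L) → toℕ r + j * L < n
    in-range r = ≤-trans (+-monoˡ-< (j * L) (Finₚ.toℕ<n r)) (≤-trans (≤-reflexive (sym (cong (_* L) ba))) (≤-trans (m/n*n≤m (toℕ a) L) (<⇒≤ (Finₚ.toℕ<n a))))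
    blk-of : ∀ (r : Fin L) m → m ≡ toℕ r + j * L → m / L ≡ j
    blk-of r m refl = trans (+-distrib-/-∣ʳ (toℕ r) (divides-refl j)) (trans (cong₂ _+_ (m<n⇒m/n≡0 (Finₚ.toℕ<n r)) (m*n/n≡m j L)) refl)
      where open import Data.Nat.Divisibility using (divides-refl)
    count : ∀ (X : List (Fin n)) v → v ∈ X → 1 ≤ sumL (λ x → ⟦ toℕ x ≡ᵇ toℕ v ⟧) X
    count (x ∷ X) v (here refl) rewrite ≡ᵇ-refl (toℕ v) = s≤s z≤n
    count (x ∷ X) v (there p) = ≤-trans (count X v p) (m≤n+m _ _)
    full : ∀ (r : Fin L) → 1 ≤ sumL (λ x → ⟦ toℕ x ≡ᵇ toℕ r + j * L ⟧) X
    full r with any? (fromℕ< (in-range r) Fin.≟_) X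
    ... | yes p = subst (λ m → 1 ≤ sumL (λ x → ⟦ toℕ x ≡ᵇ m ⟧) X) (Finₚ.toℕ-fromℕ< (in-range r)) (count X _ p)
    ... | no p = ⊥-elim (none (_ , blk-of r _ (Finₚ.toℕ-fromℕ< (in-range r)) , p))
    one : ∀ (x : Fin n) → ∑ {L} (λ r → ⟦ toℕ x ≡ᵇ toℕ r + j * L ⟧) ≤ inblk j x
    one x with blk x ≡ᵇ j in eq
    ... | true = ≤-trans (∑-mono (λ r → ≤-reflexive (cong ⟦_⟧ (shift-eq r)))) (∑-toℕ-≡ {L} (toℕ x ∸ j * L))
      where
      jL≤x : j * L ≤ toℕ x
      jL≤x = ≤-trans (≤-reflexive (cong (_* L) (sym (≡ᵇ-true (blk x) j eq)))) (m/n*n≤m (toℕ x) L)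
      shift-eq : ∀ (r : Fin L) → (toℕ x ≡ᵇ toℕ r + j * L) ≡ (toℕ r ≡ᵇ toℕ x ∸ j * L)
      shift-eq r with toℕ x ≡ᵇ toℕ r + j * L in e₁ | toℕ r ≡ᵇ toℕ x ∸ j * L in e₂
      ... | true | true = refl
      ... | false | false = refl
      ... | true | false = trans (sym (≡ᵇ-refl (toℕ r))) (trans (cong (toℕ r ≡ᵇ_) (sym (trans (cong (_∸ j * L) (≡ᵇ-true (toℕ x) (toℕ r + j * L) e₁)) (m+n∸n≡m (toℕ r) (j * L))))) e₂)
      ... | false | true = sym (trans (sym (≡ᵇ-refl (toℕ x))) (trans (cong (toℕ x ≡ᵇ_) (sym (trans (cong (_+ j * L) (≡ᵇ-true (toℕ r) (toℕ x ∸ j * L) e₂)) (m∸n+n≡m jL≤x)))) e₁))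
    ... | false = ≤-trans (∑-mono (λ r → no-hit r)) (≤-reflexive (trans (∑-const L 0) (*-zeroʳ L)))
      where
      no-hit : ∀ (r : Fin L) → ⟦ toℕ x ≡ᵇ toℕ r + j * L ⟧ ≤ 0
      no-hit r with toℕ x ≡ᵇ toℕ r + j * L in e₁
      ... | false = z≤n
      ... | true with trans (sym eq) (trans (cong (_≡ᵇ j) (blk-of r (toℕ x) (≡ᵇ-true (toℕ x) (toℕ r + j * L) e₁))) (≡ᵇ-refl j))
      ... | ()

  blkcnt : ℕ → Tup n → ℕ
  blkcnt j = wt (inblk j)

  High : Tup n → Set
  High (a , b , c , d) = (∃ λ j → blk a ≡ suc j) × (∃ λ j → blk b ≡ suc j) × (∃ λ j → blk c ≡ suc j) × (∃ λ j → blk d ≡ suc j)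

  module _ {F : Rel n} (S : FourSets F) (sh : Shifted F) where
    open Shift S sh

    realise : ∀ R → All (λ τ → F τ ≡ true × High τ) R → (∀ j → sumL (blkcnt (suc j)) R ≤ L) →
      ∃ λ M → All (λ τ → F τ ≡ true) M × Unique (flat M) × length M ≡ length R × (∀ j → occ j (flat M) ≡ sumL (blkcnt (suc j)) R)
    realise [] [] _ = [] , [] , [] , refl , λ j → refl
    realise ((a , b , c , d) ∷ R) ((Fτ , (ja , ha) , (jb , hb) , (jc , hc) , (jd , hd)) ∷ all) cap = extend (realise R all (λ j → ≤-trans (m≤n+m _ _) (cap j)))
      where
      up : ∀ {x x′ : Fin n} {i} j → blk x′ ≡ i → blk x ≡ suc i → inblk (suc j) x ≡ inblk j x′
      up j refl h = cong (λ z → ⟦ z ≡ᵇ suc j ⟧) h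
      extend : _ → _
      extend (M , FM , uM , len , same) = pick-d (fresh (flat M) d jd hd room-d)
        where
        self : ∀ {x : Fin n} {i} → blk x ≡ i → inblk i x ≡ 1
        self {x} refl = cong ⟦_⟧ (≡ᵇ-refl (blk x))
        total : ∀ j → inblk (suc j) a + (inblk (suc j) b + (inblk (suc j) c + inblk (suc j) d)) + occ j (flat M) ≤ L
        total j = ≤-trans (≤-reflexive (cong (inblk (suc j) a + (inblk (suc j) b + (inblk (suc j) c + inblk (suc j) d)) +_) (same j))) (cap j)
        room-d : occ jd (flat M) < L
        room-d = ≤-trans (≤-trans (m≤n+m _ (p + (q + r))) (≤-reflexive (e p q r (occ jd (flat M))))) (≤-trans (≤-reflexive (cong (λ z → p + (q + (r + z)) + occ jd (flat M)) (sym (self hd)))) (total jd))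
          where
          p = inblk (suc jd) a
          q = inblk (suc jd) b
          r = inblk (suc jd) c
          e : ∀ p q r o → (p + (q + r)) + suc o ≡ p + (q + (r + 1)) + o
          e = solve-∀
        pick-d : _ → _
        pick-d (d′ , bd , d∉ , d≤) = pick-c (fresh (d′ ∷ flat M) c jc hc room-c)
          where
          room-c : inblk jc d′ + occ jc (flat M) < L
          room-c = ≤-trans (≤-trans (m≤n+m _ (p + q)) (≤-reflexive (e p q (inblk jc d′) (occ jc (flat M)))))
            (≤-trans (≤-reflexive (cong₂ (λ z y → p + (q + (z + y)) + occ jc (flat M)) (sym (self hc)) (sym (up jc bd hd)))) (total jc))
            where
            p = inblk (suc jc) a
            q = inblk (suc jc) b
            e : ∀ p q r o → (p + q) + (1 + (r + o)) ≡ p + (q + (1 + r)) + o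
            e = solve-∀
          pick-c : _ → _
          pick-c (c′ , bc , c∉ , c≤) = pick-b (fresh (c′ ∷ d′ ∷ flat M) b jb hb room-b)
            where
            room-b : inblk jb c′ + (inblk jb d′ + occ jb (flat M)) < L
            room-b = ≤-trans (≤-trans (m≤n+m _ p) (≤-reflexive (e p (inblk jb c′) (inblk jb d′) (occ jb (flat M)))))
              (≤-trans (≤-reflexive (trans (cong₂ (λ z y → p + (z + (y + inblk jb d′)) + occ jb (flat M)) (sym (self hb)) (sym (up jb bc hc)))
                (cong (λ x → p + (inblk (suc jb) b + (inblk (suc jb) c + x)) + occ jb (flat M)) (sym (up jb bd hd))))) (total jb))
              where
              p = inblk (suc jb) a
              e : ∀ p q r o → p + (1 + (q + (r + o))) ≡ p + (1 + (q + r)) + o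
              e = solve-∀
            pick-b : _ → _
            pick-b (b′ , bb , b∉ , b≤) = pick-a (fresh (b′ ∷ c′ ∷ d′ ∷ flat M) a ja ha room-a)
              where
              room-a : inblk ja b′ + (inblk ja c′ + (inblk ja d′ + occ ja (flat M))) < L
              room-a = ≤-trans (≤-reflexive (e (inblk ja b′) (inblk ja c′) (inblk ja d′) (occ ja (flat M))))
                (≤-trans (≤-reflexive (trans (cong₂ (λ z y → z + (y + (inblk ja c′ + inblk ja d′)) + occ ja (flat M)) (sym (self ha)) (sym (up ja bb hb)))
                  (cong₂ (λ x y → inblk (suc ja) a + (inblk (suc ja) b + (x + y)) + occ ja (flat M)) (sym (up ja bc hc)) (sym (up ja bd hd))))) (total ja))
                where
                e : ∀ p q r o → 1 + (p + (q + (r + o))) ≡ 1 + (p + (q + r)) + o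
                e = solve-∀
              pick-a : _ → _
              pick-a (a′ , ba , a∉ , a≤) = (a′ , b′ , c′ , d′) ∷ M
                , dominated Fτ a≤ b≤ c≤ d≤ (unique⇒distinct uniq₄) ∷ FM
                , uniq
                , cong suc len
                , λ j → trans (e (inblk j a′) (inblk j b′) (inblk j c′) (inblk j d′) (occ j (flat M)))
                    (cong₂ _+_ (sym (cong₂ _+_ (up j ba ha) (cong₂ _+_ (up j bb hb) (cong₂ _+_ (up j bc hc) (up j bd hd))))) (same j))
                where
                e : ∀ a b c d o → a + (b + (c + (d + o))) ≡ (a + (b + (c + d))) + o
                e = solve-∀
                uniq : Unique (flat ((a′ , b′ , c′ , d′) ∷ M))
                uniq = Allₚ.¬Any⇒All¬ _ a∉ ∷ Allₚ.¬Any⇒All¬ _ b∉ ∷ Allₚ.¬Any⇒All¬ _ c∉ ∷ Allₚ.¬Any⇒All¬ _ d∉ ∷ uM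
                uniq₄ : Unique (a′ ∷ b′ ∷ c′ ∷ d′ ∷ [])
                uniq₄ with uniq
                ... | (p ∷ q ∷ r ∷ _) ∷ (s ∷ t ∷ _) ∷ (u ∷ _) ∷ _ ∷ _ = (p ∷ q ∷ r ∷ []) ∷ (s ∷ t ∷ []) ∷ (u ∷ []) ∷ [] ∷ []

    Key : Set
    Key = ℕ × (ℕ × (ℕ × ℕ))

    key : Tup n → Key
    key (a , b , c , d) = blk a , blk b , blk c , blk d

    keys : ℕ → List Key
    keys q = cartesianProduct (upTo q) (cartesianProduct (upTo q) (cartesianProduct (upTo q) (upTo q)))

    length-keys : ∀ q → length (keys q) ≡ q * (q * (q * q))
    length-keys q = trans (len (upTo q) _) (cong₂ _*_ (Listₚ.length-upTo q) (trans (len (upTo q) _) (cong₂ _*_ (Listₚ.length-upTo q) (trans (len (upTo q) _) (cong₂ _*_ (Listₚ.length-upTo q) (Listₚ.length-upTo q))))))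
      where
      len : ∀ {A B : Set} (xs : List A) (ys : List B) → length (cartesianProduct xs ys) ≡ length xs * length ys
      len [] ys = refl
      len (x ∷ xs) ys = trans (Listₚ.length-++ (map (x ,_) ys)) (cong₂ _+_ (Listₚ.length-map (x ,_) ys) (len xs ys))

    high? : ∀ (τ : Tup n) → High τ ⊎ 1 ≤ blkcnt 0 τ
    high? (a , b , c , d) with blk a in ea | blk b in eb | blk c in ec | blk d in ed
    ... | zero | _ | _ | _ = inj₂ (s≤s z≤n)
    ... | suc _ | zero | _ | _ = inj₂ (s≤s z≤n)
    ... | suc _ | suc _ | zero | _ = inj₂ (s≤s z≤n)
    ... | suc _ | suc _ | suc _ | zero = inj₂ (s≤s z≤n)
    ... | suc i | suc j | suc k | suc l = inj₁ ((i , refl) , (j , refl) , (k , refl) , (l , refl))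

    -- Drop the edges that meet the first interval, thin out each type, and move what is left one
    -- interval down, where every vertex may be used because F is shifted.
    rounding : ∀ {s} q t → n ≤ q * L → νRel F s → 0 < t → ∀ B → All (λ τ → F τ ≡ true) B → (∀ v → load B v ≤ t) →
      length B ≤ t * (s + (q * (q * (q * q)) + L))
    rounding {s} q t n≤qL ν 0<t B FB loads = finish (thin (≡-dec _≟_ (≡-dec _≟_ (≡-dec _≟_ _≟_))) key t (keys q) (proj₁ highs) (proj₁ (proj₂ highs)) (All.tabulate λ {τ} _ → inkeys τ))
      where
      open ≤-Reasoning
      instance _ = >-nonZero 0<t
      -- An interval has at most `L` vertices of load at most `t`. For interval 0 this bounds the
      -- loss from dropped edges; for the others, thinning divides it by `t` and leaves the capacity
      -- `L` that `realise` asks for.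
      blkload : ∀ j → sumL (blkcnt j) B ≤ t * L
      blkload j = begin
        sumL (blkcnt j) B ≡⟨ sumL-wt (inblk j) B ⟩
        ∑ (λ v → load B v * inblk j v) ≤⟨ ∑-mono {n} (λ v → *-monoˡ-≤ (inblk j v) (loads v)) ⟩
        ∑ {n} (λ v → t * inblk j v) ≡⟨ *-distribˡ-sum {n} t (inblk j) ⟨
        t * ∑ {n} (inblk j) ≤⟨ *-monoʳ-≤ t (∑-inblk {n} j) ⟩
        t * L ∎
      select : ∀ B → All (λ τ → F τ ≡ true) B → ∃ λ B₁ → All (λ τ → F τ ≡ true × High τ) B₁ × length B ≤ length B₁ + sumL (blkcnt 0) B × (∀ (f : Tup n → ℕ) → sumL f B₁ ≤ sumL f B)
      select [] [] = [] , [] , z≤n , λ f → z≤n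
      select (τ ∷ B) (Fτ ∷ FB) with select B FB | high? τ
      ... | B₁ , A , len , sub | inj₁ h = τ ∷ B₁ , (Fτ , h) ∷ A , s≤s (≤-trans len (+-monoʳ-≤ (length B₁) (m≤n+m _ _))) , λ f → +-monoʳ-≤ (f τ) (sub f)
      ... | B₁ , A , len , sub | inj₂ h = B₁ , A , ≤-trans (+-mono-≤ h len) (≤-reflexive (e (blkcnt 0 τ) (length B₁) _)) , λ f → ≤-trans (sub f) (m≤n+m _ _)
        where
        e : ∀ a b c → a + (b + c) ≡ b + (a + c)
        e = solve-∀
      highs = select B FB
      inkeys : ∀ τ → key τ ∈ keys q
      inkeys (a , b , c , d) = ∈-cartesianProduct⁺ (r a) (∈-cartesianProduct⁺ (r b) (∈-cartesianProduct⁺ (r c) (r d)))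
        where
        r : ∀ (v : Fin n) → blk v ∈ upTo q
        r v = ∈-upTo⁺ (*-cancelʳ-< L (blk v) q (≤-<-trans (m/n*n≤m (toℕ v) L) (<-≤-trans (Finₚ.toℕ<n v) n≤qL)))
      finish : _ → length B ≤ t * (s + (q * (q * (q * q)) + L))
      finish (R , AR , len , bnd) with realise R AR (λ j → *-cancelˡ-≤ t (begin
          t * sumL (blkcnt (suc j)) R ≤⟨ bnd (λ { (x , y , z , u) → ⟦ x ≡ᵇ suc j ⟧ + (⟦ y ≡ᵇ suc j ⟧ + (⟦ z ≡ᵇ suc j ⟧ + ⟦ u ≡ᵇ suc j ⟧)) }) ⟩
          sumL (blkcnt (suc j)) (proj₁ highs) ≤⟨ proj₂ (proj₂ (proj₂ highs)) (blkcnt (suc j)) ⟩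
          sumL (blkcnt (suc j)) B ≤⟨ blkload (suc j) ⟩
          t * L ∎))
      ... | M , FM , uM , same , _ = begin
          length B ≤⟨ proj₁ (proj₂ (proj₂ highs)) ⟩
          length (proj₁ highs) + sumL (blkcnt 0) B ≤⟨ +-mono-≤ len (blkload 0) ⟩
          t * length R + t * length (keys q) + t * L ≤⟨ +-monoˡ-≤ (t * L) (+-mono-≤ (*-monoʳ-≤ t (≤-trans (≤-reflexive (sym same)) (ν M FM uM))) (≤-reflexive (cong (t *_) (length-keys q)))) ⟩
          t * s + t * (q * (q * (q * q))) + t * L ≡⟨ e t s (q * (q * (q * q))) L ⟩
          t * (s + (q * (q * (q * q)) + L)) ∎
        where
        e : ∀ t s q l → t * s + t * q + t * l ≡ t * (s + (q + l))
        e = solve-∀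

-- Four blocks of weights

Block : Set
Block = Fin 4 → ℕ

infixl 6 _⊕_
-- Addition modulo 4, given by its table so that sums of literals compute.
_⊕_ : Fin 4 → Fin 4 → Fin 4
0F ⊕ s = s
1F ⊕ 0F = 1F
1F ⊕ 1F = 2F
1F ⊕ 2F = 3F
1F ⊕ 3F = 0F
2F ⊕ 0F = 2F
2F ⊕ 1F = 3F
2F ⊕ 2F = 0F
2F ⊕ 3F = 1F
3F ⊕ 0F = 3F
3F ⊕ 1F = 0F
3F ⊕ 2F = 1F
3F ⊕ 3F = 2F

∑-rotˡ : ∀ (f : Block) i → ∑ (λ s → f (i ⊕ s)) ≡ ∑ f
∑-rotˡ f i = go i (f 0F) (f 1F) (f 2F) (f 3F)
  where
  r1 : ∀ a b c d → b + (c + (d + (a + 0))) ≡ a + (b + (c + (d + 0)))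
  r1 = solve-∀
  r2 : ∀ a b c d → c + (d + (a + (b + 0))) ≡ a + (b + (c + (d + 0)))
  r2 = solve-∀
  r3 : ∀ a b c d → d + (a + (b + (c + 0))) ≡ a + (b + (c + (d + 0)))
  r3 = solve-∀
  go : ∀ i a b c d → ∑ (λ s → f (i ⊕ s)) ≡ ∑ f
  go 0F _ _ _ _ = refl
  go 1F _ _ _ _ = r1 (f 0F) (f 1F) (f 2F) (f 3F)
  go 2F _ _ _ _ = r2 (f 0F) (f 1F) (f 2F) (f 3F)
  go 3F _ _ _ _ = r3 (f 0F) (f 1F) (f 2F) (f 3F)

⊕-comm : ∀ i j → i ⊕ j ≡ j ⊕ i
⊕-comm 0F 0F = refl
⊕-comm 0F 1F = refl
⊕-comm 0F 2F = refl
⊕-comm 0F 3F = refl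
⊕-comm 1F 0F = refl
⊕-comm 1F 1F = refl
⊕-comm 1F 2F = refl
⊕-comm 1F 3F = refl
⊕-comm 2F 0F = refl
⊕-comm 2F 1F = refl
⊕-comm 2F 2F = refl
⊕-comm 2F 3F = refl
⊕-comm 3F 0F = refl
⊕-comm 3F 1F = refl
⊕-comm 3F 2F = refl
⊕-comm 3F 3F = refl

∑-rotʳ : ∀ (f : Block) s → ∑ (λ i → f (i ⊕ s)) ≡ ∑ f
∑-rotʳ f s = trans (sum-cong-≗ (λ i → cong f (⊕-comm i s))) (∑-rotˡ f s)

-- The 4 by 4 grid is cut into four cyclic diagonals. Each meets every index of both blocks once, so
-- the total weight along a diagonal is known although the single cells are not.
∑-classes : ∀ (g : Fin 4 → Fin 4 → ℕ) →
  ∑ (λ i → ∑ (λ j → g i j)) ≡ ∑ (λ s → ∑ (λ i → g i (i ⊕ s)))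
∑-classes g = trans (sum-cong-≗ (λ i → sym (∑-rotˡ (g i) i))) (∑-comm (λ i s → g i (i ⊕ s)))

∑≥ : ∀ {f : Block} c → (∀ i → c ≤ f i) → 4 * c ≤ ∑ f
∑≥ c h = ≤-trans (≤-reflexive (sym (∑-const 4 c))) (∑-mono h)

module Local (t : ℕ) (0<t : 0 < t) where

  low : ℕ → ℕ
  low r = ⟦ r <ᵇ t ⟧

  zer : ℕ → ℕ
  zer zero = 1
  zer (suc _) = 0

  low-yes : ∀ {r} → r < t → low r ≡ 1
  low-yes {r} p with r <ᵇ t | <ᵇ-reflects-< r t
  ... | true | _ = refl
  ... | false | ofⁿ q = ⊥-elim (q p)

  low-no : ∀ {r} → t ≤ r → low r ≡ 0
  low-no {r} p with r <ᵇ t | <ᵇ-reflects-< r t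
  ... | true | ofʸ q = ⊥-elim (<⇒≱ q p)
  ... | false | _ = refl

  low≤1 : ∀ r → low r ≤ 1
  low≤1 r = ⟦⟧≤1 _

  -- Holds term by term: a low row gives equality, a high row contributes at least `t` to `∑ r`.
  rowsum≥ : ∀ {n} (r : Fin n → ℕ) → t * n + ∑ (λ i → low (r i) * r i) ≤ ∑ r + t * ∑ (low ∘ r)
  rowsum≥ {zero} r = ≤-reflexive (+-identityʳ (t * 0))
  rowsum≥ {suc n} r = begin
      t * suc n + (low r0 * r0 + X) ≡⟨ e1 t n (low r0 * r0) X ⟩
      (t + low r0 * r0) + (t * n + X) ≤⟨ +-mono-≤ one (rowsum≥ (r ∘ suc)) ⟩
      (r0 + t * low r0) + (Y + t * Z) ≡⟨ e2 r0 t (low r0) Y Z ⟩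
      r0 + Y + t * (low r0 + Z) ∎
    where
    open ≤-Reasoning
    r0 = r 0F
    X = ∑ (λ i → low (r (suc i)) * r (suc i))
    Y = ∑ (r ∘ suc)
    Z = ∑ (low ∘ r ∘ suc)
    e1 : ∀ t n a x → t * suc n + (a + x) ≡ (t + a) + (t * n + x)
    e1 = solve-∀
    e2 : ∀ r t l y z → (r + t * l) + (y + t * z) ≡ r + y + t * (l + z)
    e2 = solve-∀
    e3 : ∀ t r → t + (r + 0) ≡ r + t * 1
    e3 = solve-∀
    one : t + low r0 * r0 ≤ r0 + t * low r0
    one with r0 <? t
    ... | yes q rewrite low-yes q = ≤-reflexive (e3 t r0)
    ... | no q rewrite low-no (≮⇒≥ q) = +-mono-≤ (≮⇒≥ q) z≤n

  -- The second alternative is the tie: k high rows already exhaust the total, so the low ones are 0.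
  class : ∀ k (r : Block) → ∑ r ≤ k * t →
    5 ≤ k + ∑ (low ∘ r) ⊎ (4 ≤ k + ∑ (low ∘ r) × ∑ (low ∘ r) ≤ ∑ (zer ∘ r))
  class k r h with 5 ≤? k + ∑ (low ∘ r)
  ... | yes p = inj₁ p
  ... | no p = inj₂ (4≤ , ∑-mono each)
    where
    X = ∑ (λ i → low (r i) * r i)
    Z = ∑ (low ∘ r)
    bound : t * 4 + X ≤ t * (k + Z)
    bound = ≤-trans (rowsum≥ r) (≤-trans (+-monoˡ-≤ _ h) (≤-reflexive (e k t Z)))
      where
      e : ∀ k t z → k * t + t * z ≡ t * (k + z)
      e = solve-∀
    4≤ : 4 ≤ k + Z
    4≤ = *-cancelˡ-≤ t {{>-nonZero 0<t}} (≤-trans (m≤m+n _ X) bound)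
    X≡0 : X ≡ 0
    X≡0 = n≤0⇒n≡0 (+-cancelˡ-≤ (t * 4) _ _ (≤-trans bound
      (≤-trans (*-monoʳ-≤ t (≤-pred (≰⇒> p))) (≤-reflexive (sym (+-identityʳ _))))))
    each : ∀ i → low (r i) ≤ zer (r i)
    each i with r i | low (r i) | low≤1 (r i) | term≤∑ (λ i → low (r i) * r i) i
    ... | zero | b | q | _ = q
    ... | suc m | 0 | q | _ = z≤n
    ... | suc m | suc b | q | w = ⊥-elim (<⇒≱ (s≤s z≤n) (≤-trans w (≤-reflexive X≡0)))

  S2 : Block → Block → ℕ
  S2 x y = ∑ λ i → ∑ λ j → low (x i + y j)

  S3 : Block → Block → Block → ℕ
  S3 x y z = ∑ λ i → ∑ λ j → ∑ λ k → low (x i + y j + z k)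

  S4 : Block → Block → Block → Block → ℕ
  S4 x y z u = ∑ λ i → ∑ λ j → ∑ λ k → ∑ λ l → low (x i + y j + z k + u l)

  record Small (x : Block) : Set where
    field
      sum≡ : ∑ x ≡ t
      <t : ∀ i → x i < t
  open Small

  #z : Block → ℕ
  #z x = ∑ (zer ∘ x)

  ∑≤t : ∀ {x} → Small x → ∑ x ≤ t
  ∑≤t X = ≤-reflexive (sum≡ X)

  ∑rot≤t : ∀ {x} → Small x → ∀ s → ∑ (λ i → x (i ⊕ s)) ≤ t
  ∑rot≤t {x} X s = ≤-trans (≤-reflexive (∑-rotʳ x s)) (∑≤t X)

  pair≤ : ∀ {x y} → Small x → Small y → ∀ s → ∑ (λ i → x i + y (i ⊕ s)) ≤ 2 * t
  pair≤ {x} {y} X Y s = begin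
    ∑ (λ i → x i + y (i ⊕ s)) ≡⟨ ∑-distrib-+ x (λ i → y (i ⊕ s)) ⟩
    ∑ x + ∑ (λ i → y (i ⊕ s)) ≤⟨ +-mono-≤ (∑≤t X) (∑rot≤t Y s) ⟩
    t + t ≡⟨ cong (t +_) (sym (+-identityʳ t)) ⟩
    2 * t ∎
    where open ≤-Reasoning

  triple≤ : ∀ {x y z} → Small x → Small y → Small z → ∀ s s′ →
    ∑ (λ i → x i + y (i ⊕ s) + z (i ⊕ s′)) ≤ 3 * t
  triple≤ {x} {y} {z} X Y Z s s′ = begin
    ∑ (λ i → x i + y (i ⊕ s) + z (i ⊕ s′)) ≡⟨ ∑-distrib-+ (λ i → x i + y (i ⊕ s)) (λ i → z (i ⊕ s′)) ⟩
    ∑ (λ i → x i + y (i ⊕ s)) + ∑ (λ i → z (i ⊕ s′)) ≤⟨ +-mono-≤ (pair≤ X Y s) (∑rot≤t Z s′) ⟩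
    2 * t + t ≡⟨ +-comm (2 * t) t ⟩
    3 * t ∎
    where open ≤-Reasoning

  quad≤ : ∀ {x y z u} → Small x → Small y → Small z → Small u → ∀ s s′ s″ →
    ∑ (λ i → x i + y (i ⊕ s) + z (i ⊕ s′) + u (i ⊕ s″)) ≤ 4 * t
  quad≤ {x} {y} {z} {u} X Y Z U s s′ s″ = begin
    ∑ (λ i → x i + y (i ⊕ s) + z (i ⊕ s′) + u (i ⊕ s″)) ≡⟨ ∑-distrib-+ (λ i → x i + y (i ⊕ s) + z (i ⊕ s′)) (λ i → u (i ⊕ s″)) ⟩
    ∑ (λ i → x i + y (i ⊕ s) + z (i ⊕ s′)) + ∑ (λ i → u (i ⊕ s″)) ≤⟨ +-mono-≤ (triple≤ X Y Z s s′) (∑rot≤t U s″) ⟩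
    3 * t + t ≡⟨ +-comm (3 * t) t ⟩
    4 * t ∎
    where open ≤-Reasoning

  zer≤1 : ∀ r → zer r ≤ 1
  zer≤1 zero = ≤-refl
  zer≤1 (suc r) = z≤n

  zer-+ˡ : ∀ a b → zer (a + b) ≤ zer a
  zer-+ˡ zero b = zer≤1 b
  zer-+ˡ (suc a) b = z≤n

  -- Three zeros would leave the whole weight `t` to the fourth entry, which has to be smaller.
  #z≤2 : ∀ {x} → Small x → #z x ≤ 2
  #z≤2 {x} X with #z x ≤? 2
  ... | yes p = p
  ... | no p = ⊥-elim (<-irrefl refl (begin-strict
      t ≡⟨ sum≡ X ⟨
      ∑ x ≤⟨ +-cancelʳ-≤ _ _ _ lem ⟩
      (t ∸ 1) * 1 <⟨ ≤-reflexive (trans (cong suc (*-identityʳ _)) (m+[n∸m]≡n 0<t)) ⟩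
      t ∎))
    where
    open ≤-Reasoning
    each : ∀ m → m < t → m + (t ∸ 1) * zer m ≤ t ∸ 1
    each zero _ = ≤-reflexive (*-identityʳ _)
    each (suc m) q = ≤-trans (≤-reflexive (trans (cong (suc m +_) (*-zeroʳ (t ∸ 1))) (+-identityʳ _))) (≤-pred (≤-trans q (≤-reflexive (sym (m+[n∸m]≡n 0<t)))))
    lem : ∑ x + (t ∸ 1) * 3 ≤ (t ∸ 1) * 1 + (t ∸ 1) * 3
    lem = begin
      ∑ x + (t ∸ 1) * 3 ≤⟨ +-monoʳ-≤ (∑ x) (*-monoʳ-≤ (t ∸ 1) (≰⇒> p)) ⟩
      ∑ x + (t ∸ 1) * #z x ≡⟨ cong (∑ x +_) (*-distribˡ-sum (t ∸ 1) (zer ∘ x)) ⟩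
      ∑ x + ∑ (λ i → (t ∸ 1) * zer (x i)) ≡⟨ ∑-distrib-+ x (λ i → (t ∸ 1) * zer (x i)) ⟨
      ∑ (λ i → x i + (t ∸ 1) * zer (x i)) ≤⟨ ∑-mono (λ i → each (x i) (<t X i)) ⟩
      ∑ {4} (λ i → t ∸ 1) ≡⟨ ∑-const 4 (t ∸ 1) ⟩
      4 * (t ∸ 1) ≡⟨ e (t ∸ 1) ⟩
      (t ∸ 1) * 1 + (t ∸ 1) * 3 ∎
      where
      e : ∀ a → 4 * a ≡ a * 1 + a * 3
      e = solve-∀

  S1-small : ∀ {x} → Small x → ∑ (λ i → low (x i)) ≡ 4
  S1-small X = trans (sum-cong-≗ (λ i → low-yes (<t X i))) refl

  -- With zer y = 1 the row x + y is just x, which is low.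
  S2-zeros : ∀ {x y} → Small x → Small y → 4 * #z x + 4 * #z y ≤ S2 x y + #z x * #z y
  S2-zeros {x} {y} X Y = begin
      4 * #z x + 4 * #z y ≡⟨ cong₂ _+_ e1 e2 ⟩
      ∑ (λ i → ∑ {4} (λ j → zer (x i))) + ∑ {4} (λ i → ∑ (λ j → zer (y j))) ≡⟨ ∑-distrib-+ (λ i → ∑ {4} (λ j → zer (x i))) (λ i → ∑ (λ j → zer (y j))) ⟨
      ∑ (λ i → ∑ {4} (λ j → zer (x i)) + ∑ (λ j → zer (y j))) ≤⟨ ∑-mono (λ i → row i) ⟩
      ∑ (λ i → ∑ (λ j → low (x i + y j)) + zer (x i) * #z y) ≡⟨ ∑-distrib-+ (λ i → ∑ (λ j → low (x i + y j))) (λ i → zer (x i) * #z y) ⟩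
      S2 x y + ∑ (λ i → zer (x i) * #z y) ≡⟨ cong (S2 x y +_) (*-distribʳ-sum (#z y) (zer ∘ x)) ⟨
      S2 x y + #z x * #z y ∎
    where
    open ≤-Reasoning
    e1 : 4 * #z x ≡ ∑ (λ i → ∑ {4} (λ j → zer (x i)))
    e1 = trans (*-distribˡ-sum 4 (zer ∘ x)) (sum-cong-≗ (λ i → sym (∑-const 4 (zer (x i)))))
    e2 : 4 * #z y ≡ ∑ {4} (λ i → ∑ (λ j → zer (y j)))
    e2 = sym (∑-const 4 (#z y))
    cell : ∀ i j → zer (x i) + zer (y j) ≤ low (x i + y j) + zer (x i) * zer (y j)
    cell i j with x i | y j | <t X i | <t Y j
    ... | zero | zero | p | q rewrite low-yes p = ≤-refl
    ... | zero | suc b | p | q rewrite low-yes q = ≤-refl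
    ... | suc a | zero | p | q rewrite +-identityʳ a | low-yes p = ≤-refl
    ... | suc a | suc b | p | q = z≤n
    row : ∀ i → ∑ {4} (λ j → zer (x i)) + ∑ (λ j → zer (y j)) ≤ ∑ (λ j → low (x i + y j)) + zer (x i) * #z y
    row i = begin
      ∑ {4} (λ j → zer (x i)) + ∑ (λ j → zer (y j)) ≡⟨ ∑-distrib-+ {4} (λ j → zer (x i)) (λ j → zer (y j)) ⟨
      ∑ (λ j → zer (x i) + zer (y j)) ≤⟨ ∑-mono (cell i) ⟩
      ∑ (λ j → low (x i + y j) + zer (x i) * zer (y j)) ≡⟨ ∑-distrib-+ (λ j → low (x i + y j)) (λ j → zer (x i) * zer (y j)) ⟩
      ∑ (λ j → low (x i + y j)) + ∑ (λ j → zer (x i) * zer (y j)) ≡⟨ cong (∑ (λ j → low (x i + y j)) +_) (*-distribˡ-sum (zer (x i)) (zer ∘ y)) ⟨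
      ∑ (λ j → low (x i + y j)) + zer (x i) * #z y ∎

  S2-comm : ∀ x y → S2 x y ≡ S2 y x
  S2-comm x y = trans (∑-comm (λ i j → low (x i + y j))) (sum-cong-≗ (λ j → sum-cong-≗ (λ i → cong low (+-comm (x i) (y j)))))

  -- Each of the four diagonals has total at most 2 t and contains three low cells: in a tie at
  -- least two of its cells would be 0, which requires two zeros of `x`.
  S2≥12-few : ∀ {x y} → Small x → Small y → #z x ≤ 1 → 12 ≤ S2 x y
  S2≥12-few {x} {y} X Y h = ≤-trans (∑≥ 3 cls) (≤-reflexive (sym (∑-classes (λ i j → low (x i + y j)))))
    where
    cls : ∀ s → 3 ≤ ∑ (λ i → low (x i + y (i ⊕ s)))
    cls s = [ (λ { (s≤s (s≤s p)) → p }) , (λ { (s≤s (s≤s p) , q) → absurd p q }) ]′ (class 2 (λ i → x i + y (i ⊕ s)) (pair≤ X Y s))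
      where
      absurd : ∀ {k} → 2 ≤ k → k ≤ ∑ (λ i → zer (x i + y (i ⊕ s))) → 3 ≤ k
      absurd p q = ⊥-elim (<⇒≱ (s≤s (s≤s z≤n)) (≤-trans p (≤-trans q (≤-trans (∑-mono (λ i → zer-+ˡ (x i) (y (i ⊕ s)))) h))))

  S2≥12 : ∀ {x y} → Small x → Small y → 12 ≤ S2 x y
  S2≥12 {x} {y} X Y with #z x ≤? 1 | #z y ≤? 1
  ... | yes p | _ = S2≥12-few X Y p
  ... | no _ | yes q = ≤-trans (S2≥12-few Y X q) (≤-reflexive (S2-comm y x))
  -- With exactly two zeros in each block, `S2-zeros` reads 8 + 8 ≤ S2 + 4.
  ... | no p | no q = fin (≤-antisym (#z≤2 X) (≰⇒> p)) (≤-antisym (#z≤2 Y) (≰⇒> q)) (S2-zeros X Y)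
    where
    fin : ∀ {a b s} → a ≡ 2 → b ≡ 2 → 4 * a + 4 * b ≤ s + a * b → 12 ≤ s
    fin {s = s} refl refl h = +-cancelʳ-≤ 4 12 s h

  -- Each of the 16 classes has two low rows, or in a tie at least one, which is then 0 in all three
  -- blocks and is counted a second time. The rows that vanish in all blocks number
  -- `#z x * (#z y * #z z)`.
  S3≥-classes : ∀ {x y z} → Small x → Small y → Small z → 32 ≤ S3 x y z + #z x * (#z y * #z z)
  S3≥-classes {x} {y} {z} X Y Z = begin
      32 ≤⟨ ∑≥ 8 (λ s → ∑≥ 2 (λ s′ → cls s s′)) ⟩
      ∑ (λ s → ∑ (λ s′ → ∑ (λ i → L i (i ⊕ s) (i ⊕ s′)) + ∑ (λ i → O i (i ⊕ s) (i ⊕ s′))))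
        ≡⟨ sum-cong-≗ (λ s → ∑-distrib-+ (λ s′ → ∑ (λ i → L i (i ⊕ s) (i ⊕ s′))) (λ s′ → ∑ (λ i → O i (i ⊕ s) (i ⊕ s′)))) ⟩
      ∑ (λ s → ∑ (λ s′ → ∑ (λ i → L i (i ⊕ s) (i ⊕ s′))) + ∑ (λ s′ → ∑ (λ i → O i (i ⊕ s) (i ⊕ s′))))
        ≡⟨ ∑-distrib-+ (λ s → ∑ (λ s′ → ∑ (λ i → L i (i ⊕ s) (i ⊕ s′)))) (λ s → ∑ (λ s′ → ∑ (λ i → O i (i ⊕ s) (i ⊕ s′)))) ⟩
      ∑ (λ s → ∑ (λ s′ → ∑ (λ i → L i (i ⊕ s) (i ⊕ s′)))) + ∑ (λ s → ∑ (λ s′ → ∑ (λ i → O i (i ⊕ s) (i ⊕ s′))))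
        ≡⟨ cong₂ _+_ (cl3 L) (cl3 O) ⟨
      S3 x y z + ∑ (λ i → ∑ (λ j → ∑ (λ k → O i j k)))
        ≡⟨ cong (S3 x y z +_) prod ⟩
      S3 x y z + #z x * (#z y * #z z) ∎
    where
    open ≤-Reasoning
    L O : Fin 4 → Fin 4 → Fin 4 → ℕ
    L i j k = low (x i + y j + z k)
    O i j k = zer (x i) * (zer (y j) * zer (z k))
    cl3 : ∀ (g : Fin 4 → Fin 4 → Fin 4 → ℕ) → ∑ (λ i → ∑ (λ j → ∑ (λ k → g i j k))) ≡ ∑ (λ s → ∑ (λ s′ → ∑ (λ i → g i (i ⊕ s) (i ⊕ s′))))
    cl3 g = trans (∑-classes (λ i j → ∑ (g i j))) (sum-cong-≗ (λ s → ∑-classes (λ i k → g i (i ⊕ s) k)))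
    zz : ∀ a b c → zer (a + b + c) ≤ zer a * (zer b * zer c)
    zz zero zero c = ≤-reflexive (sym (trans (+-identityʳ _) (+-identityʳ _)))
    zz zero (suc b) c = z≤n
    zz (suc a) b c = z≤n
    cls : ∀ s s′ → 2 ≤ ∑ (λ i → L i (i ⊕ s) (i ⊕ s′)) + ∑ (λ i → O i (i ⊕ s) (i ⊕ s′))
    cls s s′ = [ (λ { (s≤s (s≤s (s≤s p))) → ≤-trans p (m≤m+n _ _) })
               , (λ { (s≤s (s≤s (s≤s p)) , q) → +-mono-≤ p (≤-trans p (≤-trans q (∑-mono (λ i → zz (x i) (y (i ⊕ s)) (z (i ⊕ s′)))))) }) ]′
      (class 3 (λ i → x i + y (i ⊕ s) + z (i ⊕ s′)) (triple≤ X Y Z s s′))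
    prod : ∑ (λ i → ∑ (λ j → ∑ (λ k → O i j k))) ≡ #z x * (#z y * #z z)
    prod = trans (sum-cong-≗ (λ i → trans (sum-cong-≗ (λ j → trans (sym (*-distribˡ-sum (zer (x i)) (λ k → zer (y j) * zer (z k)))) (cong (zer (x i) *_) (sym (*-distribˡ-sum (zer (y j)) (zer ∘ z))))))
       (trans (sym (*-distribˡ-sum (zer (x i)) (λ j → zer (y j) * #z z))) (cong (zer (x i) *_) (sym (*-distribʳ-sum (#z z) (zer ∘ y)))))))
       (sym (*-distribʳ-sum (#z y * #z z) (zer ∘ x)))

  S3-swap₁₂ : ∀ x y z → S3 x y z ≡ S3 y x z
  S3-swap₁₂ x y z = trans (∑-comm (λ i j → ∑ (λ k → low (x i + y j + z k))))
    (sum-cong-≗ (λ j → sum-cong-≗ (λ i → sum-cong-≗ (λ k → cong (λ m → low (m + z k)) (+-comm (x i) (y j))))))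

  S3-swap₂₃ : ∀ x y z → S3 x y z ≡ S3 x z y
  S3-swap₂₃ x y z = sum-cong-≗ (λ i → trans (∑-comm (λ j k → low (x i + y j + z k)))
    (sum-cong-≗ (λ k → sum-cong-≗ (λ j → cong low (e (x i) (y j) (z k))))))
    where
    e : ∀ a b c → a + b + c ≡ a + c + b
    e = solve-∀

  -- Inclusion-exclusion for the transversals with a zero in `y` or in `z`: twice `S2 x z` plus
  -- twice `S2 x y`, less 2 * 2 * 4 for those with both, is at least 24 + 24 - 16.
  S3-zeros : ∀ {x y z} → Small x → Small y → Small z → #z y ≡ 2 → #z z ≡ 2 → 30 ≤ S3 x y z
  S3-zeros {x} {y} {z} X Y Z hy hz = fin hy hz (S2≥12 X Y) (S2≥12 X Z) main
    where
    open ≤-Reasoning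
    fin : ∀ {b c p q s} → b ≡ 2 → c ≡ 2 → 12 ≤ p → 12 ≤ q → b * q + c * p ≤ s + b * (c * 4) → 30 ≤ s
    fin {p = p} {q} {s} refl refl h k m = ≤-via {2 * 12 + 2 * 12} (≤-trans (+-mono-≤ (*-monoʳ-≤ 2 k) (*-monoʳ-≤ 2 h)) m)
      (≤-trans (+-monoʳ-≤ 30 (≤-reflexive (+-comm s 16))) (≤-trans (m≤m+n (30 + (16 + s)) 2) (≤-reflexive (e s))))
      where
      e : ∀ s → 30 + (16 + s) + 2 ≡ s + 48
      e = solve-∀
    cell : ∀ i j k → zer (y j) * low (x i + z k) + zer (z k) * low (x i + y j) ≤ low (x i + y j + z k) + zer (y j) * (zer (z k) * 1)
    cell i j k with y j | z k
    ... | zero | zero rewrite +-identityʳ (x i) | +-identityʳ (x i) = ≤-trans (+-monoʳ-≤ (low (x i) + 0) (≤-trans (≤-reflexive (+-identityʳ _)) (low≤1 (x i)))) (≤-reflexive (cong (_+ 1) (+-identityʳ _)))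
    ... | zero | suc c rewrite +-identityʳ (x i) = ≤-reflexive (+-assoc (low (x i + suc c)) 0 0)
    ... | suc b | zero rewrite +-identityʳ (x i + suc b) = ≤-refl
    ... | suc b | suc c = z≤n
    f1 : Fin 4 → Fin 4 → ℕ
    f1 i j = ∑ (λ k → zer (y j) * low (x i + z k))
    f2 : Fin 4 → Fin 4 → ℕ
    f2 i j = ∑ (λ k → zer (z k) * low (x i + y j))
    inner : ∀ i j → f1 i j + f2 i j ≤ ∑ (λ k → low (x i + y j + z k)) + zer (y j) * #z z
    inner i j = begin
      f1 i j + f2 i j ≡⟨ ∑-distrib-+ (λ k → zer (y j) * low (x i + z k)) (λ k → zer (z k) * low (x i + y j)) ⟨
      ∑ (λ k → zer (y j) * low (x i + z k) + zer (z k) * low (x i + y j)) ≤⟨ ∑-mono (cell i j) ⟩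
      ∑ (λ k → low (x i + y j + z k) + zer (y j) * (zer (z k) * 1)) ≡⟨ ∑-distrib-+ (λ k → low (x i + y j + z k)) (λ k → zer (y j) * (zer (z k) * 1)) ⟩
      ∑ (λ k → low (x i + y j + z k)) + ∑ (λ k → zer (y j) * (zer (z k) * 1))
        ≡⟨ cong (∑ (λ k → low (x i + y j + z k)) +_) (trans (sum-cong-≗ (λ k → cong (zer (y j) *_) (*-identityʳ (zer (z k))))) (sym (*-distribˡ-sum (zer (y j)) (zer ∘ z)))) ⟩
      ∑ (λ k → low (x i + y j + z k)) + zer (y j) * #z z ∎
    g1 : ∑ (λ i → ∑ (λ j → f1 i j)) ≡ #z y * S2 x z
    g1 = trans (sum-cong-≗ (λ i → trans (sum-cong-≗ (λ j → sym (*-distribˡ-sum (zer (y j)) (λ k → low (x i + z k))))) (sym (*-distribʳ-sum (∑ (λ k → low (x i + z k))) (zer ∘ y)))))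
      (sym (*-distribˡ-sum (#z y) (λ i → ∑ (λ k → low (x i + z k)))))
    g2 : ∑ (λ i → ∑ (λ j → f2 i j)) ≡ #z z * S2 x y
    g2 = trans (sum-cong-≗ (λ i → trans (sum-cong-≗ (λ j → sym (*-distribʳ-sum (low (x i + y j)) (zer ∘ z)))) (sym (*-distribˡ-sum (#z z) (λ j → low (x i + y j))))))
      (sym (*-distribˡ-sum (#z z) (λ i → ∑ (λ j → low (x i + y j)))))
    g3 : ∑ {4} (λ i → ∑ (λ j → zer (y j) * #z z)) ≡ #z y * (#z z * 4)
    g3 = trans (∑-const 4 (∑ (λ j → zer (y j) * #z z))) (trans (cong (4 *_) (sym (*-distribʳ-sum (#z z) (zer ∘ y)))) (e (#z y) (#z z)))
      where
      e : ∀ b c → 4 * (b * c) ≡ b * (c * 4)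
      e = solve-∀
    main : #z y * S2 x z + #z z * S2 x y ≤ S3 x y z + #z y * (#z z * 4)
    main = begin
      #z y * S2 x z + #z z * S2 x y ≡⟨ cong₂ _+_ g1 g2 ⟨
      ∑ (λ i → ∑ (λ j → f1 i j)) + ∑ (λ i → ∑ (λ j → f2 i j)) ≡⟨ ∑-distrib-+ (λ i → ∑ (λ j → f1 i j)) (λ i → ∑ (λ j → f2 i j)) ⟨
      ∑ (λ i → ∑ (λ j → f1 i j) + ∑ (λ j → f2 i j)) ≡⟨ sum-cong-≗ (λ i → sym (∑-distrib-+ (f1 i) (f2 i))) ⟩
      ∑ (λ i → ∑ (λ j → f1 i j + f2 i j)) ≤⟨ ∑-mono (λ i → ∑-mono (inner i)) ⟩
      ∑ (λ i → ∑ (λ j → ∑ (λ k → low (x i + y j + z k)) + zer (y j) * #z z)) ≡⟨ sum-cong-≗ (λ i → ∑-distrib-+ (λ j → ∑ (λ k → low (x i + y j + z k))) (λ j → zer (y j) * #z z)) ⟩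
      ∑ (λ i → ∑ (λ j → ∑ (λ k → low (x i + y j + z k))) + ∑ (λ j → zer (y j) * #z z)) ≡⟨ ∑-distrib-+ (λ i → ∑ (λ j → ∑ (λ k → low (x i + y j + z k)))) (λ i → ∑ (λ j → zer (y j) * #z z)) ⟩
      S3 x y z + ∑ {4} (λ i → ∑ (λ j → zer (y j) * #z z)) ≡⟨ cong (S3 x y z +_) g3 ⟩
      S3 x y z + #z y * (#z z * 4) ∎

  -- If two of the blocks have two zeros each, `S3-zeros` applies. Otherwise the product of the
  -- three numbers of zeros is at most 2, and `S3≥-classes` loses no more than that.
  S3≥30 : ∀ {x y z} → Small x → Small y → Small z → 30 ≤ S3 x y z
  S3≥30 {x} {y} {z} X Y Z = go (#z x) (#z y) (#z z) refl refl refl (#z≤2 X) (#z≤2 Y) (#z≤2 Z) (S3≥-classes X Y Z)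
    where
    drop : ∀ {m k} → k ≤ 2 → 32 ≤ m + k → 30 ≤ m
    drop {m} {k} p q = +-cancelʳ-≤ 2 30 m (≤-trans q (+-monoʳ-≤ m p))
    go : ∀ a b c → #z x ≡ a → #z y ≡ b → #z z ≡ c → a ≤ 2 → b ≤ 2 → c ≤ 2 → 32 ≤ S3 x y z + #z x * (#z y * #z z) → 30 ≤ S3 x y z
    go a 2 2 ea eb ec _ _ _ h = S3-zeros X Y Z eb ec
    go 2 b 2 ea eb ec _ _ _ h = ≤-trans (S3-zeros Y X Z ea ec) (≤-reflexive (S3-swap₁₂ y x z))
    go 2 2 c ea eb ec _ _ _ h = ≤-trans (S3-zeros Z X Y ea eb) (≤-reflexive (trans (S3-swap₁₂ z x y) (S3-swap₂₃ x z y)))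
    go 0 b c ea eb ec _ _ _ h rewrite ea = drop z≤n h
    go a 0 c ea eb ec _ _ _ h rewrite eb | *-zeroʳ (#z x) = drop z≤n h
    go a b 0 ea eb ec _ _ _ h rewrite ec | *-zeroʳ (#z y) | *-zeroʳ (#z x) = drop z≤n h
    go 1 1 c ea eb ec _ _ c≤2 h rewrite ea | eb | ec = drop (≤-trans (≤-reflexive (trans (+-identityʳ _) (+-identityʳ c))) c≤2) h
    go 1 2 1 ea eb ec _ _ c≤2 h rewrite ea | eb | ec = drop ≤-refl h
    go 2 1 1 ea eb ec _ _ c≤2 h rewrite ea | eb | ec = drop ≤-refl h
    go (suc (suc (suc a))) b c ea eb ec (s≤s (s≤s ())) _ _ h
    go a (suc (suc (suc b))) c ea eb ec _ (s≤s (s≤s ())) _ h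
    go a b (suc (suc (suc c))) ea eb ec _ _ (s≤s (s≤s ())) h

  Constant : Block → Set
  Constant x = ∀ i → x i ≡ x 0F

  four-eq : ∀ (r : Block) → (∀ i → t ≤ r i) → ∑ r ≤ 4 * t → ∀ i → r i ≡ t
  four-eq r ge le i = ≤-antisym (≮⇒≥ λ t<ri → <⇒≱ (strict i t<ri) le) (ge i)
    where
    strict : ∀ i → t < r i → 4 * t < ∑ r
    strict 0F p = +-mono-<-≤ p (+-mono-≤ (ge 1F) (+-mono-≤ (ge 2F) (+-monoˡ-≤ 0 (ge 3F))))
    strict 1F p = +-mono-≤-< (ge 0F) (+-mono-<-≤ p (+-mono-≤ (ge 2F) (+-monoˡ-≤ 0 (ge 3F))))
    strict 2F p = +-mono-≤-< (ge 0F) (+-mono-≤-< (ge 1F) (+-mono-<-≤ p (+-monoˡ-≤ 0 (ge 3F))))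
    strict 3F p = +-mono-≤-< (ge 0F) (+-mono-≤-< (ge 1F) (+-mono-≤-< (ge 2F) (+-monoˡ-< 0 p)))

  class₄ : ∀ (r : Block) → ∑ r ≤ 4 * t → 1 ≤ ∑ (low ∘ r) ⊎ (∀ i → r i ≡ t)
  class₄ r h with 1 ≤? ∑ (low ∘ r)
  ... | yes p = inj₁ p
  ... | no p = inj₂ (four-eq r (λ i → ≮⇒≥ λ ri<t → p (≤-trans (≤-reflexive (sym (low-yes ri<t))) (term≤∑ (low ∘ r) i))) h)

  -- Two shifts of u that both make every row equal to t would make u periodic.
  S4≥48-aperiodic : ∀ {x y z u} → Small x → Small y → Small z → Small u →
    u 0F ≢ u 2F ⊎ u 1F ≢ u 3F → 48 ≤ S4 x y z u
  S4≥48-aperiodic {x} {y} {z} {u} X Y Z U ap = begin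
      -- For each of the 16 pairs of shifts of `y` and `z`, at least three of the four shifts of `u`
      -- produce a low row.
      48 ≤⟨ ∑≥ 12 (λ s → ∑≥ 3 (λ s′ → three s s′)) ⟩
      ∑ (λ s → ∑ (λ s′ → ∑ (λ s″ → ∑ (λ i → L i (i ⊕ s) (i ⊕ s′) (i ⊕ s″))))) ≡⟨ sum-cong-≗ (λ s → sum-cong-≗ (λ s′ → ∑-classes (λ i l → L i (i ⊕ s) (i ⊕ s′) l))) ⟨
      ∑ (λ s → ∑ (λ s′ → ∑ (λ i → ∑ (λ l → L i (i ⊕ s) (i ⊕ s′) l)))) ≡⟨ sum-cong-≗ (λ s → ∑-classes (λ i k → ∑ (λ l → L i (i ⊕ s) k l))) ⟨
      ∑ (λ s → ∑ (λ i → ∑ (λ k → ∑ (λ l → L i (i ⊕ s) k l)))) ≡⟨ ∑-classes (λ i j → ∑ (λ k → ∑ (λ l → L i j k l))) ⟨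
      S4 x y z u ∎
    where
    open ≤-Reasoning
    L : Fin 4 → Fin 4 → Fin 4 → Fin 4 → ℕ
    L i j k l = low (x i + y j + z k + u l)
    three : ∀ s s′ → 3 ≤ ∑ (λ s″ → ∑ (λ i → L i (i ⊕ s) (i ⊕ s′) (i ⊕ s″)))
    three s s′ = pick (C 0F) (C 1F) (C 2F) (C 3F)
      where
      v : Block
      v i = x i + y (i ⊕ s) + z (i ⊕ s′)
      c : Fin 4 → ℕ
      c s″ = ∑ (λ i → low (v i + u (i ⊕ s″)))
      E : Fin 4 → Set
      E s″ = ∀ i → v i + u (i ⊕ s″) ≡ t
      C : ∀ s″ → 1 ≤ c s″ ⊎ E s″
      C s″ = class₄ (λ i → v i + u (i ⊕ s″)) (quad≤ X Y Z U s s′ s″)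
      same : ∀ {s₁ s₂} → E s₁ → E s₂ → ∀ i → u (i ⊕ s₁) ≡ u (i ⊕ s₂)
      same e₁ e₂ i = +-cancelˡ-≡ (v i) _ _ (trans (e₁ i) (sym (e₂ i)))
      periodic : u 0F ≡ u 2F → u 1F ≡ u 3F → ⊥
      periodic a b = [ (λ p → p a) , (λ q → q b) ]′ ap
      n01 : E 0F → E 1F → ⊥
      n01 p q = let f = same p q in periodic (trans (f 0F) (f 1F)) (trans (f 1F) (f 2F))
      n02 : E 0F → E 2F → ⊥
      n02 p q = let f = same p q in periodic (f 0F) (f 1F)
      n03 : E 0F → E 3F → ⊥
      n03 p q = let f = same p q in periodic (trans (f 0F) (f 3F)) (trans (f 1F) (f 0F))
      n12 : E 1F → E 2F → ⊥
      n12 p q = let f = same p q in periodic (trans (f 3F) (f 0F)) (trans (f 0F) (f 1F))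
      n13 : E 1F → E 3F → ⊥
      n13 p q = let f = same p q in periodic (f 3F) (f 0F)
      n23 : E 2F → E 3F → ⊥
      n23 p q = let f = same p q in periodic (trans (f 2F) (f 3F)) (trans (f 3F) (f 0F))
      pick : 1 ≤ c 0F ⊎ E 0F → 1 ≤ c 1F ⊎ E 1F → 1 ≤ c 2F ⊎ E 2F → 1 ≤ c 3F ⊎ E 3F → 3 ≤ ∑ c
      pick (inj₂ p) (inj₂ q) _ _ = ⊥-elim (n01 p q)
      pick (inj₂ p) (inj₁ _) (inj₂ q) _ = ⊥-elim (n02 p q)
      pick (inj₂ p) (inj₁ _) (inj₁ _) (inj₂ q) = ⊥-elim (n03 p q)
      pick (inj₁ _) (inj₂ p) (inj₂ q) _ = ⊥-elim (n12 p q)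
      pick (inj₁ _) (inj₂ p) (inj₁ _) (inj₂ q) = ⊥-elim (n13 p q)
      pick (inj₁ _) (inj₁ _) (inj₂ p) (inj₂ q) = ⊥-elim (n23 p q)
      pick (inj₂ _) (inj₁ a) (inj₁ b) (inj₁ d) = +-mono-≤ (z≤n {c 0F}) (+-mono-≤ a (+-mono-≤ b (+-mono-≤ d z≤n)))
      pick (inj₁ a) (inj₂ _) (inj₁ b) (inj₁ d) = +-mono-≤ a (+-mono-≤ (z≤n {c 1F}) (+-mono-≤ b (+-mono-≤ d z≤n)))
      pick (inj₁ a) (inj₁ b) (inj₂ _) (inj₁ d) = +-mono-≤ a (+-mono-≤ b (+-mono-≤ (z≤n {c 2F}) (+-mono-≤ d z≤n)))
      pick (inj₁ a) (inj₁ b) (inj₁ d) _ = +-mono-≤ a (+-mono-≤ b (+-mono-≤ d z≤n))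

  swap₁₂ : Fin 4 → Fin 4
  swap₁₂ 0F = 0F
  swap₁₂ 1F = 2F
  swap₁₂ 2F = 1F
  swap₁₂ 3F = 3F

  ∑-swap₁₂ : ∀ (f : Block) → ∑ (f ∘ swap₁₂) ≡ ∑ f
  ∑-swap₁₂ f = e (f 0F) (f 1F) (f 2F) (f 3F)
    where
    e : ∀ a b c d → a + (c + (b + (d + 0))) ≡ a + (b + (c + (d + 0)))
    e = solve-∀

  Small-swap : ∀ {x} → Small x → Small (x ∘ swap₁₂)
  Small-swap {x} X = record { sum≡ = trans (∑-swap₁₂ x) (sum≡ X) ; <t = λ i → <t X (swap₁₂ i) }

  -- A block `u` of period 2 that is not constant loses the period when its two middle entries are
  -- exchanged, and this leaves `S4` unchanged.
  S4≥48-last : ∀ {x y z u} → Small x → Small y → Small z → Small u → 48 ≤ S4 x y z u ⊎ Constant u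
  S4≥48-last {x} {y} {z} {u} X Y Z U = go (u 0F ≟ u 2F) (u 1F ≟ u 3F) (u 0F ≟ u 1F)
    where
    go : Dec (u 0F ≡ u 2F) → Dec (u 1F ≡ u 3F) → Dec (u 0F ≡ u 1F) → 48 ≤ S4 x y z u ⊎ Constant u
    go (no p) _ _ = inj₁ (S4≥48-aperiodic X Y Z U (inj₁ p))
    go (yes _) (no p) _ = inj₁ (S4≥48-aperiodic X Y Z U (inj₂ p))
    go (yes a) (yes b) (yes c) = inj₂ λ { 0F → refl ; 1F → sym c ; 2F → sym a ; 3F → trans (sym b) (sym c) }
    go (yes a) (yes b) (no c) = inj₁ (≤-trans (S4≥48-aperiodic X Y Z (Small-swap U) (inj₁ c))
        (≤-reflexive (sum-cong-≗ (λ i → sum-cong-≗ (λ j → sum-cong-≗ (λ k → ∑-swap₁₂ (λ l → low (x i + y j + z k + u l))))))))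

  S4-swap₃₄ : ∀ x y z u → S4 x y z u ≡ S4 x y u z
  S4-swap₃₄ x y z u = sum-cong-≗ (λ i → sum-cong-≗ (λ j → trans (∑-comm (λ k l → low (x i + y j + z k + u l)))
    (sum-cong-≗ (λ l → sum-cong-≗ (λ k → cong low (e (x i + y j) (z k) (u l)))))))
    where
    e : ∀ a b c → a + b + c ≡ a + c + b
    e = solve-∀

  S4-swap₂₃ : ∀ x y z u → S4 x y z u ≡ S4 x z y u
  S4-swap₂₃ x y z u = sum-cong-≗ (λ i → trans (∑-comm (λ j k → ∑ (λ l → low (x i + y j + z k + u l))))
    (sum-cong-≗ (λ k → sum-cong-≗ (λ j → sum-cong-≗ (λ l → cong (λ m → low (m + u l)) (e (x i) (y j) (z k)))))))
    where
    e : ∀ a b c → a + b + c ≡ a + c + b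
    e = solve-∀

  S4-swap₁₂ : ∀ x y z u → S4 x y z u ≡ S4 y x z u
  S4-swap₁₂ x y z u = trans (∑-comm (λ i j → ∑ (λ k → ∑ (λ l → low (x i + y j + z k + u l)))))
    (sum-cong-≗ (λ j → sum-cong-≗ (λ i → sum-cong-≗ (λ k → sum-cong-≗ (λ l → cong (λ m → low (m + z k + u l)) (+-comm (x i) (y j)))))))

  S4≥48 : ∀ {x y z u} → Small x → Small y → Small z → Small u →
    48 ≤ S4 x y z u ⊎ (Constant x × Constant y × Constant z × Constant u)
  S4≥48 {x} {y} {z} {u} X Y Z U = go (S4≥48-last X Y Z U) (S4≥48-last X Y U Z) (S4≥48-last X Z U Y) (S4≥48-last Y Z U X)
    where
    go : 48 ≤ S4 x y z u ⊎ Constant u → 48 ≤ S4 x y u z ⊎ Constant z → 48 ≤ S4 x z u y ⊎ Constant y → 48 ≤ S4 y z u x ⊎ Constant x →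
      48 ≤ S4 x y z u ⊎ (Constant x × Constant y × Constant z × Constant u)
    go (inj₁ p) _ _ _ = inj₁ p
    go (inj₂ _) (inj₁ p) _ _ = inj₁ (≤-trans p (≤-reflexive (S4-swap₃₄ x y u z)))
    go (inj₂ _) (inj₂ _) (inj₁ p) _ = inj₁ (≤-trans p (≤-reflexive (trans (S4-swap₃₄ x z u y) (S4-swap₂₃ x z y u))))
    go (inj₂ _) (inj₂ _) (inj₂ _) (inj₁ p) = inj₁ (≤-trans p (≤-reflexive (trans (S4-swap₃₄ y z u x) (trans (S4-swap₂₃ y z x u) (S4-swap₁₂ y x z u)))))
    go (inj₂ cu) (inj₂ cz) (inj₂ cy) (inj₂ cx) = inj₂ (cx , cy , cz , cu)

  4*const : ∀ {x} → Small x → Constant x → ∀ i → 4 * x i ≡ t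
  4*const {x} X C i = trans (cong (4 *_) (C i)) (trans (sym (∑-const 4 (x 0F))) (trans (sum-cong-≗ (λ j → sym (C j))) (sum≡ X)))

  -- Constant blocks have all entries equal to t / 4, so any three of them sum to less than `t` and
  -- all 64 transversals are low. The 42 is a quarter of the 168 wanted next.
  S3-const : ∀ {x y z} → Small x → Small y → Small z → Constant x → Constant y → Constant z → 42 ≤ S3 x y z
  S3-const {x} {y} {z} X Y Z cx cy cz = ≤-trans (m≤m+n 42 22) (∑≥ 16 (λ i → ∑≥ 4 (λ j → ∑≥ 1 (λ k → ≤-reflexive (sym (low-yes (lt i j k)))))))
    where
    e : ∀ a b c → 4 * (a + b + c) ≡ 4 * a + 4 * b + 4 * c
    e = solve-∀
    e′ : ∀ t → t + t + t + t ≡ 4 * t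
    e′ = solve-∀
    lt : ∀ i j k → x i + y j + z k < t
    lt i j k = *-cancelˡ-< 4 _ _ (begin-strict
      4 * (x i + y j + z k) ≡⟨ e (x i) (y j) (z k) ⟩
      4 * x i + 4 * y j + 4 * z k ≡⟨ cong₂ _+_ (cong₂ _+_ (4*const X cx i) (4*const Y cy j)) (4*const Z cz k) ⟩
      t + t + t <⟨ m<m+n (t + t + t) 0<t ⟩
      t + t + t + t ≡⟨ e′ t ⟩
      4 * t ∎)
      where open ≤-Reasoning

  -- 168 = 4 * 30 + 48 in general. Only constant blocks can spoil the 48, and then 4 * 42 suffices.
  S34≥168 : ∀ {x y z u} → Small x → Small y → Small z → Small u →
    168 ≤ S3 x y z + S3 x y u + S3 x z u + S3 y z u + S4 x y z u
  S34≥168 X Y Z U = [ (λ p → +-mono-≤ (+-mono-≤ (+-mono-≤ (+-mono-≤ (S3≥30 X Y Z) (S3≥30 X Y U)) (S3≥30 X Z U)) (S3≥30 Y Z U)) p)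
    , (λ { (cx , cy , cz , cu) → ≤-trans (+-mono-≤ (+-mono-≤ (+-mono-≤ (S3-const X Y Z cx cy cz) (S3-const X Y U cx cy cu)) (S3-const X Z U cx cz cu)) (S3-const Y Z U cy cz cu)) (m≤m+n _ _) }) ]′ (S4≥48 X Y Z U)

  -- N bs a counts the low transversals of the blocks bs, each extended by a zero, on top of a.
  N : List Block → ℕ → ℕ
  N [] a = low a
  N (b ∷ bs) a = N bs a + ∑ (λ i → N bs (a + b i))

  N2 : ∀ z u a → N (z ∷ u ∷ []) a ≡ low a + ∑ (λ l → low (a + u l)) + (∑ (λ k → low (a + z k)) + ∑ (λ k → ∑ (λ l → low (a + z k + u l))))
  N2 z u a = cong (N (u ∷ []) a +_) (∑-distrib-+ (λ k → low (a + z k)) (λ k → ∑ (λ l → low (a + z k + u l))))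

  N3 : ∀ y z u a → N (y ∷ z ∷ u ∷ []) a ≡ N (z ∷ u ∷ []) a + (∑ (λ j → low (a + y j)) + ∑ (λ j → ∑ (λ l → low (a + y j + u l)))
     + (∑ (λ j → ∑ (λ k → low (a + y j + z k))) + ∑ (λ j → ∑ (λ k → ∑ (λ l → low (a + y j + z k + u l))))))
  N3 y z u a = cong (N (z ∷ u ∷ []) a +_) (trans (sum-cong-≗ (λ j → N2 z u (a + y j)))
    (trans (∑-distrib-+ (λ j → low (a + y j) + ∑ (λ l → low (a + y j + u l))) (λ j → ∑ (λ k → low (a + y j + z k)) + ∑ (λ k → ∑ (λ l → low (a + y j + z k + u l)))))
      (cong₂ _+_ (∑-distrib-+ (λ j → low (a + y j)) (λ j → ∑ (λ l → low (a + y j + u l)))) (∑-distrib-+ (λ j → ∑ (λ k → low (a + y j + z k))) (λ j → ∑ (λ k → ∑ (λ l → low (a + y j + z k + u l))))))))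

  private
    ∑low : Block → ℕ
    ∑low x = ∑ (low ∘ x)

  N2₀ : ∀ z u → N (z ∷ u ∷ []) 0 ≡ low 0 + ∑low u + (∑low z + S2 z u)
  N2₀ z u = N2 z u 0

  N3₀ : ∀ y z u → N (y ∷ z ∷ u ∷ []) 0 ≡ low 0 + ∑low u + (∑low z + S2 z u) + (∑low y + S2 y u + (S2 y z + S3 y z u))
  N3₀ y z u = trans (N3 y z u 0) (cong (_+ (∑low y + S2 y u + (S2 y z + S3 y z u))) (N2₀ z u))

  N4₀ : ∀ x y z u → N (x ∷ y ∷ z ∷ u ∷ []) 0 ≡ N (y ∷ z ∷ u ∷ []) 0
    + (∑low x + S2 x u + (S2 x z + S3 x z u) + (S2 x y + S3 x y u + (S3 x y z + S4 x y z u)))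
  N4₀ x y z u = cong (N (y ∷ z ∷ u ∷ []) 0 +_) (trans (sum-cong-≗ step) (trans (∑-distrib-+ A B) (cong₂ _+_ eA eB)))
    where
    A B : Fin 4 → ℕ
    A i = low (x i) + ∑ (λ l → low (x i + u l)) + (∑ (λ k → low (x i + z k)) + ∑ (λ k → ∑ (λ l → low (x i + z k + u l))))
    B i = ∑ (λ j → low (x i + y j)) + ∑ (λ j → ∑ (λ l → low (x i + y j + u l)))
     + (∑ (λ j → ∑ (λ k → low (x i + y j + z k))) + ∑ (λ j → ∑ (λ k → ∑ (λ l → low (x i + y j + z k + u l)))))
    step : ∀ i → N (y ∷ z ∷ u ∷ []) (x i) ≡ A i + B i
    step i = trans (N3 y z u (x i)) (cong (_+ B i) (N2 z u (x i)))
    quad : ∀ (f g h k : Fin 4 → ℕ) → ∑ (λ i → f i + g i + (h i + k i)) ≡ ∑ f + ∑ g + (∑ h + ∑ k)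
    quad f g h k = trans (∑-distrib-+ (λ i → f i + g i) (λ i → h i + k i)) (cong₂ _+_ (∑-distrib-+ f g) (∑-distrib-+ h k))
    eA : ∑ A ≡ ∑low x + S2 x u + (S2 x z + S3 x z u)
    eA = quad (low ∘ x) (λ i → ∑ (λ l → low (x i + u l))) (λ i → ∑ (λ k → low (x i + z k))) (λ i → ∑ (λ k → ∑ (λ l → low (x i + z k + u l))))
    eB : ∑ B ≡ S2 x y + S3 x y u + (S3 x y z + S4 x y z u)
    eB = quad (λ i → ∑ (λ j → low (x i + y j))) (λ i → ∑ (λ j → ∑ (λ l → low (x i + y j + u l)))) (λ i → ∑ (λ j → ∑ (λ k → low (x i + y j + z k))))
      (λ i → ∑ (λ j → ∑ (λ k → ∑ (λ l → low (x i + y j + z k + u l)))))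

  low0 : 1 ≤ low 0
  low0 = ≤-reflexive (sym (low-yes 0<t))

  4≤∑low : ∀ {x} → Small x → 4 ≤ ∑low x
  4≤∑low X = ≤-reflexive (sym (S1-small X))

  S3≥16 : ∀ {x y z} → Small x → Small y → Small z → 16 ≤ S3 x y z
  S3≥16 X Y Z = ≤-trans (m≤m+n 16 14) (S3≥30 X Y Z)

  -- One more than 4² is what is wanted, since each star multiplies by 4: two stars and two small
  -- blocks then give 16 * 17. Likewise 65 is 4³ + 1 in the case of three small blocks.
  N2≥17 : ∀ {z u} → Small z → Small u → 17 ≤ N (z ∷ u ∷ []) 0
  N2≥17 {z} {u} Z U = ≤-trans (m≤m+n 17 4) (≤-trans (+-mono-≤ (+-mono-≤ low0 (4≤∑low U)) (+-mono-≤ (4≤∑low Z) (S2≥12 Z U))) (≤-reflexive (sym (N2₀ z u))))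

  N3≥65 : ∀ {y z u} → Small y → Small z → Small u → 65 ≤ N (y ∷ z ∷ u ∷ []) 0
  N3≥65 {y} {z} {u} Y Z U = ≤-trans (+-mono-≤ (+-mono-≤ (+-mono-≤ low0 (4≤∑low U)) (+-mono-≤ (4≤∑low Z) (S2≥12 Z U)))
    (+-mono-≤ (+-mono-≤ (4≤∑low Y) (S2≥12 Y U)) (+-mono-≤ (S2≥12 Y Z) (S3≥16 Y Z U)))) (≤-reflexive (sym (N3₀ y z u)))

  -- Sort the choices by the blocks in which the added zero is not taken: none, one or two of them
  -- give 1 + 4 * 4 + 6 * 12 = 89, three or four give 168.
  N4≥257 : ∀ {x y z u} → Small x → Small y → Small z → Small u → 257 ≤ N (x ∷ y ∷ z ∷ u ∷ []) 0
  N4≥257 {x} {y} {z} {u} X Y Z U = begin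
      89 + 168 ≤⟨ +-mono-≤ (+-mono-≤ (+-mono-≤ (+-mono-≤ low0 (4≤∑low U)) (+-mono-≤ (4≤∑low Z) (S2≥12 Z U)))
                    (+-mono-≤ (+-mono-≤ (4≤∑low Y) (S2≥12 Y U)) (+-mono-≤ (S2≥12 Y Z) (+-mono-≤ (+-mono-≤ (4≤∑low X) (S2≥12 X U)) (+-mono-≤ (S2≥12 X Z) (S2≥12 X Y))))))
                    (S34≥168 X Y Z U) ⟩
      (a + (sy + p + (q + (sx + r + (s + w))))) + (S3 x y z + S3 x y u + S3 x z u + S3 y z u + S4 x y z u)
        ≡⟨ e a sy p q sx r s w (S3 x y z) (S3 x y u) (S3 x z u) (S3 y z u) (S4 x y z u) ⟩
      a + (sy + p + (q + S3 y z u)) + (sx + r + (s + S3 x z u) + (w + S3 x y u + (S3 x y z + S4 x y z u)))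
        ≡⟨ cong (_+ (sx + r + (s + S3 x z u) + (w + S3 x y u + (S3 x y z + S4 x y z u)))) (N3₀ y z u) ⟨
      N (y ∷ z ∷ u ∷ []) 0 + (sx + r + (s + S3 x z u) + (w + S3 x y u + (S3 x y z + S4 x y z u)))
        ≡⟨ N4₀ x y z u ⟨
      N (x ∷ y ∷ z ∷ u ∷ []) 0 ∎
    where
    open ≤-Reasoning
    a = low 0 + ∑low u + (∑low z + S2 z u)
    sy = ∑low y
    p = S2 y u
    q = S2 y z
    sx = ∑low x
    r = S2 x u
    s = S2 x z
    w = S2 x y
    e : ∀ a sy p q sx r s w A B C D E → (a + (sy + p + (q + (sx + r + (s + w))))) + (A + B + C + D + E) ≡ a + (sy + p + (q + D)) + (sx + r + (s + C) + (w + B + (A + E)))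
    e = solve-∀

  star? : ∀ x → ∑ x ≡ t → Small x ⊎ ∃ λ i → t ≤ x i
  star? x h with x 0F <? t | x 1F <? t | x 2F <? t | x 3F <? t
  ... | no p | _ | _ | _ = inj₂ (0F , ≮⇒≥ p)
  ... | _ | no p | _ | _ = inj₂ (1F , ≮⇒≥ p)
  ... | _ | _ | no p | _ = inj₂ (2F , ≮⇒≥ p)
  ... | _ | _ | _ | no p = inj₂ (3F , ≮⇒≥ p)
  ... | yes p | yes q | yes r | yes s = inj₁ (record { sum≡ = h ; <t = λ { 0F → p ; 1F → q ; 2F → r ; 3F → s } })

  others : ∀ x → ∑ x ≡ t → ∀ i → t ≤ x i → ∀ j → i ≢ j → x j ≡ 0
  others x h i p j ne = n≤0⇒n≡0 (+-cancelˡ-≤ t _ _ (≤-trans (+-monoˡ-≤ (x j) p) (≤-trans (two {4} {x} i j ne) (≤-reflexive (trans h (sym (+-identityʳ t)))))))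
    where
    two : ∀ {n} {f : Fin n → ℕ} (i j : Fin n) → i ≢ j → f i + f j ≤ ∑ f
    two {f = f} zero zero ne = ⊥-elim (ne refl)
    two {f = f} zero (suc j) ne = +-monoʳ-≤ (f zero) (term≤∑ (f ∘ suc) j)
    two {f = f} (suc i) zero ne = ≤-trans (≤-reflexive (+-comm (f (suc i)) _)) (+-monoʳ-≤ (f zero) (term≤∑ (f ∘ suc) i))
    two {f = f} (suc i) (suc j) ne = ≤-trans (two {f = f ∘ suc} i j (ne ∘ cong suc)) (m≤n+m _ _)

  three-zeros : ∀ x → ∑ x ≡ t → (∃ λ i → t ≤ x i) → 3 ≤ #z x
  three-zeros x h (i , p) = go i (others x h i p)
    where
    go : ∀ i → (∀ j → i ≢ j → x j ≡ 0) → 3 ≤ #z x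
    go 0F o rewrite o 1F (λ ()) | o 2F (λ ()) | o 3F (λ ()) = m≤n+m 3 (zer (x 0F))
    go 1F o rewrite o 0F (λ ()) | o 2F (λ ()) | o 3F (λ ()) = s≤s (m≤n+m 2 (zer (x 1F)))
    go 2F o rewrite o 0F (λ ()) | o 1F (λ ()) | o 3F (λ ()) = s≤s (s≤s (m≤n+m 1 (zer (x 2F))))
    go 3F o rewrite o 0F (λ ()) | o 1F (λ ()) | o 2F (λ ()) = s≤s (s≤s (s≤s z≤n))

  -- A star has four zeros, counting the added one.
  N-star : ∀ x bs a → 3 ≤ #z x → 4 * N bs a ≤ N (x ∷ bs) a
  N-star x bs a h = +-monoʳ-≤ (N bs a) (begin
      3 * N bs a ≤⟨ *-monoˡ-≤ (N bs a) h ⟩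
      #z x * N bs a ≡⟨ *-distribʳ-sum (N bs a) (zer ∘ x) ⟩
      ∑ (λ i → zer (x i) * N bs a) ≤⟨ ∑-mono (λ i → cell (x i)) ⟩
      ∑ (λ i → N bs (a + x i)) ∎)
    where
    open ≤-Reasoning
    cell : ∀ m → zer m * N bs a ≤ N bs (a + m)
    cell zero rewrite +-identityʳ a = ≤-reflexive (+-identityʳ _)
    cell (suc m) = z≤n

  N-mono : ∀ {bs bs′} c x → (∀ a → c * N bs′ a ≤ N bs a) → ∀ a → c * N (x ∷ bs′) a ≤ N (x ∷ bs) a
  N-mono {bs} {bs′} c x h a = ≤-trans (≤-reflexive (trans (*-distribˡ-+ c (N bs′ a) _) (cong (c * N bs′ a +_) (*-distribˡ-sum c (λ i → N bs′ (a + x i))))))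
    (+-mono-≤ (h a) (∑-mono (λ i → h (a + x i))))

  star : Block → ℕ
  star x = ⟦ does (Finₚ.any? (λ i → t ≤? x i)) ⟧

  star-yes : ∀ x → (∃ λ i → t ≤ x i) → star x ≡ 1
  star-yes x w = ⟦⟧-yes (Finₚ.any? (λ i → t ≤? x i)) w

  private
    Reduced : List Block → Set
    Reduced bs = ∃ λ bs′ → ∃ λ k → All Small bs′ × length bs′ + k ≡ length bs
      × (bs′ ≡ [] → All (λ x → star x ≡ 1) bs) × (∀ a → 4 ^ k * N bs′ a ≤ N bs a)

    -- Stars are stripped off, each worth a factor 4 by `N-star`; `k` counts them, `bs′` keeps the
    -- small blocks. `N-mono` carries the inequality through a small block put back in front.
    reduce : ∀ bs → All (λ x → ∑ x ≡ t) bs → Reduced bs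
    reduce [] [] = [] , 0 , [] , refl , (λ _ → []) , λ a → ≤-reflexive (+-identityʳ _)
    reduce (x ∷ bs) (h ∷ hs) with reduce bs hs | star? x h
    ... | bs′ , k , S , e , st , le | inj₁ X = x ∷ bs′ , k , X ∷ S , cong suc e , (λ ()) , N-mono {bs} {bs′} (4 ^ k) x le
    ... | bs′ , k , S , e , st , le | inj₂ w = bs′ , suc k , S , trans (+-suc _ k) (cong suc e) , (λ q → star-yes x w ∷ st q)
        , λ a → ≤-trans (≤-reflexive (*-assoc 4 (4 ^ k) (N bs′ a))) (≤-trans (*-monoʳ-≤ 4 (le a)) (N-star x bs a (three-zeros x h w)))

  -- Four stars have exactly 4 ^ 4 low transversals; every other choice of blocks has more.
  local : ∀ x y z u → ∑ x ≡ t → ∑ y ≡ t → ∑ z ≡ t → ∑ u ≡ t →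
    257 ≤ N (x ∷ y ∷ z ∷ u ∷ []) 0 + star x * (star y * (star z * star u))
  local x y z u hx hy hz hu = conclude (reduce (x ∷ y ∷ z ∷ u ∷ []) (hx ∷ hy ∷ hz ∷ hu ∷ []))
    where
    P = star x * (star y * (star z * star u))
    total = N (x ∷ y ∷ z ∷ u ∷ []) 0
    all-stars : All (λ x → star x ≡ 1) (x ∷ y ∷ z ∷ u ∷ []) → 1 ≤ P
    all-stars (sx ∷ sy ∷ sz ∷ su ∷ []) = ≤-reflexive (sym (cong₂ _*_ sx (cong₂ _*_ sy (cong₂ _*_ sz su))))
    conclude : Reduced (x ∷ y ∷ z ∷ u ∷ []) → 257 ≤ total + P
    conclude ([] , 4 , [] , refl , st , le) = +-mono-≤ (≤-trans (*-monoʳ-≤ 256 low0) (le 0)) (all-stars (st refl))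
    conclude (a ∷ [] , 3 , A ∷ [] , refl , st , le) =
      ≤-trans (m≤m+n 257 63) (≤-trans (≤-trans (*-monoʳ-≤ 64 (+-mono-≤ low0 (4≤∑low A))) (le 0)) (m≤m+n total P))
    conclude (a ∷ b ∷ [] , 2 , A ∷ B ∷ [] , refl , st , le) =
      ≤-trans (m≤m+n 257 15) (≤-trans (≤-trans (*-monoʳ-≤ 16 (N2≥17 A B)) (le 0)) (m≤m+n total P))
    conclude (a ∷ b ∷ c ∷ [] , 1 , A ∷ B ∷ C ∷ [] , refl , st , le) =
      ≤-trans (m≤m+n 257 3) (≤-trans (≤-trans (*-monoʳ-≤ 4 (N3≥65 A B C)) (le 0)) (m≤m+n total P))
    conclude (a ∷ b ∷ c ∷ d ∷ [] , 0 , A ∷ B ∷ C ∷ D ∷ [] , refl , st , le) =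
      ≤-trans (≤-trans (≤-trans (N4≥257 A B C D) (≤-reflexive (sym (+-identityʳ _)))) (le 0)) (m≤m+n total P)

-- Counting the edges through an optimal fractional cover

expand : ∀ {A : Set} E → (Fin E → A) → (Fin E → ℕ) → List A
expand zero x y = []
expand (suc E) x y = replicate (y zero) (x zero) ++ expand E (x ∘ suc) (y ∘ suc)

sumL-expand : ∀ {A : Set} (f : A → ℕ) E (x : Fin E → A) y → sumL f (expand E x y) ≡ ∑ (λ e → y e * f (x e))
sumL-expand f zero x y = refl
sumL-expand f (suc E) x y = trans (sumL-++ f (replicate (y zero) (x zero)) _) (cong₂ _+_ (sumL-replicate f (y zero) (x zero)) (sumL-expand f E (x ∘ suc) (y ∘ suc)))

All-expand : ∀ {A : Set} {P : A → Set} E {x : Fin E → A} y → (∀ e → P (x e)) → All P (expand E x y)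
All-expand zero y p = []
All-expand (suc E) y p = Allₚ.++⁺ (Allₚ.replicate⁺ (y zero) (p zero)) (All-expand E (y ∘ suc) (p ∘ suc))

-- The fractional matching is a list of edges with repetitions, `t` being the capacity of a vertex,
-- so that rounding and counting can treat it as a list.
record Duality (F : Rel n) : Set where
  field
    t : ℕ
    w : Fin n → ℕ
    B : List (Tup n)
    0<t : 0 < t
    inF : All (λ τ → F τ ≡ true) B
    cover : ∀ τ → F τ ≡ true → t ≤ wt w τ
    loads : ∀ v → load B v ≤ t
    value : ∑ w ≤ length B

duality : (F : Rel n) → Duality F
duality {n} F = build (lp-duality n (length es) inc hit)
  where
  every : List (Tup n)
  every = cartesianProduct (allFin n) (cartesianProduct (allFin n) (cartesianProduct (allFin n) (allFin n)))
  es : List (Tup n)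
  es = filter (λ τ → F τ Boolₚ.≟ true) every
  edge : Fin (length es) → Tup n
  edge = List.lookup es
  inc : Fin (length es) → Fin n → ℕ
  inc e v = cnt v (edge e)
  hit : ∀ e → ∃ λ v → 1 ≤ inc e v
  hit e = first (edge e)
    where
    first : ∀ τ → ∃ λ v → 1 ≤ cnt v τ
    first (a , b , c , d) = a , ≤-trans (≤-reflexive (cong ⟦_⟧ (sym (==-refl a)))) (m≤m+n _ _)
  build : _ → Duality F
  build (t , w , y , 0<t , cov , match , val) = record
    { t = t ; w = w ; B = B ; 0<t = 0<t
    ; inF = All-expand (length es) y (λ e → All.lookup (Allₚ.all-filter (λ τ → F τ Boolₚ.≟ true) every) (∈-lookup e))
    ; cover = covers
    ; loads = λ v → ≤-trans (≤-reflexive (trans (sumL-expand (cnt v) (length es) edge y) (sum-cong-≗ (λ e → *-comm (y e) (inc e v))))) (match v)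
    ; value = ≤-trans val (≤-reflexive (sym (trans (sym (sumL-1 B)) (trans (sumL-expand (λ _ → 1) (length es) edge y) (sum-cong-≗ (λ e → *-identityʳ (y e)))))))
    }
    where
    B = expand (length es) edge y
    covers : ∀ τ → F τ ≡ true → t ≤ wt w τ
    covers τ@(a , b , c , d) Fτ = subst (λ σ → t ≤ wt w σ) (sym (lookup-index τ∈)) (≤-trans (cov (Any.index τ∈)) (≤-reflexive (∑-cnt w (edge (Any.index τ∈)))))
      where
      τ∈ : τ ∈ es
      τ∈ = ∈-filter⁺ (λ τ → F τ Boolₚ.≟ true) (∈-cartesianProduct⁺ (∈-allFin a) (∈-cartesianProduct⁺ (∈-allFin b) (∈-cartesianProduct⁺ (∈-allFin c) (∈-allFin d)))) Fτ

sumL-mono-All : ∀ {A : Set} {P : A → Set} {f g : A → ℕ} {xs} → All P xs → (∀ x → P x → f x ≤ g x) → sumL f xs ≤ sumL g xs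
sumL-mono-All [] h = z≤n
sumL-mono-All {xs = x ∷ _} (p ∷ ps) h = +-mono-≤ (h x p) (sumL-mono-All ps h)

sumL-+ : ∀ {A : Set} (f g : A → ℕ) xs → sumL (λ x → f x + g x) xs ≡ sumL f xs + sumL g xs
sumL-+ f g [] = refl
sumL-+ f g (x ∷ xs) = trans (cong (f x + g x +_) (sumL-+ f g xs)) (e (f x) (g x) (sumL f xs) (sumL g xs))
  where
  e : ∀ a b c d → (a + b) + (c + d) ≡ (a + c) + (b + d)
  e = solve-∀

sumL-cong : ∀ {A : Set} {f g : A → ℕ} xs → (∀ x → f x ≡ g x) → sumL f xs ≡ sumL g xs
sumL-cong [] h = refl
sumL-cong (x ∷ xs) h = cong₂ _+_ (h x) (sumL-cong xs h)

sumL-const : ∀ {A : Set} c (xs : List A) → sumL (λ _ → c) xs ≡ length xs * c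
sumL-const c [] = refl
sumL-const c (x ∷ xs) = cong (c +_) (sumL-const c xs)

sumL-map : ∀ {A B : Set} (f : B → ℕ) (g : A → B) xs → sumL f (map g xs) ≡ sumL (f ∘ g) xs
sumL-map f g [] = refl
sumL-map f g (x ∷ xs) = cong (f (g x) +_) (sumL-map f g xs)

module Slackness {n} {F : Rel n} (D : Duality F) where
  open Duality D public

  Y : ℕ
  Y = length B

  private
    squeeze : t * Y ≤ ∑ (λ v → load B v * w v)
    squeeze = begin
      t * Y ≡⟨ trans (*-comm t Y) (sym (sumL-const t B)) ⟩
      sumL (λ _ → t) B ≤⟨ sumL-mono-All inF cover ⟩
      sumL (wt w) B ≡⟨ sumL-wt w B ⟩
      ∑ (λ v → load B v * w v) ∎
      where open ≤-Reasoning

    cap : ∑ (λ v → t * w v) ≤ t * Y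
    cap = ≤-trans (≤-reflexive (sym (*-distribˡ-sum t w))) (*-monoʳ-≤ t value)

  -- The chain t Y ≤ ∑ load * w ≤ t * ∑ w ≤ t Y consists of equalities, hence so do its termwise
  -- comparisons. `tight-edge` draws the same conclusion for the sum over edges.
  tight-vertex : ∀ v → load B v * w v ≡ t * w v
  tight-vertex v = ≤-antisym (*-monoˡ-≤ (w v) (loads v)) (≮⇒≥ λ lt →
    <⇒≱ (∑-mono-< (λ u → *-monoˡ-≤ (w u) (loads u)) v lt) (≤-trans cap squeeze))

  ∑w≡Y : ∑ w ≡ Y
  ∑w≡Y = ≤-antisym value (*-cancelˡ-≤ t {{>-nonZero 0<t}} (≤-trans squeeze (≤-trans (∑-mono (λ v → *-monoˡ-≤ (w v) (loads v))) (≤-reflexive (sym (*-distribˡ-sum t w))))))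

  tight-edge : All (λ τ → wt w τ ≡ t) B
  tight-edge = go B inF (≤-trans (≤-reflexive (sumL-wt w B)) (≤-trans (∑-mono (λ v → *-monoˡ-≤ (w v) (loads v))) (≤-trans cap (≤-reflexive (*-comm t Y)))))
    where
    go : ∀ B → All (λ τ → F τ ≡ true) B → sumL (wt w) B ≤ length B * t → All (λ τ → wt w τ ≡ t) B
    go [] [] h = []
    go (τ ∷ B) (Fτ ∷ FB) h = ≤-antisym (+-cancelʳ-≤ (length B * t) _ _ (≤-trans (+-monoʳ-≤ (wt w τ) rest≥) h)) (cover τ Fτ)
      ∷ go B FB (+-cancelˡ-≤ t _ _ (≤-trans (+-monoˡ-≤ (sumL (wt w) B) (cover τ Fτ)) h))
      where
      rest≥ : length B * t ≤ sumL (wt w) B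
      rest≥ = ≤-trans (≤-reflexive (sym (sumL-const t B))) (sumL-mono-All FB cover)

  unused : ℕ
  unused = ∑ (λ v → t ∸ load B v)

  unused-total : unused + 4 * Y ≡ n * t
  unused-total = begin
    unused + 4 * Y ≡⟨ cong (unused +_) (trans (*-comm 4 Y) (trans (sym (sumL-const 4 B)) (sumL-wt (λ _ → 1) B))) ⟩
    unused + ∑ (λ v → load B v * 1) ≡⟨ ∑-distrib-+ (λ v → t ∸ load B v) (λ v → load B v * 1) ⟨
    ∑ (λ v → (t ∸ load B v) + load B v * 1) ≡⟨ sum-cong-≗ (λ v → trans (cong (t ∸ load B v +_) (*-identityʳ _)) (m∸n+n≡m (loads v))) ⟩
    ∑ {n} (λ v → t) ≡⟨ ∑-const n t ⟩
    n * t ∎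
    where open ≡-Reasoning

  -- By complementary slackness the unused capacity sits on vertices of weight 0.
  redistribute : ∀ (h : ℕ → ℕ) → t * ∑ (h ∘ w) ≡ ∑ (λ v → load B v * h (w v)) + unused * h 0
  redistribute h = begin
    t * ∑ (h ∘ w) ≡⟨ *-distribˡ-sum t (h ∘ w) ⟩
    ∑ (λ v → t * h (w v)) ≡⟨ sum-cong-≗ each ⟩
    ∑ (λ v → load B v * h (w v) + (t ∸ load B v) * h 0) ≡⟨ ∑-distrib-+ (λ v → load B v * h (w v)) (λ v → (t ∸ load B v) * h 0) ⟩
    ∑ (λ v → load B v * h (w v)) + ∑ (λ v → (t ∸ load B v) * h 0) ≡⟨ cong (∑ (λ v → load B v * h (w v)) +_) (*-distribʳ-sum (h 0) (λ v → t ∸ load B v)) ⟨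
    ∑ (λ v → load B v * h (w v)) + unused * h 0 ∎
    where
    open ≡-Reasoning
    each : ∀ v → t * h (w v) ≡ load B v * h (w v) + (t ∸ load B v) * h 0
    each v with w v | tight-vertex v
    ... | zero | _ = trans (cong (_* h 0) (sym (m+[n∸m]≡n (loads v)))) (*-distribʳ-+ (h 0) (load B v) _)
    ... | suc k | e rewrite *-cancelʳ-≡ (load B v) t (suc k) e | n∸n≡0 t = sym (+-identityʳ _)

-- `balance` determines the number `T` of added stars. Only Y ≤ t (s + κ) will be known, so 5 Y may
-- exceed n t; 5 κ t further zeros make up for this. Once each edge of `B` has taken a zero, `T`
-- zeros are left, enough for T / 4 stars, which is why everything is then taken four times.
module Counting {n} {F : Rel n} (D : Duality F) (κ T : ℕ) (balance : T + 5 * length (Duality.B D) ≡ n * Duality.t D + 5 * (κ * Duality.t D)) where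
  open Slackness D
  open Local t 0<t

  edge-block : Tup n → Block
  edge-block (a , b , c , d) 0F = w a
  edge-block (a , b , c , d) 1F = w b
  edge-block (a , b , c , d) 2F = w c
  edge-block (a , b , c , d) 3F = w d

  star-block : Block
  star-block 0F = t
  star-block 1F = 0
  star-block 2F = 0
  star-block 3F = 0

  -- Take 4t copies of the weight of every vertex, T further weights t and 20κt further zeros.
  -- They split into these blocks, where every edge block uses one zero and every star four.
  edges₁ blocks : List Block
  edges₁ = map edge-block B
  blocks = edges₁ ++ (edges₁ ++ (edges₁ ++ (edges₁ ++ replicate T star-block)))

  sumL-blocks : ∀ (f : Block → ℕ) → sumL f blocks ≡ 4 * sumL (f ∘ edge-block) B + T * f star-block
  sumL-blocks f = begin
    sumL f blocks ≡⟨ trans (sumL-++ f edges₁ _) (cong (s +_) (trans (sumL-++ f edges₁ _) (cong (s +_) (trans (sumL-++ f edges₁ _) (cong (s +_) (trans (sumL-++ f edges₁ _) (cong (s +_) (sumL-replicate f T star-block)))))))) ⟩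
    s + (s + (s + (s + T * f star-block))) ≡⟨ e s (T * f star-block) ⟩
    4 * s + T * f star-block ≡⟨ cong (λ z → 4 * z + T * f star-block) (sumL-map f edge-block B) ⟩
    4 * sumL (f ∘ edge-block) B + T * f star-block ∎
    where
    open ≡-Reasoning
    s = sumL f edges₁
    e : ∀ s x → s + (s + (s + (s + x))) ≡ 4 * s + x
    e = solve-∀

  balanced : All (λ x → ∑ x ≡ t) blocks
  balanced = Allₚ.++⁺ es (Allₚ.++⁺ es (Allₚ.++⁺ es (Allₚ.++⁺ es (Allₚ.replicate⁺ T (+-identityʳ t)))))
    where
    ∑-edge : ∀ τ → ∑ (edge-block τ) ≡ wt w τ
    ∑-edge (a , b , c , d) = cong (λ z → w a + (w b + (w c + z))) (+-identityʳ (w d))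
    es : All (λ x → ∑ x ≡ t) edges₁
    es = Allₚ.map⁺ (All.map (λ {τ} h → trans (∑-edge τ) h) tight-edge)

  E : (ℕ → ℕ) → ℕ
  E h = sumL (λ b → h 0 + ∑ (h ∘ b)) blocks

  pad : ℕ
  pad = 20 * (κ * t)

  E-formula : ∀ h → E h ≡ 4 * t * ∑ (h ∘ w) + pad * h 0 + T * h t
  E-formula h = +-cancelʳ-≡ (4 * (unused * h 0)) _ _ (begin
      E h + 4 * (unused * h 0)
        ≡⟨ cong (_+ 4 * (unused * h 0)) (trans (sumL-blocks (λ b → h 0 + ∑ (h ∘ b))) (cong (λ z → 4 * z + T * (h 0 + ∑ (h ∘ star-block))) edge-sum)) ⟩
      4 * (Y * h 0 + W) + T * (h 0 + (h t + (h 0 + (h 0 + (h 0 + 0))))) + 4 * (unused * h 0)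
        ≡⟨ e₁ Y (h 0) W T (h t) unused ⟩
      4 * (W + unused * h 0) + (4 * T + 4 * Y) * h 0 + T * h t
        ≡⟨ cong₂ (λ x y → 4 * x + y * h 0 + T * h t) (sym (redistribute h)) count ⟩
      4 * (t * ∑ (h ∘ w)) + (pad + 4 * unused) * h 0 + T * h t
        ≡⟨ e₂ t (∑ (h ∘ w)) pad unused (h 0) (T * h t) ⟩
      4 * t * ∑ (h ∘ w) + pad * h 0 + T * h t + 4 * (unused * h 0) ∎)
    where
    open ≡-Reasoning
    W = ∑ (λ v → load B v * h (w v))
    edge-sum : sumL ((λ b → h 0 + ∑ (h ∘ b)) ∘ edge-block) B ≡ Y * h 0 + W
    edge-sum = trans (sumL-+ (λ _ → h 0) (λ τ → ∑ (h ∘ edge-block τ)) B) (cong₂ _+_ (sumL-const (h 0) B)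
      (trans (sumL-cong B (λ { (a , b , c , d) → cong (λ z → h (w a) + (h (w b) + (h (w c) + z))) (+-identityʳ (h (w d))) })) (sumL-wt (h ∘ w) B)))
    count : 4 * T + 4 * Y ≡ pad + 4 * unused
    count = +-cancelʳ-≡ (16 * Y) _ _ (begin
      4 * T + 4 * Y + 16 * Y ≡⟨ f₁ T Y ⟩
      4 * (T + 5 * Y) ≡⟨ cong (4 *_) balance ⟩
      4 * (n * t + 5 * (κ * t)) ≡⟨ cong (λ z → 4 * (z + 5 * (κ * t))) unused-total ⟨
      4 * (unused + 4 * Y + 5 * (κ * t)) ≡⟨ f₂ unused Y (κ * t) ⟩
      20 * (κ * t) + 4 * unused + 16 * Y ∎)
      where
      f₁ : ∀ T Y → 4 * T + 4 * Y + 16 * Y ≡ 4 * (T + 5 * Y)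
      f₁ = solve-∀
      f₂ : ∀ u Y k → 4 * (u + 4 * Y + 5 * k) ≡ 20 * k + 4 * u + 16 * Y
      f₂ = solve-∀
    e₁ : ∀ Y h W T k u → 4 * (Y * h + W) + T * (h + (k + (h + (h + (h + 0))))) + 4 * (u * h) ≡ 4 * (W + u * h) + (4 * T + 4 * Y) * h + T * k
    e₁ = solve-∀
    e₂ : ∀ t s p u h k → 4 * (t * s) + (p + 4 * u) * h + k ≡ 4 * t * s + p * h + k + 4 * (u * h)
    e₂ = solve-∀

  lowE : ℕ → ℕ → ℕ
  lowE zero a = low a
  lowE (suc k) a = E (λ x → lowE k (a + x))

  Sᵏ : ℕ → (List Block → ℕ) → ℕ
  Sᵏ zero f = f []
  Sᵏ (suc k) f = sumL (λ b → Sᵏ k (λ bs → f (b ∷ bs))) blocks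

  Sᵏ-cong : ∀ k {f g : List Block → ℕ} → (∀ bs → f bs ≡ g bs) → Sᵏ k f ≡ Sᵏ k g
  Sᵏ-cong zero h = h []
  Sᵏ-cong (suc k) h = sumL-cong blocks (λ b → Sᵏ-cong k (λ bs → h (b ∷ bs)))

  Sᵏ-+ : ∀ k (f g : List Block → ℕ) → Sᵏ k (λ bs → f bs + g bs) ≡ Sᵏ k f + Sᵏ k g
  Sᵏ-+ zero f g = refl
  Sᵏ-+ (suc k) f g = trans (sumL-cong blocks (λ b → Sᵏ-+ k (f ∘ (b ∷_)) (g ∘ (b ∷_)))) (sumL-+ _ _ blocks)

  Sᵏ-∑ : ∀ k {m} (f : Fin m → List Block → ℕ) → Sᵏ k (λ bs → ∑ (λ i → f i bs)) ≡ ∑ (λ i → Sᵏ k (f i))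
  Sᵏ-∑ zero f = refl
  Sᵏ-∑ (suc k) {m} f = trans (sumL-cong blocks (λ b → Sᵏ-∑ k (λ i bs → f i (b ∷ bs)))) (sumL-∑ {m} (λ b i → Sᵏ k (λ bs → f i (b ∷ bs))) blocks)

  lowE-blocks : ∀ k a → Sᵏ k (λ bs → N bs a) ≡ lowE k a
  lowE-blocks zero a = refl
  lowE-blocks (suc k) a = sumL-cong blocks λ b →
    trans (Sᵏ-+ k (λ bs → N bs a) (λ bs → ∑ (λ i → N bs (a + b i))))
      (cong₂ _+_ (trans (lowE-blocks k a) (cong (lowE k) (sym (+-identityʳ a))))
        (trans (Sᵏ-∑ k (λ i bs → N bs (a + b i))) (sum-cong-≗ (λ i → lowE-blocks k (a + b i)))))

  M S★ : ℕ
  M = 4 * Y + T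
  S★ = 4 * sumL (star ∘ edge-block) B + T

  length-blocks : length blocks ≡ M
  length-blocks = trans (sym (sumL-1 blocks)) (trans (sumL-blocks (λ _ → 1)) (cong₂ (λ x y → 4 * x + y) (sumL-1 B) (*-identityʳ T)))

  stars : sumL star blocks ≡ S★
  stars = trans (sumL-blocks star) (cong (4 * sumL (star ∘ edge-block) B +_) (trans (cong (T *_) (star-yes star-block (0F , ≤-refl))) (*-identityʳ T)))

  local-sum : M * (M * (M * (M * 257))) ≤ lowE 4 0 + S★ * (S★ * (S★ * S★))
  local-sum = begin
      M * (M * (M * (M * 257)))
        ≡⟨ constant ⟨
      sumL (λ x → sumL (λ y → sumL (λ z → sumL (λ u → 257) blocks) blocks) blocks) blocks
        ≤⟨ sumL-mono-All balanced (λ x hx → sumL-mono-All balanced (λ y hy → sumL-mono-All balanced (λ z hz → sumL-mono-All balanced (λ u hu → local x y z u hx hy hz hu)))) ⟩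
      Sᵏ 4 (λ bs → N bs 0 + stars₄ bs)
        ≡⟨ Sᵏ-+ 4 (λ bs → N bs 0) stars₄ ⟩
      Sᵏ 4 (λ bs → N bs 0) + Sᵏ 4 stars₄
        ≡⟨ cong₂ _+_ (lowE-blocks 4 0) product ⟩
      lowE 4 0 + S★ * (S★ * (S★ * S★)) ∎
    where
    open ≤-Reasoning
    stars₄ : List Block → ℕ
    stars₄ (x ∷ y ∷ z ∷ u ∷ _) = star x * (star y * (star z * star u))
    stars₄ _ = 0
    l = length-blocks
    const′ : ∀ c → sumL (λ (_ : Block) → c) blocks ≡ M * c
    const′ c = trans (sumL-const c blocks) (cong (_* c) l)
    constant : sumL (λ x → sumL (λ y → sumL (λ z → sumL (λ u → 257) blocks) blocks) blocks) blocks ≡ M * (M * (M * (M * 257)))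
    constant = trans (const′ _) (cong (M *_) (trans (const′ _) (cong (M *_) (trans (const′ _) (cong (M *_) (const′ 257))))))
    pull : ∀ c → sumL (λ x → star x * c) blocks ≡ S★ * c
    pull c = trans (sumL-cong blocks (λ x → *-comm (star x) c)) (trans (sumL-*ˡ c star blocks) (trans (*-comm c _) (cong (_* c) stars)))
    product : Sᵏ 4 stars₄ ≡ S★ * (S★ * (S★ * S★))
    product = trans (sumL-cong blocks λ x → trans (sumL-cong blocks λ y → trans (sumL-cong blocks λ z →
        trans (sumL-*ˡ (star x) (λ u → star y * (star z * star u)) blocks) (cong (star x *_) (trans (sumL-*ˡ (star y) (λ u → star z * star u) blocks) (cong (star y *_) (trans (sumL-*ˡ (star z) star blocks) (cong (star z *_) stars))))))
        (trans (sumL-*ˡ (star x) (λ z → star y * (star z * S★)) blocks) (cong (star x *_) (trans (sumL-*ˡ (star y) (λ z → star z * S★) blocks) (cong (star y *_) (pull S★))))))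
        (trans (sumL-*ˡ (star x) (λ y → star y * (S★ * S★)) blocks) (cong (star x *_) (pull (S★ * S★)))))
        (pull (S★ * (S★ * S★)))

  lowE-high : ∀ k a → t ≤ a → lowE k a ≡ 0
  lowE-high zero a h = low-no h
  lowE-high (suc k) a h = trans (E-formula (λ x → lowE k (a + x)))
    (trans (cong₂ (λ x y → 4 * t * x + pad * y + T * lowE k (a + t)) (trans (sum-cong-≗ (λ v → z (w v))) (trans (∑-const n 0) (*-zeroʳ n))) (z 0))
      (trans (cong₂ (λ x y → 4 * t * 0 + x + T * y) (*-zeroʳ pad) (z t)) (trans (cong (4 * t * 0 + 0 +_) (*-zeroʳ T)) (e t))))
    where
    z : ∀ x → lowE k (a + x) ≡ 0
    z x = lowE-high k (a + x) (≤-trans h (m≤m+n a x))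
    e : ∀ t → 4 * t * 0 + 0 + 0 ≡ 0
    e = solve-∀

  lowE-suc : ∀ k a → lowE (suc k) a ≡ 4 * t * ∑ (λ v → lowE k (a + w v)) + pad * lowE k (a + 0)
  lowE-suc k a = trans (E-formula (λ x → lowE k (a + x))) (trans (cong (λ z → X + T * z) (lowE-high k (a + t) (m≤n+m t a))) (trans (cong (X +_) (*-zeroʳ T)) (+-identityʳ X)))
    where X = 4 * t * ∑ (λ v → lowE k (a + w v)) + pad * lowE k (a + 0)

  realE : ℕ → ℕ → ℕ
  realE zero a = low a
  realE (suc k) a = 4 * t * ∑ (λ v → realE k (a + w v))

  μ : ℕ
  μ = 4 * t * n + pad

  error : ℕ → ℕ
  error zero = 0
  error (suc k) = μ * error k + pad * μ ^ k

  lowE≤ : ∀ k a → lowE k a ≤ μ ^ k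
  lowE≤ zero a = low≤1 a
  lowE≤ (suc k) a = begin
      lowE (suc k) a ≡⟨ lowE-suc k a ⟩
      4 * t * ∑ (λ v → lowE k (a + w v)) + pad * lowE k (a + 0) ≤⟨ +-mono-≤ (*-monoʳ-≤ (4 * t) (∑-mono (λ v → lowE≤ k (a + w v)))) (*-monoʳ-≤ pad (lowE≤ k (a + 0))) ⟩
      4 * t * ∑ {n} (λ v → μ ^ k) + pad * μ ^ k ≡⟨ cong (λ z → 4 * t * z + pad * μ ^ k) (∑-const n (μ ^ k)) ⟩
      4 * t * (n * μ ^ k) + pad * μ ^ k ≡⟨ e (4 * t) n (μ ^ k) pad ⟩
      μ * μ ^ k ∎
    where
    open ≤-Reasoning
    e : ∀ f n m p → f * (n * m) + p * m ≡ (f * n + p) * m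
    e = solve-∀

  -- The weights `t` brought in by the stars occur in no low sum, by `lowE-high`. The padding zeros
  -- may occur; choices with at least one of them are absorbed by `error`, and `realE` keeps the
  -- choices made of genuine vertices.
  lowE≤real : ∀ k a → lowE k a ≤ realE k a + error k
  lowE≤real zero a = m≤m+n _ _
  lowE≤real (suc k) a = begin
      lowE (suc k) a ≡⟨ lowE-suc k a ⟩
      4 * t * ∑ (λ v → lowE k (a + w v)) + pad * lowE k (a + 0) ≤⟨ +-mono-≤ (*-monoʳ-≤ (4 * t) (∑-mono (λ v → lowE≤real k (a + w v)))) (*-monoʳ-≤ pad (lowE≤ k (a + 0))) ⟩
      4 * t * ∑ (λ v → realE k (a + w v) + error k) + pad * μ ^ k ≡⟨ cong (λ z → 4 * t * z + pad * μ ^ k) (trans (∑-distrib-+ (λ v → realE k (a + w v)) (λ _ → error k)) (cong (R +_) (∑-const n (error k)))) ⟩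
      4 * t * (R + n * error k) + pad * μ ^ k ≤⟨ +-monoˡ-≤ (pad * μ ^ k) (≤-trans (m≤m+n _ (pad * error k)) (≤-reflexive (e (4 * t) R n (error k) pad))) ⟩
      4 * t * R + μ * error k + pad * μ ^ k ≡⟨ +-assoc (4 * t * R) (μ * error k) _ ⟩
      realE (suc k) a + error (suc k) ∎
    where
    open ≤-Reasoning
    R = ∑ (λ v → realE k (a + w v))
    e : ∀ f r n x p → f * (r + n * x) + p * x ≡ f * r + (f * n + p) * x
    e = solve-∀

  lows : ℕ
  lows = Στ λ { (a , b , c , d) → low (w a + w b + w c + w d) }

  realE₄ : realE 4 0 ≡ 256 * (t * t * t * t) * lows
  realE₄ = trans (cong (f *_) (trans (sum-cong-≗ (λ a → trans (cong (f *_) (trans (sum-cong-≗ (λ b → trans (cong (f *_) (sym (*-distribˡ-sum f (λ c → ∑ (λ d → low (w a + w b + w c + w d)))))) (sym (*-assoc f f _))))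
      (sym (*-distribˡ-sum (f * f) (λ b → ∑ (λ c → ∑ (λ d → low (w a + w b + w c + w d))))))))
      (sym (*-assoc f (f * f) _))))
      (sym (*-distribˡ-sum (f * (f * f)) (λ a → ∑ (λ b → ∑ (λ c → ∑ (λ d → low (w a + w b + w c + w d)))))))))
    (e t lows)
    where
    f = 4 * t
    e : ∀ t l → 4 * t * (4 * t * (4 * t * (4 * t)) * l) ≡ 256 * (t * t * t * t) * l
    e = solve-∀

  -- `local` summed over all M⁴ quadruples of blocks. When `M` is near t d and `lows` near d⁴, the
  -- first term on the right takes 256 of the 257 parts, so S★⁴ has to supply almost a whole M⁴.
  counting : 257 * (M * M * M * M) ≤ 256 * (t * t * t * t) * lows + 4 * pad * (μ * μ * μ) + S★ * S★ * S★ * S★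
  counting = begin
    257 * (M * M * M * M) ≡⟨ e₁ M ⟩
    M * (M * (M * (M * 257))) ≤⟨ local-sum ⟩
    lowE 4 0 + S★ * (S★ * (S★ * S★)) ≤⟨ +-monoˡ-≤ _ (lowE≤real 4 0) ⟩
    realE 4 0 + error 4 + S★ * (S★ * (S★ * S★)) ≡⟨ cong₂ _+_ (cong₂ _+_ realE₄ (e₂ μ pad)) (e₃ S★) ⟩
    256 * (t * t * t * t) * lows + 4 * pad * (μ * μ * μ) + S★ * S★ * S★ * S★ ∎
    where
    open ≤-Reasoning
    e₁ : ∀ M → 257 * (M * M * M * M) ≡ M * (M * (M * (M * 257)))
    e₁ = solve-∀
    e₂ : ∀ m p → m * (m * (m * (m * 0 + p * 1) + p * (m * 1)) + p * (m * (m * 1))) + p * (m * (m * (m * 1))) ≡ 4 * p * (m * m * m)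
    e₂ = solve-∀
    e₃ : ∀ S → S * (S * (S * S)) ≡ S * S * S * S
    e₃ = solve-∀

-- Fourth powers, and stability of families of nearly extremal size

cube : ℕ → ℕ
cube x = x * x * x

fourth : ℕ → ℕ
fourth x = x * x * x * x

cube-mono : ∀ {x y} → x ≤ y → cube x ≤ cube y
cube-mono h = *-mono-≤ (*-mono-≤ h h) h

fourth-mono : ∀ {x y} → x ≤ y → fourth x ≤ fourth y
fourth-mono h = *-mono-≤ (cube-mono h) h

cube>0 : ∀ {x} → 0 < x → 0 < cube x
cube>0 {suc x} _ = s≤s z≤n

fourth-gap : ∀ {x y e} → y + e ≤ x → fourth y + e * cube x ≤ fourth x
fourth-gap {x} {y} {e} h = begin
  fourth y + e * cube x ≡⟨ cong (_+ e * cube x) (f y) ⟩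
  y * cube y + e * cube x ≤⟨ +-monoˡ-≤ (e * cube x) (*-monoʳ-≤ y (cube-mono (≤-trans (m≤m+n y e) h))) ⟩
  y * cube x + e * cube x ≡⟨ *-distribʳ-+ (cube x) y e ⟨
  (y + e) * cube x ≤⟨ *-monoˡ-≤ (cube x) h ⟩
  x * cube x ≡⟨ f x ⟨
  fourth x ∎
  where
  open ≤-Reasoning
  f : ∀ x → x * x * x * x ≡ x * (x * x * x)
  f = solve-∀

fourth-lipschitz : ∀ {d b k n} → d ≤ b + k → b ≤ n → d ≤ n → fourth d ≤ fourth b + 4 * (k * cube n)
fourth-lipschitz {d} {b} {k} {n} h b≤n d≤n with ≤-total d b
... | inj₁ d≤b = ≤-trans (fourth-mono d≤b) (m≤m+n _ _)
... | inj₂ b≤d = begin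
  d * d * d * d ≡⟨ f d ⟩
  d * (d * d * d) ≤⟨ *-monoˡ-≤ _ h ⟩
  (b + k) * (d * d * d) ≡⟨ g b k d ⟩
  b * d * (d * d) + k * (d * d * d) ≤⟨ +-mono-≤ (*-monoˡ-≤ (d * d) (*-monoʳ-≤ b h)) (*-monoʳ-≤ k (cube-mono d≤n)) ⟩
  b * (b + k) * (d * d) + k * cube n ≡⟨ g₂ b k d (k * cube n) ⟩
  b * b * d * d + k * (b * d * d) + k * cube n ≤⟨ +-monoˡ-≤ (k * cube n) (+-mono-≤ (*-monoˡ-≤ d (*-monoʳ-≤ (b * b) h)) (*-monoʳ-≤ k (*-mono-≤ (*-mono-≤ b≤n d≤n) d≤n))) ⟩
  b * b * (b + k) * d + k * cube n + k * cube n ≡⟨ g₃ b k d (k * cube n) ⟩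
  b * b * b * d + k * (b * b * d) + (k * cube n + k * cube n) ≤⟨ +-monoˡ-≤ (k * cube n + k * cube n) (+-mono-≤ (*-monoʳ-≤ (b * b * b) h) (*-monoʳ-≤ k (*-mono-≤ (*-mono-≤ b≤n b≤n) d≤n))) ⟩
  b * b * b * (b + k) + k * cube n + (k * cube n + k * cube n) ≡⟨ g₄ b k (k * cube n) ⟩
  fourth b + k * (b * b * b) + 3 * (k * cube n) ≤⟨ +-monoˡ-≤ (3 * (k * cube n)) (+-monoʳ-≤ (fourth b) (*-monoʳ-≤ k (cube-mono b≤n))) ⟩
  fourth b + k * cube n + 3 * (k * cube n) ≡⟨ +-assoc (fourth b) (k * cube n) _ ⟩
  fourth b + 4 * (k * cube n) ∎
  where
  open ≤-Reasoning
  f : ∀ x → x * x * x * x ≡ x * (x * x * x)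
  f = solve-∀
  g : ∀ b k d → (b + k) * (d * d * d) ≡ b * d * (d * d) + k * (d * d * d)
  g = solve-∀
  g₂ : ∀ b k d c → b * (b + k) * (d * d) + c ≡ b * b * d * d + k * (b * d * d) + c
  g₂ = solve-∀
  g₃ : ∀ b k d c → b * b * (b + k) * d + c + c ≡ b * b * b * d + k * (b * b * d) + (c + c)
  g₃ = solve-∀
  g₄ : ∀ b k c → b * b * b * (b + k) + c + (c + c) ≡ b * b * b * b + k * (b * b * b) + 3 * c
  g₄ = solve-∀

Στ-const : ∀ n c → Στ {n} (λ _ → c) ≡ fourth n * c
Στ-const n c = trans (sum-cong-≗ {n} (λ _ → trans (sum-cong-≗ {n} (λ _ → trans (sum-cong-≗ {n} (λ _ → ∑-const n c)) (∑-const n (n * c)))) (∑-const n (n * (n * c))))) (trans (∑-const n (n * (n * (n * c)))) (e n c))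
  where
  e : ∀ n c → n * (n * (n * (n * c))) ≡ n * n * n * n * c
  e = solve-∀

Στ-product : ∀ (f g h k : Fin n → ℕ) → Στ (λ { (a , b , c , d) → f a * (g b * (h c * k d)) }) ≡ ∑ f * (∑ g * (∑ h * ∑ k))
Στ-product f g h k =
  trans (sum-cong-≗ λ a → trans (sum-cong-≗ λ b → trans (sum-cong-≗ λ c → sym (pull₃ a b c)) (pull₂ a b)) (pull₁ a)) (sym (*-distribʳ-sum _ f))
  where
  pull₃ : ∀ a b c → f a * (g b * (h c * ∑ k)) ≡ ∑ (λ d → f a * (g b * (h c * k d)))
  pull₃ a b c = trans (cong (λ z → f a * (g b * z)) (*-distribˡ-sum (h c) k)) (trans (cong (f a *_) (*-distribˡ-sum (g b) (λ d → h c * k d))) (*-distribˡ-sum (f a) (λ d → g b * (h c * k d))))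
  pull₂ : ∀ a b → ∑ (λ c → f a * (g b * (h c * ∑ k))) ≡ f a * (g b * (∑ h * ∑ k))
  pull₂ a b = trans (sym (*-distribˡ-sum (f a) (λ c → g b * (h c * ∑ k)))) (cong (f a *_) (trans (sym (*-distribˡ-sum (g b) (λ c → h c * ∑ k))) (cong (g b *_) (sym (*-distribʳ-sum (∑ k) h)))))
  pull₁ : ∀ a → ∑ (λ b → f a * (g b * (∑ h * ∑ k))) ≡ f a * (∑ g * (∑ h * ∑ k))
  pull₁ a = trans (sym (*-distribˡ-sum (f a) (λ b → g b * (∑ h * ∑ k)))) (cong (f a *_) (sym (*-distribʳ-sum (∑ h * ∑ k) g)))

Στ-wt : ∀ (f : Fin n → ℕ) → Στ (wt f) ≡ 4 * (cube n * ∑ f)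
Στ-wt {n} f = begin
  Στ (wt f) ≡⟨ Στ-cong (λ { (a , b , c , d) → e (f a) (f b) (f c) (f d) }) ⟩
  Στ (λ τ → (p₁ τ + p₂ τ) + (p₃ τ + p₄ τ)) ≡⟨ trans (Στ-+ (λ τ → p₁ τ + p₂ τ) (λ τ → p₃ τ + p₄ τ)) (cong₂ _+_ (Στ-+ p₁ p₂) (Στ-+ p₃ p₄)) ⟩
  (Στ p₁ + Στ p₂) + (Στ p₃ + Στ p₄)
    ≡⟨ cong₂ _+_ (cong₂ _+_ (Στ-product f 1ᶠ 1ᶠ 1ᶠ) (Στ-product 1ᶠ f 1ᶠ 1ᶠ)) (cong₂ _+_ (Στ-product 1ᶠ 1ᶠ f 1ᶠ) (Στ-product 1ᶠ 1ᶠ 1ᶠ f)) ⟩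
  (∑ f * (∑ {n} 1ᶠ * (∑ {n} 1ᶠ * ∑ {n} 1ᶠ)) + ∑ {n} 1ᶠ * (∑ f * (∑ {n} 1ᶠ * ∑ {n} 1ᶠ))) + (∑ {n} 1ᶠ * (∑ {n} 1ᶠ * (∑ f * ∑ {n} 1ᶠ)) + ∑ {n} 1ᶠ * (∑ {n} 1ᶠ * (∑ {n} 1ᶠ * ∑ f)))
    ≡⟨ cong (λ z → (∑ f * (z * (z * z)) + z * (∑ f * (z * z))) + (z * (z * (∑ f * z)) + z * (z * (z * ∑ f)))) (trans (∑-const n 1) (*-identityʳ n)) ⟩
  (∑ f * (n * (n * n)) + n * (∑ f * (n * n))) + (n * (n * (∑ f * n)) + n * (n * (n * ∑ f))) ≡⟨ e₂ (∑ f) n ⟩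
  4 * (cube n * ∑ f) ∎
  where
  open ≡-Reasoning
  1ᶠ : Fin n → ℕ
  1ᶠ _ = 1
  p₁ p₂ p₃ p₄ : Tup n → ℕ
  p₁ (a , b , c , d) = f a * (1 * (1 * 1))
  p₂ (a , b , c , d) = 1 * (f b * (1 * 1))
  p₃ (a , b , c , d) = 1 * (1 * (f c * 1))
  p₄ (a , b , c , d) = 1 * (1 * (1 * f d))
  e : ∀ a b c d → a + (b + (c + d)) ≡ (a * (1 * (1 * 1)) + 1 * (b * (1 * 1))) + (1 * (1 * (c * 1)) + 1 * (1 * (1 * d)))
  e = solve-∀
  e₂ : ∀ f n → (f * (n * (n * n)) + n * (f * (n * n))) + (n * (n * (f * n)) + n * (n * (n * f))) ≡ 4 * (n * n * n * f)
  e₂ = solve-∀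

-- `many` says, up to terms of order n³, that `F` is at least as large as the extremal family. In
-- the bound for `k`, 256 * 6 stems from that cubic term and 20 * 500 from the padding: `pad` is 20
-- κ t and `μ` at most 5 n t, and 4 * 20 * 125 = 20 * 500.
module Stability {n} {F : Rel n} (D : Duality F) (s d κ : ℕ) (n≡ : n ≡ s + d) (4s≤d : 4 * s ≤ d) (1≤κ : 1 ≤ κ) (20κ≤n : 20 * κ ≤ n)
  (Y≤ : length (Duality.B D) ≤ Duality.t D * (s + κ)) (many : fourth n ≤ ∣ F ∣ᵣ + fourth d + 6 * cube n)
  (k : ℕ) (k≥ : 256 * 6 + 20 * 500 ≤ k) where
  open Slackness D
  open Local t 0<t

  private
    total = n * t + 5 * (κ * t)

    5Y≤ : 5 * Y ≤ total
    5Y≤ = begin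
      5 * Y ≤⟨ *-monoʳ-≤ 5 Y≤ ⟩
      5 * (t * (s + κ)) ≡⟨ e t s κ ⟩
      (s + 4 * s) * t + 5 * (κ * t) ≤⟨ +-monoˡ-≤ (5 * (κ * t)) (*-monoˡ-≤ t (≤-trans (+-monoʳ-≤ s 4s≤d) (≤-reflexive (sym n≡)))) ⟩
      n * t + 5 * (κ * t) ∎
      where
      open ≤-Reasoning
      e : ∀ t s κ → 5 * (t * (s + κ)) ≡ (s + 4 * s) * t + 5 * (κ * t)
      e = solve-∀

    T = total ∸ 5 * Y

  open Counting D κ T (m∸n+n≡m 5Y≤)

  Sᵣ : ℕ
  Sᵣ = sumL (star ∘ edge-block) B

  n≤2d : n ≤ 2 * d
  n≤2d = begin
    n ≡⟨ n≡ ⟩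
    s + d ≤⟨ +-monoˡ-≤ d (≤-trans (m≤n*m s 4) 4s≤d) ⟩
    d + d ≡⟨ cong (d +_) (+-identityʳ d) ⟨
    2 * d ∎
    where open ≤-Reasoning

  0<n : 0 < n
  0<n = ≤-trans (≤-trans 1≤κ (m≤n*m κ 20)) 20κ≤n

  private
    M+Y : M + Y ≡ total
    M+Y = trans (e Y T) (m∸n+n≡m 5Y≤)
      where
      e : ∀ Y T → 4 * Y + T + Y ≡ T + 5 * Y
      e = solve-∀

    td≤M : t * d ≤ M
    td≤M = ≤-via {Y} {t * (s + κ)} Y≤ (begin
      t * d + t * (s + κ) ≤⟨ m≤m+n _ (4 * (κ * t)) ⟩
      t * d + t * (s + κ) + 4 * (κ * t) ≡⟨ e t d s κ ⟩
      (s + d) * t + 5 * (κ * t) ≡⟨ cong (λ z → z * t + 5 * (κ * t)) n≡ ⟨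
      total ≡⟨ M+Y ⟨
      M + Y ∎)
      where
      open ≤-Reasoning
      e : ∀ t d s κ → t * d + t * (s + κ) + 4 * (κ * t) ≡ (s + d) * t + 5 * (κ * t)
      e = solve-∀

    nt≤2M : n * t ≤ 2 * M
    nt≤2M = begin
      n * t ≤⟨ *-monoˡ-≤ t n≤2d ⟩
      2 * d * t ≡⟨ e d t ⟩
      2 * (t * d) ≤⟨ *-monoʳ-≤ 2 td≤M ⟩
      2 * M ∎
      where
      open ≤-Reasoning
      e : ∀ d t → 2 * d * t ≡ 2 * (t * d)
      e = solve-∀

    μ≤ : μ ≤ 5 * (n * t)
    μ≤ = begin
      4 * t * n + 20 * (κ * t) ≡⟨ cong (4 * t * n +_) (sym (*-assoc 20 κ t)) ⟩
      4 * t * n + 20 * κ * t ≤⟨ +-monoʳ-≤ (4 * t * n) (*-monoˡ-≤ t 20κ≤n) ⟩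
      4 * t * n + n * t ≡⟨ e t n ⟩
      5 * (n * t) ∎
      where
      open ≤-Reasoning
      e : ∀ t n → 4 * t * n + n * t ≡ 5 * (n * t)
      e = solve-∀

    lows≤ : lows ≤ fourth d + 6 * cube n
    lows≤ = +-cancelˡ-≤ ∣ F ∣ᵣ _ _ (begin
      ∣ F ∣ᵣ + lows ≡⟨ Στ-+ (⟦_⟧ ∘ F) _ ⟨
      Στ (λ τ → ⟦ F τ ⟧ + lowτ τ) ≤⟨ Στ-mono one ⟩
      Στ {n} (λ τ → 1) ≡⟨ trans (Στ-const n 1) (*-identityʳ (fourth n)) ⟩
      fourth n ≤⟨ many ⟩
      ∣ F ∣ᵣ + fourth d + 6 * cube n ≡⟨ +-assoc ∣ F ∣ᵣ _ _ ⟩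
      ∣ F ∣ᵣ + (fourth d + 6 * cube n) ∎)
      where
      open ≤-Reasoning
      lowτ : Tup n → ℕ
      lowτ (a , b , c , d) = low (w a + w b + w c + w d)
      e : ∀ a b c d → a + (b + (c + d)) ≡ a + b + c + d
      e = solve-∀
      one : ∀ τ → ⟦ F τ ⟧ + lowτ τ ≤ 1
      one τ@(a , b , c , d) with F τ in Fτ
      ... | true rewrite low-no (≤-trans (cover τ Fτ) (≤-reflexive (e (w a) (w b) (w c) (w d)))) = ≤-refl
      ... | false = low≤1 _

    stars-bound : fourth M ≤ k * (κ * t * cube (n * t)) + fourth S★
    stars-bound = +-cancelˡ-≤ (256 * fourth M) _ _ (begin
      256 * fourth M + fourth M ≡⟨ +-comm (256 * fourth M) (fourth M) ⟩
      257 * fourth M ≤⟨ counting ⟩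
      256 * fourth t * lows + 4 * pad * cube μ + fourth S★
        ≤⟨ +-monoˡ-≤ (fourth S★) (+-mono-≤ (*-monoʳ-≤ (256 * fourth t) lows≤) (*-monoʳ-≤ (4 * pad) (cube-mono μ≤))) ⟩
      256 * fourth t * (fourth d + 6 * cube n) + 4 * pad * cube (5 * (n * t)) + fourth S★
        ≡⟨ cong (_+ fourth S★) (cong₂ _+_ (e₁ 256 t d n) (e₂ 20 t n κ)) ⟩
      256 * fourth (t * d) + 256 * 6 * (t * cube (n * t)) + 20 * 500 * W + fourth S★
        ≤⟨ +-monoˡ-≤ (fourth S★) (+-monoˡ-≤ (20 * 500 * W) (+-mono-≤ (*-monoʳ-≤ 256 (fourth-mono td≤M)) (*-monoʳ-≤ (256 * 6) (*-monoˡ-≤ (cube (n * t)) (m≤n*m t κ {{>-nonZero 1≤κ}}))))) ⟩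
      256 * fourth M + 256 * 6 * W + 20 * 500 * W + fourth S★
        ≡⟨ e₃ (256 * 6) (20 * 500) (256 * fourth M) W (fourth S★) ⟩
      256 * fourth M + ((256 * 6 + 20 * 500) * W + fourth S★)
        ≤⟨ +-monoʳ-≤ (256 * fourth M) (+-monoˡ-≤ (fourth S★) (*-monoˡ-≤ W k≥)) ⟩
      256 * fourth M + (k * W + fourth S★) ∎)
      where
      open ≤-Reasoning
      W = κ * t * cube (n * t)
      e₁ : ∀ p t d n → p * (t * t * t * t) * (d * d * d * d + 6 * (n * n * n))
        ≡ p * (t * d * (t * d) * (t * d) * (t * d)) + p * 6 * (t * (n * t * (n * t) * (n * t)))
      e₁ = solve-∀
      e₂ : ∀ r t n κ → 4 * (r * (κ * t)) * (5 * (n * t) * (5 * (n * t)) * (5 * (n * t))) ≡ r * 500 * (κ * t * (n * t * (n * t) * (n * t)))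
      e₂ = solve-∀
      e₃ : ∀ a b m x s → m + a * x + b * x + s ≡ m + ((a + b) * x + s)
      e₃ = solve-∀

    Sᵣ≤Y : Sᵣ ≤ Y
    Sᵣ≤Y = ≤-trans (sumL-mono B (λ τ → ⟦⟧≤1 _)) (≤-reflexive (sumL-1 B))

  -- In `counting`, `lows` is at most d⁴ + 6 n³ and t d at most `M`, so 256 M⁴ cancels and M⁴ ≤ S★⁴
  -- + k κ t (n t)³ remains. As n t ≤ 2 M, `fourth-gap` turns this into M - S★ ≤ 8 k κ t, and M - S★
  -- is 4 (Y - Sᵣ).
  Y≤stars : Y ≤ Sᵣ + 2 * k * (κ * t)
  Y≤stars = *-cancelˡ-≤ 4 (begin
      4 * Y ≡⟨ cong (4 *_) (m+[n∸m]≡n Sᵣ≤Y) ⟨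
      4 * (Sᵣ + g) ≡⟨ *-distribˡ-+ 4 Sᵣ g ⟩
      4 * Sᵣ + 4 * g ≤⟨ +-monoʳ-≤ (4 * Sᵣ) 4g≤ ⟩
      4 * Sᵣ + 8 * k * (κ * t) ≡⟨ e Sᵣ k (κ * t) ⟩
      4 * (Sᵣ + 2 * k * (κ * t)) ∎)
    where
    open ≤-Reasoning
    g = Y ∸ Sᵣ
    e : ∀ s k x → 4 * s + 8 * k * x ≡ 4 * (s + 2 * k * x)
    e = solve-∀
    gap : S★ + 4 * g ≤ M
    gap = ≤-reflexive (trans (f Sᵣ T g) (cong (λ z → 4 * z + T) (m+[n∸m]≡n Sᵣ≤Y)))
      where
      f : ∀ s T g → 4 * s + T + 4 * g ≡ 4 * (s + g) + T
      f = solve-∀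
    4g≤ : 4 * g ≤ 8 * k * (κ * t)
    4g≤ = *-cancelʳ-≤ _ _ (cube (n * t)) {{>-nonZero (cube>0 (*-mono-≤ 0<n 0<t))}} (begin
      4 * g * cube (n * t) ≤⟨ *-monoʳ-≤ (4 * g) (cube-mono nt≤2M) ⟩
      4 * g * cube (2 * M) ≡⟨ f₁ (4 * g) M ⟩
      8 * (4 * g * cube M) ≤⟨ *-monoʳ-≤ 8 {4 * g * cube M} {k * (κ * t * cube (n * t))} (+-cancelˡ-≤ (fourth S★) _ _ (≤-trans (fourth-gap {M} {S★} {4 * g} gap) (≤-trans stars-bound (≤-reflexive (+-comm _ (fourth S★)))))) ⟩
      8 * (k * (κ * t * cube (n * t))) ≡⟨ f₂ k (κ * t) (cube (n * t)) ⟩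
      8 * k * (κ * t) * cube (n * t) ∎)
      where
      f₁ : ∀ g M → g * (2 * M * (2 * M) * (2 * M)) ≡ 8 * (g * (M * M * M))
      f₁ = solve-∀
      f₂ : ∀ c k n → 8 * (c * (k * n)) ≡ 8 * c * k * n
      f₂ = solve-∀

  heavy : Fin n → Bool
  heavy v = t ≤ᵇ w v

  α : ℕ
  α = ∑ (λ v → ⟦ heavy v ⟧)

  β : ℕ
  β = ∑ (λ v → ⟦ not (heavy v) ⟧)

  outside : Fin n → ℕ
  outside v = ⟦ not (heavy v) ⟧ * w v

  α+β≡n : α + β ≡ n
  α+β≡n = trans (sym (∑-distrib-+ (λ v → ⟦ heavy v ⟧) (λ v → ⟦ not (heavy v) ⟧))) (trans (sum-cong-≗ (λ v → e (heavy v))) (trans (∑-const n 1) (*-identityʳ n)))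
    where
    e : ∀ b → ⟦ b ⟧ + ⟦ not b ⟧ ≡ 1
    e true = refl
    e false = refl

  heavy+outside : t * α + ∑ outside ≤ Y
  heavy+outside = begin
      t * α + ∑ outside ≡⟨ cong (_+ ∑ outside) (*-distribˡ-sum t (λ v → ⟦ heavy v ⟧)) ⟩
      ∑ (λ v → t * ⟦ heavy v ⟧) + ∑ outside ≡⟨ ∑-distrib-+ (λ v → t * ⟦ heavy v ⟧) outside ⟨
      ∑ (λ v → t * ⟦ heavy v ⟧ + outside v) ≤⟨ ∑-mono each ⟩
      ∑ w ≡⟨ ∑w≡Y ⟩
      Y ∎
    where
    open ≤-Reasoning
    each : ∀ v → t * ⟦ heavy v ⟧ + outside v ≤ w v
    each v with t ≤ᵇ w v | ≤ᵇ-reflects-≤ t (w v)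
    ... | true | ofʸ p = ≤-trans (≤-reflexive (trans (+-identityʳ _) (*-identityʳ t))) p
    ... | false | _ = ≤-reflexive (trans (cong (_+ (w v + 0)) (*-zeroʳ t)) (+-identityʳ (w v)))

  -- Each star in `B` contains a heavy vertex, and no vertex lies on more than `t` members of `B`.
  Sᵣ≤tα : Sᵣ ≤ t * α
  Sᵣ≤tα = begin
      Sᵣ ≤⟨ sumL-mono B each ⟩
      sumL (wt (⟦_⟧ ∘ heavy)) B ≡⟨ sumL-wt (⟦_⟧ ∘ heavy) B ⟩
      ∑ (λ v → load B v * ⟦ heavy v ⟧) ≤⟨ ∑-mono (λ v → *-monoˡ-≤ ⟦ heavy v ⟧ (loads v)) ⟩
      ∑ (λ v → t * ⟦ heavy v ⟧) ≡⟨ *-distribˡ-sum t (λ v → ⟦ heavy v ⟧) ⟨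
      t * α ∎
    where
    open ≤-Reasoning
    is-heavy : ∀ {v} → t ≤ w v → 1 ≤ ⟦ heavy v ⟧
    is-heavy {v} p with t ≤ᵇ w v | ≤ᵇ-reflects-≤ t (w v)
    ... | true | _ = ≤-refl
    ... | false | ofⁿ q = ⊥-elim (q p)
    each : ∀ τ → star (edge-block τ) ≤ wt (⟦_⟧ ∘ heavy) τ
    each τ@(a , b , c , d) = bound (Finₚ.any? (λ i → t ≤? edge-block τ i))
      where
      bound : (e : Dec (∃ λ i → t ≤ edge-block τ i)) → ⟦ does e ⟧ ≤ wt (⟦_⟧ ∘ heavy) τ
      bound (no _) = z≤n
      bound (yes (0F , p)) = ≤-trans (is-heavy p) (m≤m+n _ _)
      bound (yes (1F , p)) = ≤-trans (is-heavy p) (≤-trans (m≤m+n _ _) (m≤n+m _ ⟦ heavy a ⟧))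
      bound (yes (2F , p)) = ≤-trans (is-heavy p) (≤-trans (m≤m+n _ _) (≤-trans (m≤n+m _ ⟦ heavy b ⟧) (m≤n+m _ ⟦ heavy a ⟧)))
      bound (yes (3F , p)) = ≤-trans (is-heavy p) (≤-trans (m≤n+m _ ⟦ heavy c ⟧) (≤-trans (m≤n+m _ ⟦ heavy b ⟧) (m≤n+m _ ⟦ heavy a ⟧)))

  outside≤ : ∑ outside ≤ 2 * k * (κ * t)
  outside≤ = +-cancelˡ-≤ (t * α) _ _ (≤-trans heavy+outside (≤-trans Y≤stars (+-monoˡ-≤ (2 * k * (κ * t)) Sᵣ≤tα)))

  α≤ : α ≤ s + κ
  α≤ = *-cancelˡ-≤ t {{>-nonZero 0<t}} (≤-trans (m≤m+n _ _) (≤-trans heavy+outside Y≤))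

module Spread {n} {F : Rel n} (D : Duality F) (s d κ : ℕ) (n≡ : n ≡ s + d) (4s≤d : 4 * s ≤ d) (1≤κ : 1 ≤ κ) (20κ≤n : 20 * κ ≤ n)
  (Y≤ : length (Duality.B D) ≤ Duality.t D * (s + κ)) (many : fourth n ≤ ∣ F ∣ᵣ + fourth d + 6 * cube n)
  (k : ℕ) (k≥ : 256 * 6 + 20 * 500 ≤ k) where
  open Slackness D
  open Stability D s d κ n≡ 4s≤d 1≤κ 20κ≤n Y≤ many k k≥

  -- Limits a set `H` of heavy vertices that has no edges into X³: those η x³ tuples are missing in
  -- addition to almost all of the β⁴ tuples without a heavy vertex, while `many` leaves room for
  -- only about d⁴ missing ones.
  module Missing (c₁ : ℕ) (outside≤ : ∑ outside ≤ c₁ * (κ * t)) (X : Fin n → Bool) (H : Fin n → Bool) (H⊆heavy : ∀ v → H v ≡ true → heavy v ≡ true)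
    (missing : ∀ a b c e → H a ≡ true → X b ≡ true → X c ≡ true → X e ≡ true → F (a , b , c , e) ≡ false) where

    x η : ℕ
    x = ∑ (⟦_⟧ ∘ X)
    η = ∑ (⟦_⟧ ∘ H)

    private
      p q : Tup n → ℕ
      p (a , b , c , e) = ⟦ H a ⟧ * (⟦ X b ⟧ * (⟦ X c ⟧ * ⟦ X e ⟧))
      q (a , b , c , e) = ⟦ not (heavy a) ⟧ * (⟦ not (heavy b) ⟧ * (⟦ not (heavy c) ⟧ * ⟦ not (heavy e) ⟧))

      exclusive : ∀ a b c e → ⟦ F (a , b , c , e) ⟧ + p (a , b , c , e) ≤ 1
      exclusive a b c e with H a in ha | X b in hb | X c in hc | X e in he
      ... | false | _ | _ | _ = ≤-trans (≤-reflexive (+-identityʳ _)) (⟦⟧≤1 _)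
      ... | true | false | _ | _ = ≤-trans (≤-reflexive (+-identityʳ _)) (⟦⟧≤1 _)
      ... | true | true | false | _ = ≤-trans (≤-reflexive (+-identityʳ _)) (⟦⟧≤1 _)
      ... | true | true | true | false = ≤-trans (≤-reflexive (+-identityʳ _)) (⟦⟧≤1 _)
      ... | true | true | true | true rewrite missing a b c e ha hb hc he = ≤-refl

      p≤1-heavy : ∀ a b c e → heavy a ≡ false → p (a , b , c , e) ≡ 0
      p≤1-heavy a b c e h with H a in ha
      ... | false = refl
      ... | true with trans (sym (H⊆heavy a ha)) h
      ... | ()

      ordinary : ∀ τ {k m} → k ≡ 0 → t * (⟦ F τ ⟧ + p τ) + t * k ≤ t + m
      ordinary (a , b , c , e) refl = ≤-trans (≤-reflexive (trans (cong (t * (⟦ F (a , b , c , e) ⟧ + p (a , b , c , e)) +_) (*-zeroʳ t)) (+-identityʳ _)))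
        (≤-trans (*-monoʳ-≤ t (exclusive a b c e)) (≤-trans (≤-reflexive (*-identityʳ t)) (m≤m+n t _)))

      pointwise : ∀ τ → t * (⟦ F τ ⟧ + p τ) + t * q τ ≤ t + wt outside τ
      pointwise τ@(a , b , c , e) with heavy a in ha | heavy b in hb | heavy c in hc | heavy e in he
      ... | false | false | false | false rewrite p≤1-heavy a b c e ha = ≤-trans (≤-reflexive (f t ⟦ F τ ⟧)) (+-monoʳ-≤ t covered)
        where
        f : ∀ t x → t * (x + 0) + t * 1 ≡ t + t * x
        f = solve-∀
        covered : t * ⟦ F τ ⟧ ≤ w a + 0 + (w b + 0 + (w c + 0 + (w e + 0)))
        covered with F τ in Fτ
        ... | false = ≤-trans (≤-reflexive (*-zeroʳ t)) z≤n
        ... | true = ≤-trans (≤-reflexive (*-identityʳ t)) (≤-trans (cover τ Fτ) (≤-reflexive (g (w a) (w b) (w c) (w e))))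
          where
          g : ∀ a b c e → a + (b + (c + e)) ≡ a + 0 + (b + 0 + (c + 0 + (e + 0)))
          g = solve-∀
      ... | true | _ | _ | _ = ordinary τ refl
      ... | false | true | _ | _ = ordinary τ refl
      ... | false | false | true | _ = ordinary τ refl
      ... | false | false | false | true = ordinary τ refl

    -- Every edge meets the heavy set, up to few exceptions paid for by the weight outside it.
    edges≤ : ∣ F ∣ᵣ + η * cube x + fourth β ≤ fourth n + 4 * c₁ * (κ * cube n)
    edges≤ = *-cancelˡ-≤ t {{>-nonZero 0<t}} (begin
        t * (∣ F ∣ᵣ + η * cube x + fourth β) ≡⟨ cong (t *_) (cong₂ (λ u v → ∣ F ∣ᵣ + u + v) (sym ∑p) (sym ∑q)) ⟩
        t * (∣ F ∣ᵣ + Στ p + Στ q) ≡⟨ cong (λ z → t * (z + Στ q)) (sym (Στ-+ (⟦_⟧ ∘ F) p)) ⟩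
        t * (Στ (λ τ → ⟦ F τ ⟧ + p τ) + Στ q) ≡⟨ *-distribˡ-+ t _ _ ⟩
        t * Στ (λ τ → ⟦ F τ ⟧ + p τ) + t * Στ q ≡⟨ cong₂ _+_ (Στ-*ˡ t (λ τ → ⟦ F τ ⟧ + p τ)) (Στ-*ˡ t q) ⟩
        Στ (λ τ → t * (⟦ F τ ⟧ + p τ)) + Στ (λ τ → t * q τ) ≡⟨ Στ-+ (λ τ → t * (⟦ F τ ⟧ + p τ)) (λ τ → t * q τ) ⟨
        Στ (λ τ → t * (⟦ F τ ⟧ + p τ) + t * q τ) ≤⟨ Στ-mono pointwise ⟩
        Στ (λ τ → t + wt outside τ) ≡⟨ trans (Στ-+ (λ _ → t) (wt outside)) (cong₂ _+_ (Στ-const n t) (Στ-wt outside)) ⟩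
        fourth n * t + 4 * (cube n * ∑ outside) ≤⟨ +-monoʳ-≤ (fourth n * t) (*-monoʳ-≤ 4 (*-monoʳ-≤ (cube n) outside≤)) ⟩
        fourth n * t + 4 * (cube n * (c₁ * (κ * t))) ≡⟨ f (fourth n) t (cube n) c₁ κ ⟩
        t * (fourth n + 4 * c₁ * (κ * cube n)) ∎)
      where
      open ≤-Reasoning
      f : ∀ n⁴ t n³ c k → n⁴ * t + 4 * (n³ * (c * (k * t))) ≡ t * (n⁴ + 4 * c * (k * n³))
      f = solve-∀
      Στ-*ˡ : ∀ c (f : Tup n → ℕ) → c * Στ f ≡ Στ (λ τ → c * f τ)
      Στ-*ˡ k f = trans (*-distribˡ-sum k (λ a → ∑ λ b → ∑ λ c → ∑ λ e → f (a , b , c , e))) (sum-cong-≗ λ a →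
        trans (*-distribˡ-sum k (λ b → ∑ λ c → ∑ λ e → f (a , b , c , e))) (sum-cong-≗ λ b →
        trans (*-distribˡ-sum k (λ c → ∑ λ e → f (a , b , c , e))) (sum-cong-≗ λ c → *-distribˡ-sum k (λ e → f (a , b , c , e)))))
      g : ∀ h x → h * (x * (x * x)) ≡ h * (x * x * x)
      g = solve-∀
      g′ : ∀ x → x * (x * (x * x)) ≡ x * x * x * x
      g′ = solve-∀
      ∑p : Στ p ≡ η * cube x
      ∑p = trans (Στ-product (⟦_⟧ ∘ H) (⟦_⟧ ∘ X) (⟦_⟧ ∘ X) (⟦_⟧ ∘ X)) (g η x)
      ∑q : Στ q ≡ fourth β
      ∑q = trans (Στ-product l l l l) (g′ β)
        where
        l : Fin n → ℕ
        l v = ⟦ not (heavy v) ⟧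

    missing≤ : η * cube x + fourth β ≤ fourth d + (4 * c₁ + 6) * (κ * cube n)
    missing≤ = +-cancelˡ-≤ ∣ F ∣ᵣ _ _ (begin
      ∣ F ∣ᵣ + (η * cube x + fourth β) ≡⟨ +-assoc ∣ F ∣ᵣ _ _ ⟨
      ∣ F ∣ᵣ + η * cube x + fourth β ≤⟨ edges≤ ⟩
      fourth n + 4 * c₁ * (κ * cube n) ≤⟨ +-monoˡ-≤ _ many ⟩
      ∣ F ∣ᵣ + fourth d + 6 * cube n + 4 * c₁ * (κ * cube n) ≤⟨ +-monoˡ-≤ _ (+-monoʳ-≤ (∣ F ∣ᵣ + fourth d) (*-monoʳ-≤ 6 (m≤n*m (cube n) κ {{>-nonZero 1≤κ}}))) ⟩
      ∣ F ∣ᵣ + fourth d + 6 * (κ * cube n) + 4 * c₁ * (κ * cube n) ≡⟨ f ∣ F ∣ᵣ (fourth d) (κ * cube n) (4 * c₁) ⟩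
      ∣ F ∣ᵣ + (fourth d + (4 * c₁ + 6) * (κ * cube n)) ∎)
      where
      open ≤-Reasoning
      f : ∀ F d k c → F + d + 6 * k + c * k ≡ F + (d + (c + 6) * k)
      f = solve-∀

    -- By `α≤`, β is at least d - κ, so d⁴ and β⁴ cancel up to 4 κ n³.
    η-bound : η * cube x ≤ (4 * c₁ + 10) * (κ * cube n)
    η-bound = +-cancelʳ-≤ (fourth β) _ _ (begin
      η * cube x + fourth β ≤⟨ missing≤ ⟩
      fourth d + (4 * c₁ + 6) * (κ * cube n) ≤⟨ +-monoˡ-≤ _ (fourth-lipschitz d≤β+κ (≤-trans (m≤n+m β α) (≤-reflexive α+β≡n)) (≤-trans (m≤n+m d s) (≤-reflexive (sym n≡)))) ⟩
      fourth β + 4 * (κ * cube n) + (4 * c₁ + 6) * (κ * cube n) ≡⟨ f (fourth β) (κ * cube n) (4 * c₁) ⟩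
      (4 * c₁ + 10) * (κ * cube n) + fourth β ∎)
      where
      open ≤-Reasoning
      f : ∀ b k c → b + 4 * k + (c + 6) * k ≡ (c + 10) * k + b
      f = solve-∀
      d≤β+κ : d ≤ β + κ
      d≤β+κ = +-cancelˡ-≤ s _ _ (begin
        s + d ≡⟨ trans (sym n≡) (sym α+β≡n) ⟩
        α + β ≤⟨ +-monoˡ-≤ β α≤ ⟩
        s + κ + β ≡⟨ trans (+-assoc s κ β) (cong (s +_) (+-comm κ β)) ⟩
        s + (β + κ) ∎)

    c₂ : ℕ
    c₂ = 8 * (4 * c₁ + 6)

    -- `missing≤` bounds β⁴ by d⁴ + O(κ n³), and d is at least n / 2, so β exceeds d by O(κ) at
    -- most. Hence almost `s` vertices are heavy.
    β≤ : β ≤ d + c₂ * κ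
    β≤ = ≤-trans (m≤n+m∸n β d) (+-monoʳ-≤ d gap≤)
      where
      open ≤-Reasoning
      gap≤ : β ∸ d ≤ c₂ * κ
      gap≤ with ≤-total β d
      ... | inj₁ β≤d = ≤-trans (≤-reflexive (m≤n⇒m∸n≡0 β≤d)) z≤n
      ... | inj₂ d≤β = *-cancelʳ-≤ _ _ (cube n) {{>-nonZero (cube>0 0<n)}} (begin
          (β ∸ d) * cube n ≤⟨ *-monoʳ-≤ (β ∸ d) (cube-mono n≤2d) ⟩
          (β ∸ d) * cube (2 * d) ≡⟨ f₁ (β ∸ d) d ⟩
          8 * ((β ∸ d) * cube d) ≤⟨ *-monoʳ-≤ 8 (*-monoʳ-≤ (β ∸ d) (cube-mono d≤β)) ⟩
          8 * ((β ∸ d) * cube β) ≤⟨ *-monoʳ-≤ 8 {(β ∸ d) * cube β} {(4 * c₁ + 6) * (κ * cube n)} (+-cancelˡ-≤ (fourth d) _ _ (≤-trans (fourth-gap {β} {d} {β ∸ d} (≤-reflexive (m+[n∸m]≡n d≤β))) (≤-trans (m≤n+m (fourth β) (η * cube x)) missing≤))) ⟩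
          8 * ((4 * c₁ + 6) * (κ * cube n)) ≡⟨ f₂ (4 * c₁ + 6) κ (cube n) ⟩
          c₂ * κ * cube n ∎)
        where
        f₁ : ∀ e d → e * (2 * d * (2 * d) * (2 * d)) ≡ 8 * (e * (d * d * d))
        f₁ = solve-∀
        f₂ : ∀ c k n → 8 * (c * (k * n)) ≡ 8 * c * k * n
        f₂ = solve-∀

    s≤α : s ≤ α + c₂ * κ
    s≤α = +-cancelʳ-≤ d _ _ (begin
      s + d ≡⟨ trans (sym n≡) (sym α+β≡n) ⟩
      α + β ≤⟨ +-monoʳ-≤ α β≤ ⟩
      α + (d + c₂ * κ) ≡⟨ cong (α +_) (+-comm d (c₂ * κ)) ⟩
      α + (c₂ * κ + d) ≡⟨ +-assoc α _ d ⟨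
      α + c₂ * κ + d ∎)
      where open ≤-Reasoning

  -- Otherwise let `H` be the heavy vertices from `j` on. An edge with head in `H` and the rest in
  -- `X` could be lowered to the head `j`, so there is none. By `s≤α`, `H` has at least c₄ κ
  -- elements, but `η-bound` together with n ≤ 6 x allows fewer; the factor 216 is 6³.
  full : ∀ c₁ c₄ → ∑ outside ≤ c₁ * (κ * t) → 216 * (4 * c₁ + 10) < c₄ → FourSets F → Shifted F →
    ∀ (j : Fin n) → s ≡ toℕ j + (8 * (4 * c₁ + 6) + c₄) * κ → ∀ (X : Fin n → Bool) → (∀ v → X v ≡ true → j Fin.< v) → n ≤ 6 * ∑ (⟦_⟧ ∘ X) →
    ∃ λ b → ∃ λ c → ∃ λ e → X b ≡ true × X c ≡ true × X e ≡ true × F (j , b , c , e) ≡ true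
  full c₁ c₄ out≤ c₄> S sh j s≡ X above n≤6x with Finₚ.any? (λ b → Finₚ.any? λ c → Finₚ.any? λ e → (X b Boolₚ.≟ true) ×-dec ((X c Boolₚ.≟ true) ×-dec ((X e Boolₚ.≟ true) ×-dec (F (j , b , c , e) Boolₚ.≟ true))))
  ... | yes found = found
  ... | no none = ⊥-elim (<⇒≱ c₄> c₄≤)
    where
    open Shift S sh
    open ≤-Reasoning
    H : Fin n → Bool
    H v = heavy v ∧ (toℕ j ≤ᵇ toℕ v)
    H⊆heavy : ∀ v → H v ≡ true → heavy v ≡ true
    H⊆heavy v h with heavy v
    ... | true = refl
    H≥j : ∀ v → H v ≡ true → j Fin.≤ v
    H≥j v h with heavy v | toℕ j ≤ᵇ toℕ v | ≤ᵇ-reflects-≤ (toℕ j) (toℕ v)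
    ... | true | true | ofʸ p = p
    missing : ∀ a b c e → H a ≡ true → X b ≡ true → X c ≡ true → X e ≡ true → F (a , b , c , e) ≡ false
    missing a b c e ha hb hc he with F (a , b , c , e) in h
    ... | false = refl
    ... | true = ⊥-elim (none (b , c , e , hb , hc , he , step₁ j (H≥j a ha) (Finₚ.<⇒≢ (above b hb)) (Finₚ.<⇒≢ (above c hc)) (Finₚ.<⇒≢ (above e he)) h))
    open Missing c₁ out≤ X H H⊆heavy missing
    below : ∀ {n} m → ∑ {n} (λ v → ⟦ toℕ v <ᵇ m ⟧) ≤ m
    below {zero} m = z≤n
    below {suc n} zero = ≤-reflexive (trans (∑-const n 0) (*-zeroʳ n))
    below {suc n} (suc m) = s≤s (below {n} m)
    α≤η+j : α ≤ η + toℕ j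
    α≤η+j = begin
      α ≤⟨ ∑-mono each ⟩
      ∑ (λ v → ⟦ H v ⟧ + ⟦ toℕ v <ᵇ toℕ j ⟧) ≡⟨ ∑-distrib-+ (⟦_⟧ ∘ H) (λ v → ⟦ toℕ v <ᵇ toℕ j ⟧) ⟩
      η + ∑ {n} (λ v → ⟦ toℕ v <ᵇ toℕ j ⟧) ≤⟨ +-monoʳ-≤ η (below {n} (toℕ j)) ⟩
      η + toℕ j ∎
      where
      each : ∀ v → ⟦ heavy v ⟧ ≤ ⟦ H v ⟧ + ⟦ toℕ v <ᵇ toℕ j ⟧
      each v with heavy v | toℕ j ≤ᵇ toℕ v | ≤ᵇ-reflects-≤ (toℕ j) (toℕ v) | toℕ v <ᵇ toℕ j | <ᵇ-reflects-< (toℕ v) (toℕ j)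
      ... | false | _ | _ | _ | _ = z≤n
      ... | true | true | _ | _ | _ = s≤s z≤n
      ... | true | false | _ | true | _ = ≤-refl
      ... | true | false | ofⁿ p | false | ofⁿ q = ⊥-elim (p (≮⇒≥ q))
    c₄κ≤η : c₄ * κ ≤ η
    c₄κ≤η = +-cancelˡ-≤ (toℕ j + c₂ * κ) _ _ (begin
      toℕ j + c₂ * κ + c₄ * κ ≡⟨ f (toℕ j) c₂ c₄ κ ⟩
      toℕ j + (c₂ + c₄) * κ ≡⟨ s≡ ⟨
      s ≤⟨ s≤α ⟩
      α + c₂ * κ ≤⟨ +-monoˡ-≤ (c₂ * κ) α≤η+j ⟩
      η + toℕ j + c₂ * κ ≡⟨ trans (+-assoc η _ _) (+-comm η _) ⟩
      toℕ j + c₂ * κ + η ∎)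
      where
      f : ∀ j a b k → j + a * k + b * k ≡ j + (a + b) * k
      f = solve-∀
    c₄≤ : c₄ ≤ 216 * (4 * c₁ + 10)
    c₄≤ = *-cancelʳ-≤ _ _ (κ * cube n) {{>-nonZero (*-mono-≤ 1≤κ (cube>0 0<n))}} (begin
      c₄ * (κ * cube n) ≡⟨ *-assoc c₄ κ (cube n) ⟨
      c₄ * κ * cube n ≤⟨ *-mono-≤ c₄κ≤η (cube-mono n≤6x) ⟩
      η * cube (6 * x) ≡⟨ f₁ η x ⟩
      216 * (η * cube x) ≤⟨ *-monoʳ-≤ 216 {η * cube x} {(4 * c₁ + 10) * (κ * cube n)} η-bound ⟩
      216 * ((4 * c₁ + 10) * (κ * cube n)) ≡⟨ *-assoc 216 (4 * c₁ + 10) (κ * cube n) ⟨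
      216 * (4 * c₁ + 10) * (κ * cube n) ∎)
      where
      f₁ : ∀ h x → h * (6 * x * (6 * x) * (6 * x)) ≡ 216 * (h * (x * x * x))
      f₁ = solve-∀

-- The exact bound near the extremal family

∧-true : ∀ {a b} → a ∧ b ≡ true → a ≡ true × b ≡ true
∧-true {true} h = refl , h

true-∧ : ∀ {a b} → a ≡ true → b ≡ true → a ∧ b ≡ true
true-∧ refl refl = refl

⟦∧⟧ : ∀ a b → ⟦ a ∧ b ⟧ ≡ ⟦ a ⟧ * ⟦ b ⟧
⟦∧⟧ true b = sym (+-identityʳ _)
⟦∧⟧ false b = refl

Pred : ℕ → Set
Pred n = Fin n → Bool

#_ : Pred n → ℕ
# P = ∑ (⟦_⟧ ∘ P)

_∖_ : Pred n → Fin n → Pred n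
(P ∖ a) v = P v ∧ not (v == a)

-- Distinctness is expressed by successive removal, so that tuples can be counted one coordinate at
-- a time, each with one candidate fewer than the last.
ord₃ : Pred n → Fin n → Fin n → Fin n → Bool
ord₃ P b c d = P b ∧ ((P ∖ b) c ∧ ((P ∖ b) ∖ c) d)

ord : Pred n → Tup n → Bool
ord P (a , b , c , d) = P a ∧ ord₃ (P ∖ a) b c d

∖-true : ∀ {P : Pred n} {a v} → (P ∖ a) v ≡ true → P v ≡ true × v ≢ a
∖-true {P = P} {a} {v} h with ∧-true {P v} h
... | p , q = p , λ { refl → absurd (trans (sym q) (cong not (==-refl v))) }
  where
  absurd : true ≡ false → ⊥
  absurd ()

true-∖ : ∀ {P : Pred n} {a v} → P v ≡ true → v ≢ a → (P ∖ a) v ≡ true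
true-∖ p ne = true-∧ p (cong not (==-≢ ne))

ord₃⇒ : ∀ {P : Pred n} {b c d} → ord₃ P b c d ≡ true → (P b ≡ true × P c ≡ true × P d ≡ true) × (b ≢ c × b ≢ d × c ≢ d)
ord₃⇒ {P = P} {b} {c} {d} h with ∧-true {P b} h
... | pb , h₁ with ∧-true {(P ∖ b) c} h₁
... | hc , hd with ∖-true {P = P} {b} {c} hc | ∖-true {P = P ∖ b} {c} {d} hd
... | pc , cb | hd′ , dc with ∖-true {P = P} {b} {d} hd′
... | pd , db = (pb , pc , pd) , (cb ∘ sym) , (db ∘ sym) , (dc ∘ sym)

⇒ord₃ : ∀ {P : Pred n} {b c d} → P b ≡ true → P c ≡ true → P d ≡ true → b ≢ c → b ≢ d → c ≢ d → ord₃ P b c d ≡ true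
⇒ord₃ {P = P} {b} {c} {d} pb pc pd bc bd cd = true-∧ pb (true-∧ (true-∖ {P = P} pc (bc ∘ sym)) (true-∖ {P = P ∖ b} (true-∖ {P = P} pd (bd ∘ sym)) (cd ∘ sym)))

ord⇒ : ∀ {P : Pred n} {a b c d} → ord P (a , b , c , d) ≡ true → (P a ≡ true × P b ≡ true × P c ≡ true × P d ≡ true) × Distinct a b c d
ord⇒ {P = P} {a} {b} {c} {d} h with ∧-true {P a} h
... | pa , h₁ with ord₃⇒ {P = P ∖ a} {b} {c} {d} h₁
... | (hb , hc , hd) , bc , bd , cd with ∖-true {P = P} {a} {b} hb | ∖-true {P = P} {a} {c} hc | ∖-true {P = P} {a} {d} hd
... | pb , ba | pc , ca | pd , da = (pa , pb , pc , pd) , (ba ∘ sym) , (ca ∘ sym) , (da ∘ sym) , bc , bd , cd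

⇒ord : ∀ {P : Pred n} {a b c d} → P a ≡ true → P b ≡ true → P c ≡ true → P d ≡ true → Distinct a b c d → ord P (a , b , c , d) ≡ true
⇒ord {P = P} {a} pa pb pc pd (ab , ac , ad , bc , bd , cd) =
  true-∧ pa (⇒ord₃ {P = P ∖ a} (true-∖ {P = P} pb (ab ∘ sym)) (true-∖ {P = P} pc (ac ∘ sym)) (true-∖ {P = P} pd (ad ∘ sym)) bc bd cd)

#-∖ : ∀ (P : Pred n) a → P a ≡ true → # (P ∖ a) ≡ # P ∸ 1
#-∖ P a pa = sym (trans (cong (_∸ 1) (sym split)) (m+n∸n≡m (# (P ∖ a)) 1))
  where
  each : ∀ v → ⟦ (P ∖ a) v ⟧ + ⟦ v == a ⟧ * 1 ≡ ⟦ P v ⟧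
  each v with v Fin.≟ a
  ... | yes refl rewrite pa = refl
  ... | no _ with P v
  ... | true = refl
  ... | false = refl
  split : # (P ∖ a) + 1 ≡ # P
  split = trans (cong (# (P ∖ a) +_) (sym (∑-pick a (λ _ → 1)))) (trans (sym (∑-distrib-+ (⟦_⟧ ∘ (P ∖ a)) (λ v → ⟦ v == a ⟧ * 1))) (sum-cong-≗ each))

∑-filtered : ∀ (P : Pred n) (g : Fin n → ℕ) K → (∀ v → P v ≡ true → g v ≡ K) → ∑ (λ v → ⟦ P v ⟧ * g v) ≡ # P * K
∑-filtered P g K h = trans (sum-cong-≗ each) (sym (*-distribʳ-sum K (⟦_⟧ ∘ P)))
  where
  each : ∀ v → ⟦ P v ⟧ * g v ≡ ⟦ P v ⟧ * K
  each v with P v in pv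
  ... | true = cong (_+ 0) (h v pv)
  ... | false = refl

falling₃ falling₄ : ℕ → ℕ
falling₃ p = p * ((p ∸ 1) * (p ∸ 2))
falling₄ p = p * ((p ∸ 1) * ((p ∸ 2) * (p ∸ 3)))

∑-ord₃ : ∀ (P : Pred n) → ∑ (λ b → ∑ λ c → ∑ λ d → ⟦ ord₃ P b c d ⟧) ≡ falling₃ (# P)
∑-ord₃ {n} P = trans (sum-cong-≗ λ b → trans (sum-cong-≗ λ c → trans (sum-cong-≗ λ d → ⟦∧⟧ (P b) ((P ∖ b) c ∧ ((P ∖ b) ∖ c) d))
    (sym (*-distribˡ-sum ⟦ P b ⟧ (λ d → ⟦ (P ∖ b) c ∧ ((P ∖ b) ∖ c) d ⟧))))
    (sym (*-distribˡ-sum ⟦ P b ⟧ (λ c → ∑ λ d → ⟦ (P ∖ b) c ∧ ((P ∖ b) ∖ c) d ⟧))))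
  (∑-filtered P _ ((# P ∸ 1) * (# P ∸ 2)) λ b pb →
    trans (sum-cong-≗ λ c → trans (sum-cong-≗ λ d → ⟦∧⟧ ((P ∖ b) c) (((P ∖ b) ∖ c) d)) (sym (*-distribˡ-sum ⟦ (P ∖ b) c ⟧ (⟦_⟧ ∘ ((P ∖ b) ∖ c)))))
    (trans (∑-filtered (P ∖ b) _ (# P ∸ 2) λ c hc → trans (#-∖ (P ∖ b) c hc) (trans (cong (_∸ 1) (#-∖ P b pb)) (∸-+-assoc (# P) 1 1)))
      (cong (_* (# P ∸ 2)) (#-∖ P b pb))))

Στ-ord : ∀ (P : Pred n) → Στ (⟦_⟧ ∘ ord P) ≡ falling₄ (# P)
Στ-ord P = trans (sum-cong-≗ λ a → trans (sum-cong-≗ λ b → trans (sum-cong-≗ λ c → trans (sum-cong-≗ λ d → ⟦∧⟧ (P a) (ord₃ (P ∖ a) b c d))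
    (sym (*-distribˡ-sum ⟦ P a ⟧ (λ d → ⟦ ord₃ (P ∖ a) b c d ⟧))))
    (sym (*-distribˡ-sum ⟦ P a ⟧ (λ c → ∑ λ d → ⟦ ord₃ (P ∖ a) b c d ⟧))))
    (sym (*-distribˡ-sum ⟦ P a ⟧ (λ b → ∑ λ c → ∑ λ d → ⟦ ord₃ (P ∖ a) b c d ⟧))))
  (∑-filtered P _ ((# P ∸ 1) * ((# P ∸ 2) * (# P ∸ 3))) λ a pa →
    trans (∑-ord₃ (P ∖ a)) (trans (cong falling₃ (#-∖ P a pa)) (cong₂ (λ x y → (# P ∸ 1) * (x * y)) (∸-+-assoc (# P) 1 1) (∸-+-assoc (# P) 1 2))))

#-≤-list : ∀ (f : Pred n) xs → ∑ (λ v → ⟦ does (any? (v Fin.≟_) xs) ∧ f v ⟧) ≤ sumL (⟦_⟧ ∘ f) xs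
#-≤-list {n} f [] = ≤-reflexive (trans (∑-const n 0) (*-zeroʳ n))
#-≤-list {n} f (x ∷ xs) = begin
    ∑ (λ v → ⟦ does (any? (v Fin.≟_) (x ∷ xs)) ∧ f v ⟧) ≤⟨ ∑-mono each ⟩
    ∑ (λ v → ⟦ v == x ⟧ * ⟦ f v ⟧ + ⟦ does (any? (v Fin.≟_) xs) ∧ f v ⟧) ≡⟨ ∑-distrib-+ (λ v → ⟦ v == x ⟧ * ⟦ f v ⟧) _ ⟩
    ∑ (λ v → ⟦ v == x ⟧ * ⟦ f v ⟧) + ∑ (λ v → ⟦ does (any? (v Fin.≟_) xs) ∧ f v ⟧) ≤⟨ +-mono-≤ (≤-reflexive (∑-pick x (⟦_⟧ ∘ f))) (#-≤-list f xs) ⟩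
    ⟦ f x ⟧ + sumL (⟦_⟧ ∘ f) xs ∎
  where
  open ≤-Reasoning
  each : ∀ v → ⟦ does (any? (v Fin.≟_) (x ∷ xs)) ∧ f v ⟧ ≤ ⟦ v == x ⟧ * ⟦ f v ⟧ + ⟦ does (any? (v Fin.≟_) xs) ∧ f v ⟧
  each v with does (v Fin.≟ x) | does (any? (v Fin.≟_) xs) | f v
  ... | true | p | true = s≤s z≤n
  ... | true | true | false = z≤n
  ... | true | false | false = z≤n
  ... | false | p | q = ≤-refl

#-interval : ∀ {n} lo hi → lo ≤ hi → hi ≤ n → hi ∸ lo ≤ # (λ (v : Fin n) → (lo ≤ᵇ toℕ v) ∧ (toℕ v <ᵇ hi))
#-interval {zero} zero zero _ _ = z≤n
#-interval {suc n} zero zero _ _ = z≤n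
#-interval {suc n} zero (suc hi) _ (s≤s q) = s≤s (#-interval {n} zero hi z≤n q)
#-interval {suc n} (suc zero) (suc hi) (s≤s p) (s≤s q) = #-interval {n} zero hi p q
#-interval {suc n} (suc (suc lo)) (suc hi) (s≤s p) (s≤s q) = #-interval {n} (suc lo) hi p q

#-below : ∀ {n} m → m ≤ n → # (λ (v : Fin n) → toℕ v <ᵇ m) ≡ m
#-below {zero} zero _ = refl
#-below {suc n} zero _ = trans (∑-const n 0) (*-zeroʳ n)
#-below {suc n} (suc m) (s≤s p) = cong suc (#-below {n} m p)

true-≤ᵇ : ∀ {a b} → (a ≤ᵇ b) ≡ true → a ≤ b
true-≤ᵇ {a} {b} h with a ≤ᵇ b | ≤ᵇ-reflects-≤ a b
... | true | ofʸ q = q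

true-<ᵇ : ∀ {a b} → (a <ᵇ b) ≡ true → a < b
true-<ᵇ {a} {b} h with a <ᵇ b | <ᵇ-reflects-< a b
... | true | ofʸ q = q

-- As a ≤ s, at most 4 s + 1 ≤ 4 n / 5 + 1 vertices are not free; n ≥ 60 absorbs the constant.
free-sixth : ∀ {n x s a} → n ≤ x + suc s + 3 * a → a ≤ s → 5 * s ≤ n → 60 ≤ n → n ≤ 6 * x
free-sixth {n} {x} {s} {a} n≤ a≤s 5s≤n 60≤n = ≤-trans n≤5x+5 (≤-trans (+-monoʳ-≤ (5 * x) 5≤x) (≤-reflexive (+-comm (5 * x) x)))
  where
  n≤5x+5 : n ≤ 5 * x + 5
  n≤5x+5 = ≤-via (+-mono-≤ (*-monoʳ-≤ 5 n≤) (+-mono-≤ (*-monoʳ-≤ 15 a≤s) (*-monoʳ-≤ 4 5s≤n))) (≤-reflexive (e n x s a))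
    where
    e : ∀ n x s a → n + (5 * (x + (1 + s) + 3 * a) + (15 * s + 4 * n)) ≡ 5 * x + 5 + (5 * n + (15 * a + 4 * (5 * s)))
    e = solve-∀
  5≤x : 5 ≤ x
  5≤x = *-cancelˡ-≤ 5 (≤-trans (m≤m+n 25 30) (+-cancelʳ-≤ 5 55 (5 * x) (≤-trans 60≤n n≤5x+5)))

-- For such small a, at most n / 5 + n / 20 + 1 vertices are not free, well below half. The `+ 4`
-- amounts to n ≤ 2 (x - 2), the form in which `falling₃ x` is compared with n³.
free-half : ∀ {n x s a b} → n ≤ x + suc s + 3 * a → a ≤ b → 768 * b ≤ n → 5 * s ≤ n → 60 ≤ n → n + 4 ≤ 2 * x
free-half {n} {x} {s} {a} {b} n≤ a≤b small 5s≤n 60≤n = *-cancelˡ-≤ 10 (≤-via (+-mono-≤ (*-monoʳ-≤ 20 n≤) (+-mono-≤ (*-monoʳ-≤ 4 5s≤n) (+-mono-≤ 60a≤n 60≤n))) (≤-trans (m≤m+n _ (4 * n)) (≤-reflexive (e n x s a))))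
  where
  60a≤n : 60 * a ≤ n
  60a≤n = ≤-trans (*-mono-≤ (m≤m+n 60 708) a≤b) small
  e : ∀ n x s a → 10 * (n + 4) + (20 * (x + (1 + s) + 3 * a) + (4 * n + (n + n))) + 4 * n ≡ 10 * (2 * x) + (20 * n + (4 * (5 * s) + (60 * a + 60)))
  e = solve-∀

module Greedy {n} {F : Rel n} (S : FourSets F) (sh : Shifted F) (s : ℕ) (s<n : s < n) (ν : νRel F s) where
  open Shift S sh

  used : List (Tup n) → Pred n
  used M v = does (any? (v Fin.≟_) (flat M))

  big : Pred n
  big v = s <ᵇ toℕ v

  free : List (Tup n) → Pred n
  free M v = big v ∧ not (used M v)

  free-big : ∀ {M v} → free M v ≡ true → s < toℕ v
  free-big {M} {v} h = true-<ᵇ (proj₁ (∧-true {big v} h))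

  free-∉ : ∀ {M v} → free M v ≡ true → v ∉ flat M
  free-∉ {M} {v} h with any? (v Fin.≟_) (flat M) | proj₂ (∧-true {big v} h)
  ... | no p | _ = p

  -- `heads` says that no vertex up to s - a is used, so the next head is available. `few` counts
  -- the used vertices beyond `s`: at most three per edge, because the heads are at most `s`.
  record State (a : ℕ) (M : List (Tup n)) : Set where
    field
      len : length M ≡ a
      edges : All (λ τ → F τ ≡ true) M
      uniq : Unique (flat M)
      heads : ∀ {v} → v ∈ flat M → s < toℕ v + a
      few : sumL (⟦_⟧ ∘ big) (flat M) ≤ 3 * a
  open State

  Stuck : ℕ → List (Tup n) → Set
  Stuck a M = ∀ h → toℕ h + a ≡ s → ∀ b c d → free M b ≡ true → free M c ≡ true → free M d ≡ true → F (h , b , c , d) ≡ false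

  greedy : ∀ k a M → a + k ≡ suc s → State a M → ∃ λ a′ → ∃ λ M′ → a′ ≤ s × State a′ M′ × Stuck a′ M′
  greedy zero a M e st = ⊥-elim (<⇒≱ (n<1+n s) (≤-trans (≤-reflexive (trans (sym e) (trans (+-identityʳ a) (sym (len st))))) (ν M (edges st) (uniq st))))
  greedy (suc k) a M e st = search (Finₚ.any? λ b → Finₚ.any? λ c → Finₚ.any? λ d →
      (free M b Boolₚ.≟ true) ×-dec ((free M c Boolₚ.≟ true) ×-dec ((free M d Boolₚ.≟ true) ×-dec (F (h , b , c , d) Boolₚ.≟ true))))
    where
    a≤s : a ≤ s
    a≤s = ≤-trans (m≤m+n a k) (≤-reflexive (suc-injective (trans (sym (+-suc a k)) e)))
    h<n : s ∸ a < n
    h<n = ≤-<-trans (m∸n≤m s a) s<n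
    h : Fin n
    h = fromℕ< h<n
    h≡ : toℕ h + a ≡ s
    h≡ = trans (cong (_+ a) (Finₚ.toℕ-fromℕ< h<n)) (m∸n+n≡m a≤s)
    h≤s : toℕ h ≤ s
    h≤s = ≤-trans (m≤m+n (toℕ h) a) (≤-reflexive h≡)
    search : Dec (∃ λ b → ∃ λ c → ∃ λ d → free M b ≡ true × free M c ≡ true × free M d ≡ true × F (h , b , c , d) ≡ true) → _
    search (no none) = a , M , a≤s , st , stuck
      where
      stuck : Stuck a M
      stuck h′ h′≡ b c d fb fc fd with F (h′ , b , c , d) in eq
      ... | false = refl
      ... | true = ⊥-elim (none (b , c , d , fb , fc , fd , subst (λ z → F (z , b , c , d) ≡ true) (Finₚ.toℕ-injective (+-cancelʳ-≡ a _ _ (trans h′≡ (sym h≡)))) eq))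
    search (yes (b , c , d , fb , fc , fd , hF)) = greedy k (suc a) ((h , b , c , d) ∷ M) (trans (sym (+-suc a k)) e) record
      { len = cong suc (len st)
      ; edges = hF ∷ edges st
      ; uniq = (proj₁ di ∷ proj₁ (proj₂ di) ∷ proj₁ (proj₂ (proj₂ di)) ∷ Allₚ.¬Any⇒All¬ _ h∉)
             ∷ (proj₁ (proj₂ (proj₂ (proj₂ di))) ∷ proj₁ (proj₂ (proj₂ (proj₂ (proj₂ di)))) ∷ Allₚ.¬Any⇒All¬ _ (free-∉ {M} fb))
             ∷ (proj₂ (proj₂ (proj₂ (proj₂ (proj₂ di)))) ∷ Allₚ.¬Any⇒All¬ _ (free-∉ {M} fc))
             ∷ Allₚ.¬Any⇒All¬ _ (free-∉ {M} fd) ∷ uniq st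
      ; heads = λ { (here refl) → ≤-reflexive (trans (cong suc (sym h≡)) (sym (+-suc (toℕ h) a)))
                  ; (there (here refl)) → ≤-trans (free-big {M} fb) (m≤m+n _ _)
                  ; (there (there (here refl))) → ≤-trans (free-big {M} fc) (m≤m+n _ _)
                  ; (there (there (there (here refl)))) → ≤-trans (free-big {M} fd) (m≤m+n _ _)
                  ; (there (there (there (there p)))) → ≤-trans (heads st p) (+-monoʳ-≤ _ (n≤1+n a)) }
      ; few = ≤-trans (+-mono-≤ (≤-reflexive h-small) (+-mono-≤ (⟦⟧≤1 (big b)) (+-mono-≤ (⟦⟧≤1 (big c)) (+-mono-≤ (⟦⟧≤1 (big d)) (few st))))) (≤-reflexive (e₃ a))
      }
      where
      di = F-distinct hF
      h∉ : h ∉ flat M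
      h∉ p = <-irrefl refl (≤-trans (heads st p) (≤-reflexive h≡))
      h-small : ⟦ big h ⟧ ≡ 0
      h-small with s <ᵇ toℕ h | <ᵇ-reflects-< s (toℕ h)
      ... | true | ofʸ q = ⊥-elim (<⇒≱ q h≤s)
      ... | false | _ = refl
      e₃ : ∀ a → 0 + (1 + (1 + (1 + 3 * a))) ≡ 3 * suc a
      e₃ = solve-∀

  start : State 0 []
  start = record { len = refl ; edges = [] ; uniq = [] ; heads = λ () ; few = z≤n }

  module Final (a : ℕ) (M : List (Tup n)) (a≤s : a ≤ s) (st : State a M) (stuck : Stuck a M) where

    x : ℕ
    x = # (free M)

    h : Fin n
    h = fromℕ< (≤-<-trans (m∸n≤m s a) s<n)

    toℕ-h : toℕ h ≡ s ∸ a
    toℕ-h = Finₚ.toℕ-fromℕ< _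

    n≤ : n ≤ x + suc s + 3 * a
    n≤ = begin
        n ≡⟨ trans (∑-const n 1) (*-identityʳ n) ⟨
        ∑ {n} (λ v → 1) ≤⟨ ∑-mono each ⟩
        ∑ (λ v → (⟦ free M v ⟧ + ⟦ toℕ v <ᵇ suc s ⟧) + ⟦ used M v ∧ big v ⟧) ≡⟨ trans (∑-distrib-+ (λ v → ⟦ free M v ⟧ + ⟦ toℕ v <ᵇ suc s ⟧) _) (cong (_+ ∑ (λ v → ⟦ used M v ∧ big v ⟧)) (∑-distrib-+ (⟦_⟧ ∘ free M) _)) ⟩
        x + ∑ {n} (λ v → ⟦ toℕ v <ᵇ suc s ⟧) + ∑ (λ v → ⟦ used M v ∧ big v ⟧) ≤⟨ +-mono-≤ (+-monoʳ-≤ x (≤-reflexive (#-below (suc s) s<n))) (≤-trans (#-≤-list big (flat M)) (few st)) ⟩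
        x + suc s + 3 * a ∎
      where
      open ≤-Reasoning
      each : ∀ v → 1 ≤ (⟦ free M v ⟧ + ⟦ toℕ v <ᵇ suc s ⟧) + ⟦ used M v ∧ big v ⟧
      each v with used M v | s <ᵇ toℕ v | <ᵇ-reflects-< s (toℕ v) | toℕ v <ᵇ suc s | <ᵇ-reflects-< (toℕ v) (suc s)
      ... | true | true | _ | _ | _ = ≤-trans (s≤s z≤n) (m≤n+m 1 _)
      ... | false | true | _ | _ | _ = s≤s z≤n
      ... | u | false | _ | true | _ = s≤s z≤n
      ... | u | false | ofⁿ p | false | ofⁿ q = ⊥-elim (q (s≤s (≮⇒≥ p)))

    -- `Stuck` speaks only of the head s - a, but in a shifted family any later head could be
    -- lowered to it, the free vertices being larger than `s`.
    three-free : ∀ i b c d → s ∸ a ≤ toℕ i → free M b ≡ true → free M c ≡ true → free M d ≡ true → F (i , b , c , d) ≡ true → ⊥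
    three-free i b c d i≥ fb fc fd hF = absurd (trans (sym (stuck h (trans (cong (_+ a) toℕ-h) (m∸n+n≡m a≤s)) b c d fb fc fd))
        (step₁ h (≤-trans (≤-reflexive toℕ-h) i≥) (apart fb) (apart fc) (apart fd) hF))
      where
      absurd : false ≡ true → ⊥
      absurd ()
      apart : ∀ {v} → free M v ≡ true → h ≢ v
      apart {v} fv refl = <⇒≱ (free-big {M} fv) (≤-trans (≤-reflexive toℕ-h) (m∸n≤m s a))

    late : Pred n
    late v = s ≤ᵇ toℕ v

    rest : Pred n
    rest v = late v ∧ not (free M v)

    -- One summand for each pair of positions. The factors 1 make each a product of four functions
    -- of one coordinate, as `Στ-product` requires.
    pairs : Tup n → ℕ
    pairs (a , b , c , d) = (r a * (r b * (1 * 1)) + (r a * (1 * (r c * 1)) + r a * (1 * (1 * r d))))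
                          + (1 * (r b * (r c * 1)) + (1 * (r b * (1 * r d)) + 1 * (1 * (r c * r d))))
      where
      r : Fin n → ℕ
      r v = ⟦ rest v ⟧

    -- At most two entries of a late edge are free, since three free ones could be given the head s ∸ a.
    late-pairs : ∀ p q r u → F (p , q , r , u) ≡ true → late p ≡ true → late q ≡ true → late r ≡ true → late u ≡ true →
      1 ≤ pairs (p , q , r , u)
    late-pairs p q r u hF lp lq lr lu = go (free M p) (free M q) (free M r) (free M u) refl refl refl refl
      where
      ge : ∀ {v} → late v ≡ true → s ∸ a ≤ toℕ v
      ge l = ≤-trans (m∸n≤m s a) (true-≤ᵇ l)
      spent : ∀ {v} → late v ≡ true → free M v ≡ false → ⟦ rest v ⟧ ≡ 1
      spent l f rewrite l | f = refl
      go : ∀ w₁ w₂ w₃ w₄ → free M p ≡ w₁ → free M q ≡ w₂ → free M r ≡ w₃ → free M u ≡ w₄ → 1 ≤ pairs (p , q , r , u)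
      go _ true true true _ e₂ e₃ e₄ = ⊥-elim (three-free p q r u (ge lp) e₂ e₃ e₄ hF)
      go true _ true true e₁ _ e₃ e₄ = ⊥-elim (three-free q p r u (ge lq) e₁ e₃ e₄ (trans (sym₁₂ S _ _ _ _) hF))
      go true true _ true e₁ e₂ _ e₄ = ⊥-elim (three-free r p q u (ge lr) e₁ e₂ e₄ (trans (sym₁₂ S _ _ _ _) (trans (sym₂₃ S _ _ _ _) hF)))
      go true true true _ e₁ e₂ e₃ _ = ⊥-elim (three-free u p q r (ge lu) e₁ e₂ e₃ (trans (sym₁₂ S _ _ _ _) (trans (sym₂₃ S _ _ _ _) (trans (sym₃₄ S _ _ _ _) hF))))
      go false false _ _ e₁ e₂ _ _ rewrite spent lp e₁ | spent lq e₂ = s≤s z≤n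
      go false true false _ e₁ _ e₃ _ rewrite spent lp e₁ | spent lr e₃ = ≤-trans (≤-trans (s≤s z≤n) (m≤n+m _ (1 * (⟦ rest q ⟧ * (1 * 1))))) (m≤m+n _ _)
      go false true true false e₁ _ _ e₄ rewrite spent lp e₁ | spent lu e₄ = ≤-trans (≤-trans (≤-trans (s≤s z≤n) (m≤n+m _ (1 * (1 * (⟦ rest r ⟧ * 1))))) (m≤n+m _ (1 * (⟦ rest q ⟧ * (1 * 1))))) (m≤m+n _ _)
      go true false false _ _ e₂ e₃ _ rewrite spent lq e₂ | spent lr e₃ = ≤-trans (s≤s z≤n) (m≤n+m _ (⟦ rest p ⟧ * (1 * (1 * 1)) + (⟦ rest p ⟧ * (1 * (1 * 1)) + ⟦ rest p ⟧ * (1 * (1 * ⟦ rest u ⟧)))))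
      go true false true false _ e₂ _ e₄ rewrite spent lq e₂ | spent lu e₄ = ≤-trans (≤-trans (s≤s z≤n) (m≤n+m _ (1 * (1 * (⟦ rest r ⟧ * 1))))) (m≤n+m _ (⟦ rest p ⟧ * (1 * (1 * 1)) + (⟦ rest p ⟧ * (1 * (⟦ rest r ⟧ * 1)) + ⟦ rest p ⟧ * (1 * (1 * 1)))))
      go true true false false _ _ e₃ e₄ rewrite spent lr e₃ | spent lu e₄ = ≤-trans (≤-trans (≤-trans (s≤s z≤n) (m≤n+m _ (1 * (⟦ rest q ⟧ * (1 * 1))))) (m≤n+m _ (1 * (⟦ rest q ⟧ * (1 * 1))))) (m≤n+m _ (⟦ rest p ⟧ * (⟦ rest q ⟧ * (1 * 1)) + (⟦ rest p ⟧ * (1 * (1 * 1)) + ⟦ rest p ⟧ * (1 * (1 * 1)))))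

    ρ≤ : # rest ≤ 1 + 3 * a
    ρ≤ = begin
        # rest ≤⟨ ∑-mono each ⟩
        ∑ (λ v → ⟦ toℕ v ≡ᵇ s ⟧ + ⟦ used M v ∧ big v ⟧) ≡⟨ ∑-distrib-+ {n} (λ v → ⟦ toℕ v ≡ᵇ s ⟧) _ ⟩
        ∑ {n} (λ v → ⟦ toℕ v ≡ᵇ s ⟧) + ∑ (λ v → ⟦ used M v ∧ big v ⟧) ≤⟨ +-mono-≤ (∑-toℕ-≡ {n} s) (≤-trans (#-≤-list big (flat M)) (few st)) ⟩
        1 + 3 * a ∎
      where
      open ≤-Reasoning
      each : ∀ v → ⟦ rest v ⟧ ≤ ⟦ toℕ v ≡ᵇ s ⟧ + ⟦ used M v ∧ big v ⟧
      each v with s ≤ᵇ toℕ v | ≤ᵇ-reflects-≤ s (toℕ v) | s <ᵇ toℕ v | <ᵇ-reflects-< s (toℕ v) | used M v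
      ... | false | _ | _ | _ | _ = z≤n
      ... | true | _ | true | _ | true = m≤n+m 1 _
      ... | true | _ | true | _ | false = z≤n
      ... | true | ofʸ p | false | ofⁿ q | u rewrite ≤-antisym (≮⇒≥ q) p | ≡ᵇ-refl s = s≤s z≤n

    everything : Pred n
    everything _ = true

    heads-range : Pred n
    heads-range v = (s ∸ a ≤ᵇ toℕ v) ∧ (toℕ v <ᵇ s)

    non-edge : Tup n → Bool
    non-edge (i , b , c , d) = heads-range i ∧ ord₃ (free M) b c d

    non-edge-F : ∀ τ → non-edge τ ≡ true → F τ ≡ false
    non-edge-F (i , b , c , d) h with F (i , b , c , d) in eq
    ... | false = refl
    ... | true with ∧-true {heads-range i} h
    ... | hi , ho with proj₁ (ord₃⇒ {P = free M} {b} {c} {d} ho)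
    ... | fb , fc , fd = ⊥-elim (three-free i b c d (true-≤ᵇ (proj₁ (∧-true {s ∸ a ≤ᵇ toℕ i} hi))) fb fc fd eq)

    non-edge-late : ∀ τ → non-edge τ ≡ true → ord late τ ≡ false
    non-edge-late (i , b , c , d) h with ord late (i , b , c , d) in eq
    ... | false = refl
    ... | true = ⊥-elim (<⇒≱ {toℕ i} {s} (true-<ᵇ (proj₂ (∧-true {s ∸ a ≤ᵇ toℕ i} (proj₁ (∧-true {heads-range i} h))))) (true-≤ᵇ (proj₁ (proj₁ (ord⇒ {P = late} {i} {b} {c} {d} eq)))))

    non-edge-ord : ∀ τ → non-edge τ ≡ true → ord everything τ ≡ true
    non-edge-ord (i , b , c , d) h with ∧-true {heads-range i} h
    ... | hi , ho with ord₃⇒ {P = free M} {b} {c} {d} ho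
    ... | (fb , fc , fd) , bc , bd , cd = ⇒ord {P = everything} refl refl refl refl (apart fb , apart fc , apart fd , bc , bd , cd)
      where
      apart : ∀ {v} → free M v ≡ true → i ≢ v
      apart {v} fv refl = <-asym (true-<ᵇ (proj₂ (∧-true {s ∸ a ≤ᵇ toℕ i} hi))) (free-big {M} fv)

    late-ord : ∀ τ → ord late τ ≡ true → ord everything τ ≡ true
    late-ord (p , q , r , u) h = ⇒ord {P = everything} refl refl refl refl (proj₂ (ord⇒ {P = late} {p} {q} {r} {u} h))

    F-ord : ∀ τ → F τ ≡ true → ord everything τ ≡ true
    F-ord (p , q , r , u) h = ⇒ord {P = everything} refl refl refl refl (F-distinct h)

    -- Edges, late tuples and non-edges are all orderings of four distinct vertices. A non-edge is
    -- not late, its head being below `s`, so the three kinds overlap only in the late edges, for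
    -- which `extra` pays.
    edge-count : ∀ (extra : Tup n → ℕ) → (∀ τ → F τ ≡ true → ord late τ ≡ true → 1 ≤ extra τ) →
      ∣ F ∣ᵣ + falling₄ (# late) + # heads-range * falling₃ x ≤ falling₄ n + Στ extra
    edge-count extra paid = begin
        ∣ F ∣ᵣ + falling₄ (# late) + # heads-range * falling₃ x ≡⟨ cong₂ (λ y z → ∣ F ∣ᵣ + y + z) (Στ-ord late) ∑ne ⟨
        ∣ F ∣ᵣ + Στ (⟦_⟧ ∘ ord late) + Στ (⟦_⟧ ∘ non-edge) ≡⟨ cong (_+ Στ (⟦_⟧ ∘ non-edge)) (Στ-+ (⟦_⟧ ∘ F) (⟦_⟧ ∘ ord late)) ⟨
        Στ (λ τ → ⟦ F τ ⟧ + ⟦ ord late τ ⟧) + Στ (⟦_⟧ ∘ non-edge) ≡⟨ Στ-+ (λ τ → ⟦ F τ ⟧ + ⟦ ord late τ ⟧) (⟦_⟧ ∘ non-edge) ⟨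
        Στ (λ τ → ⟦ F τ ⟧ + ⟦ ord late τ ⟧ + ⟦ non-edge τ ⟧) ≤⟨ Στ-mono pointwise ⟩
        Στ (λ τ → ⟦ ord everything τ ⟧ + extra τ) ≡⟨ Στ-+ (⟦_⟧ ∘ ord everything) extra ⟩
        Στ (⟦_⟧ ∘ ord everything) + Στ extra ≡⟨ cong (_+ Στ extra) (trans (Στ-ord everything) (cong falling₄ (trans (∑-const n 1) (*-identityʳ n)))) ⟩
        falling₄ n + Στ extra ∎
      where
      open ≤-Reasoning
      ∑ne : Στ (⟦_⟧ ∘ non-edge) ≡ # heads-range * falling₃ x
      ∑ne = trans (sum-cong-≗ λ i → trans (sum-cong-≗ λ b → trans (sum-cong-≗ λ c → trans (sum-cong-≗ λ d → ⟦∧⟧ (heads-range i) (ord₃ (free M) b c d))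
        (sym (*-distribˡ-sum ⟦ heads-range i ⟧ (λ d → ⟦ ord₃ (free M) b c d ⟧))))
        (sym (*-distribˡ-sum ⟦ heads-range i ⟧ (λ c → ∑ λ d → ⟦ ord₃ (free M) b c d ⟧))))
        (trans (sym (*-distribˡ-sum ⟦ heads-range i ⟧ (λ b → ∑ λ c → ∑ λ d → ⟦ ord₃ (free M) b c d ⟧))) (cong (⟦ heads-range i ⟧ *_) (∑-ord₃ (free M)))))
        (sym (*-distribʳ-sum (falling₃ x) (⟦_⟧ ∘ heads-range)))
      pointwise : ∀ τ → ⟦ F τ ⟧ + ⟦ ord late τ ⟧ + ⟦ non-edge τ ⟧ ≤ ⟦ ord everything τ ⟧ + extra τ
      pointwise τ = go (F τ) (ord late τ) (non-edge τ) refl refl refl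
        where
        go : ∀ f l e → F τ ≡ f → ord late τ ≡ l → non-edge τ ≡ e → ⟦ f ⟧ + ⟦ l ⟧ + ⟦ e ⟧ ≤ ⟦ ord everything τ ⟧ + extra τ
        go f l true hf hl he with trans (sym hf) (non-edge-F τ he) | trans (sym hl) (non-edge-late τ he)
        ... | refl | refl rewrite non-edge-ord τ he = s≤s z≤n
        go true true false hf hl he rewrite F-ord τ hf = s≤s (paid τ hf hl)
        go true false false hf hl he rewrite F-ord τ hf = s≤s z≤n
        go false true false hf hl he rewrite late-ord τ hl = s≤s z≤n
        go false false false hf hl he = z≤n

    late≥ : n ∸ s ≤ # late
    late≥ = m≤n+o⇒m∸n≤o n s (begin
        n ≡⟨ trans (∑-const n 1) (*-identityʳ n) ⟨
        ∑ {n} (λ v → 1) ≤⟨ ∑-mono each ⟩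
        ∑ {n} (λ v → ⟦ toℕ v <ᵇ s ⟧ + ⟦ late v ⟧) ≡⟨ ∑-distrib-+ {n} (λ v → ⟦ toℕ v <ᵇ s ⟧) _ ⟩
        ∑ {n} (λ v → ⟦ toℕ v <ᵇ s ⟧) + # late ≡⟨ cong (_+ # late) (#-below {n} s (<⇒≤ s<n)) ⟩
        s + # late ∎)
      where
      open ≤-Reasoning
      each : ∀ v → 1 ≤ ⟦ toℕ v <ᵇ s ⟧ + ⟦ late v ⟧
      each v with toℕ v <ᵇ s | <ᵇ-reflects-< (toℕ v) s | s ≤ᵇ toℕ v | ≤ᵇ-reflects-≤ s (toℕ v)
      ... | true | _ | _ | _ = s≤s z≤n
      ... | false | _ | true | _ = ≤-refl
      ... | false | ofⁿ p | false | ofⁿ q = ⊥-elim (q (≮⇒≥ p))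

    falling₄-mono : ∀ {p q} → p ≤ q → falling₄ p ≤ falling₄ q
    falling₄-mono h = *-mono-≤ h (*-mono-≤ (∸-monoˡ-≤ 1 h) (*-mono-≤ (∸-monoˡ-≤ 2 h) (∸-monoˡ-≤ 3 h)))

    -- With nothing chosen, `s` is the only late vertex that is not free, so among four distinct
    -- late vertices three are free.
    late-none : a ≡ 0 → ∀ τ → F τ ≡ true → ord late τ ≡ true → ⊥
    late-none a≡0 (p , q , r , u) hF ho with ord⇒ {P = late} {p} {q} {r} {u} ho
    ... | (lp , lq , lr , lu) , pq , pr , pu , qr , qu , ru = go (free M p) (free M q) (free M r) (free M u) refl refl refl refl
      where
      M≡[] : ∀ M → length M ≡ 0 → ∀ v → used M v ≡ false
      M≡[] [] _ v = refl
      at-s : ∀ {v} → late v ≡ true → free M v ≡ false → toℕ v ≡ s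
      at-s {v} l f with s <ᵇ toℕ v | <ᵇ-reflects-< s (toℕ v)
      ... | false | ofⁿ k = ≤-antisym (≮⇒≥ k) (true-≤ᵇ l)
      ... | true | _ rewrite M≡[] M (trans (len st) a≡0) v with f
      ... | ()
      two : ∀ {v w} → v ≢ w → late v ≡ true → late w ≡ true → free M v ≡ false → free M w ≡ false → ⊥
      two ne lv lw fv fw = ne (Finₚ.toℕ-injective (trans (at-s lv fv) (sym (at-s lw fw))))
      ge : ∀ {v} → late v ≡ true → s ∸ a ≤ toℕ v
      ge l = ≤-trans (m∸n≤m s a) (true-≤ᵇ l)
      go : ∀ w₁ w₂ w₃ w₄ → free M p ≡ w₁ → free M q ≡ w₂ → free M r ≡ w₃ → free M u ≡ w₄ → ⊥
      go _ true true true _ e₂ e₃ e₄ = three-free p q r u (ge lp) e₂ e₃ e₄ hF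
      go true _ true true e₁ _ e₃ e₄ = three-free q p r u (ge lq) e₁ e₃ e₄ (trans (sym₁₂ S _ _ _ _) hF)
      go true true _ true e₁ e₂ _ e₄ = three-free r p q u (ge lr) e₁ e₂ e₄ (trans (sym₁₂ S _ _ _ _) (trans (sym₂₃ S _ _ _ _) hF))
      go true true true _ e₁ e₂ e₃ _ = three-free u p q r (ge lu) e₁ e₂ e₃ (trans (sym₁₂ S _ _ _ _) (trans (sym₂₃ S _ _ _ _) (trans (sym₃₄ S _ _ _ _) hF)))
      go false false _ _ e₁ e₂ _ _ = two pq lp lq e₁ e₂
      go false true false _ e₁ _ e₃ _ = two pr lp lr e₁ e₃
      go false true true false e₁ _ _ e₄ = two pu lp lu e₁ e₄
      go true false false _ _ e₂ e₃ _ = two qr lq lr e₂ e₃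
      go true false true false _ e₂ _ e₄ = two qu lq lu e₂ e₄
      go true true false false _ _ e₃ e₄ = two ru lr lu e₃ e₄

    Στ-pairs : Στ pairs ≡ 6 * (# rest * # rest * (n * n))
    Στ-pairs = begin
        Στ pairs ≡⟨ trans (Στ-+ (λ τ → p₁ τ + (p₂ τ + p₃ τ)) (λ τ → p₄ τ + (p₅ τ + p₆ τ))) (cong₂ _+_ (trans (Στ-+ p₁ (λ τ → p₂ τ + p₃ τ)) (cong (Στ p₁ +_) (Στ-+ p₂ p₃))) (trans (Στ-+ p₄ (λ τ → p₅ τ + p₆ τ)) (cong (Στ p₄ +_) (Στ-+ p₅ p₆)))) ⟩
        (Στ p₁ + (Στ p₂ + Στ p₃)) + (Στ p₄ + (Στ p₅ + Στ p₆))
          ≡⟨ cong₂ _+_ (cong₂ _+_ (Στ-product r r i i) (cong₂ _+_ (Στ-product r i r i) (Στ-product r i i r)))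
                       (cong₂ _+_ (Στ-product i r r i) (cong₂ _+_ (Στ-product i r i r) (Στ-product i i r r))) ⟩
        shape ρ (∑ i) ≡⟨ cong (shape ρ) (trans (∑-const n 1) (*-identityʳ n)) ⟩
        shape ρ n ≡⟨ e ρ n ⟩
        6 * (ρ * ρ * (n * n)) ∎
      where
      open ≡-Reasoning
      r i : Fin n → ℕ
      r v = ⟦ rest v ⟧
      i _ = 1
      ρ = # rest
      shape : ℕ → ℕ → ℕ
      shape ρ n = (ρ * (ρ * (n * n)) + (ρ * (n * (ρ * n)) + ρ * (n * (n * ρ)))) + (n * (ρ * (ρ * n)) + (n * (ρ * (n * ρ)) + n * (n * (ρ * ρ))))
      e : ∀ ρ n → (ρ * (ρ * (n * n)) + (ρ * (n * (ρ * n)) + ρ * (n * (n * ρ)))) + (n * (ρ * (ρ * n)) + (n * (ρ * (n * ρ)) + n * (n * (ρ * ρ)))) ≡ 6 * (ρ * ρ * (n * n))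
      e = solve-∀
      p₁ p₂ p₃ p₄ p₅ p₆ : Tup n → ℕ
      p₁ (a , b , c , d) = r a * (r b * (1 * 1))
      p₂ (a , b , c , d) = r a * (1 * (r c * 1))
      p₃ (a , b , c , d) = r a * (1 * (1 * r d))
      p₄ (a , b , c , d) = 1 * (r b * (r c * 1))
      p₅ (a , b , c , d) = 1 * (r b * (1 * r d))
      p₆ (a , b , c , d) = 1 * (1 * (r c * r d))

    #heads≥ : a ≤ # heads-range
    #heads≥ = ≤-trans (≤-reflexive (sym (m∸[m∸n]≡n a≤s))) (#-interval (s ∸ a) s (m∸n≤m s a) (<⇒≤ s<n))

    -- For a = 0 no edge is late. Otherwise there are at most 6 (4 a)² n² late edge tuples, against
    -- at least a (n / 2)³ missing ones, and 768 = 8 * 6 * 16.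
    bound : 768 * a ≤ n → n + 4 ≤ 2 * x → ∣ F ∣ᵣ + falling₄ (n ∸ s) ≤ falling₄ n
    bound small half with a ≟ 0
    ... | yes a≡0 = begin
        ∣ F ∣ᵣ + falling₄ (n ∸ s) ≤⟨ +-monoʳ-≤ ∣ F ∣ᵣ (falling₄-mono late≥) ⟩
        ∣ F ∣ᵣ + falling₄ (# late) ≤⟨ m≤m+n _ _ ⟩
        ∣ F ∣ᵣ + falling₄ (# late) + # heads-range * falling₃ x ≤⟨ edge-count (λ _ → 0) (λ τ hF ho → ⊥-elim (late-none a≡0 τ hF ho)) ⟩
        falling₄ n + Στ {n} (λ _ → 0) ≡⟨ trans (cong (falling₄ n +_) (trans (Στ-const n 0) (*-zeroʳ (n * n * n * n)))) (+-identityʳ _) ⟩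
        falling₄ n ∎
      where open ≤-Reasoning
    ... | no a≢0 = +-cancelʳ-≤ (# heads-range * falling₃ x) _ _ (begin
        ∣ F ∣ᵣ + falling₄ (n ∸ s) + # heads-range * falling₃ x ≤⟨ +-monoˡ-≤ _ (+-monoʳ-≤ ∣ F ∣ᵣ (falling₄-mono late≥)) ⟩
        ∣ F ∣ᵣ + falling₄ (# late) + # heads-range * falling₃ x ≤⟨ edge-count pairs (λ { (p , q , r , u) hF ho → let l = proj₁ (ord⇒ {P = late} {p} {q} {r} {u} ho) in
                                                                            late-pairs p q r u hF (proj₁ l) (proj₁ (proj₂ l)) (proj₁ (proj₂ (proj₂ l))) (proj₂ (proj₂ (proj₂ l))) }) ⟩
        falling₄ n + Στ pairs ≤⟨ +-monoʳ-≤ (falling₄ n) (≤-trans few-pairs (*-monoˡ-≤ (falling₃ x) #heads≥)) ⟩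
        falling₄ n + # heads-range * falling₃ x ∎)
      where
      open ≤-Reasoning
      1≤a : 1 ≤ a
      1≤a = n≢0⇒n>0 a≢0
      y = x ∸ 2
      n≤2y : n ≤ 2 * y
      n≤2y = ≤-trans (≤-reflexive (sym (m+n∸n≡m n 4))) (≤-trans (∸-monoˡ-≤ 4 half) (≤-reflexive (sym (*-distribˡ-∸ 2 x 2))))
      cube-y : cube y ≤ falling₃ x
      cube-y = ≤-trans (≤-reflexive (*-assoc y y y)) (*-mono-≤ (m∸n≤m x 2) (*-mono-≤ (∸-monoʳ-≤ x (s≤s z≤n)) ≤-refl))
      ρ≤4a : # rest ≤ 4 * a
      ρ≤4a = ≤-trans ρ≤ (+-monoˡ-≤ (3 * a) 1≤a)
      few-pairs : Στ pairs ≤ a * falling₃ x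
      few-pairs = *-cancelˡ-≤ 8 (begin
        8 * Στ pairs ≡⟨ cong (8 *_) Στ-pairs ⟩
        8 * (6 * (# rest * # rest * (n * n))) ≤⟨ *-monoʳ-≤ 8 (*-monoʳ-≤ 6 (*-monoˡ-≤ (n * n) (*-mono-≤ ρ≤4a ρ≤4a))) ⟩
        8 * (6 * (4 * a * (4 * a) * (n * n))) ≡⟨ e₁ a n ⟩
        768 * a * (a * (n * n)) ≤⟨ *-monoˡ-≤ (a * (n * n)) small ⟩
        n * (a * (n * n)) ≡⟨ e₂ a n ⟩
        a * cube n ≤⟨ *-monoʳ-≤ a (cube-mono n≤2y) ⟩
        a * cube (2 * y) ≡⟨ e₃ a y ⟩
        8 * (a * cube y) ≤⟨ *-monoʳ-≤ 8 (*-monoʳ-≤ a cube-y) ⟩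
        8 * (a * falling₃ x) ∎)
        where
        e₁ : ∀ a n → 8 * (6 * (4 * a * (4 * a) * (n * n))) ≡ 768 * a * (a * (n * n))
        e₁ = solve-∀
        e₂ : ∀ a n → n * (a * (n * n)) ≡ a * (n * n * n)
        e₂ = solve-∀
        e₃ : ∀ a y → a * (2 * y * (2 * y) * (2 * y)) ≡ 8 * (a * (y * y * y))
        e₃ = solve-∀

  Full : Fin n → Set
  Full j = ∀ (X : Pred n) → (∀ v → X v ≡ true → s < toℕ v) → n ≤ 6 * # X →
    ∃ λ b → ∃ λ c → ∃ λ d → X b ≡ true × X c ≡ true × X d ≡ true × F (j , b , c , d) ≡ true

  -- The greedy choice stops with a ≤ b. This is clear if s ≤ b. If instead j = s - b is full, the
  -- free vertices, being a sixth of all, contain a triple that forms an edge with `j`; for a > b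
  -- this `j` would be at least s - a, and `three-free` forbids such an edge.
  finish : ∀ b → 5 * s ≤ n → 768 * b ≤ n → 60 ≤ n → (s ≤ b ⊎ ∃ λ j → s ≡ toℕ j + b × Full j) → ∣ F ∣ᵣ + falling₄ (n ∸ s) ≤ falling₄ n
  finish b 5s≤n small 60≤n fullness = conclude (greedy (suc s) 0 [] refl start)
    where
    conclude : (∃ λ a → ∃ λ M → a ≤ s × State a M × Stuck a M) → ∣ F ∣ᵣ + falling₄ (n ∸ s) ≤ falling₄ n
    conclude (a , M , a≤s , st , stuck) = Out.bound (≤-trans (*-monoʳ-≤ 768 a≤b) small) (free-half {n} {Out.x} {s} {a} {b} Out.n≤ a≤b small 5s≤n 60≤n)
      where
      module Out = Final a M a≤s st stuck
      by-full : ∃ (λ j → s ≡ toℕ j + b × Full j) → a ≤ b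
      by-full (j , s≡ , full) = ≮⇒≥ λ b<a → refute b<a (full (free M) (λ v h → free-big {M} h) (free-sixth {n} {Out.x} {s} {a} Out.n≤ a≤s 5s≤n 60≤n))
        where
        refute : b < a → (∃ λ p → ∃ λ q → ∃ λ r → free M p ≡ true × free M q ≡ true × free M r ≡ true × F (j , p , q , r) ≡ true) → ⊥
        refute b<a (p , q , r , fp , fq , fr , hF) = Out.three-free j p q r
          (m≤n+o⇒m∸n≤o s a (≤-trans (≤-reflexive s≡) (≤-trans (+-monoʳ-≤ (toℕ j) (<⇒≤ b<a)) (≤-reflexive (+-comm (toℕ j) a))))) fp fq fr hF
      a≤b : a ≤ b
      a≤b = [ ≤-trans a≤s , by-full ]′ fullness

-- Hypergraphs

open import Defs
open import Data.Nat.Combinatorics using (_C_; nC1≡n; nCk+nC[k+1]≡[n+1]C[k+1])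
open import Data.Fin.Subset using (Subset; ∣_∣)
import Data.Fin.Subset.Properties as Subₚ
open import Data.Vec using (lookup; []; _∷_)
open import Data.Vec.Properties using ([]=⇒lookup; tabulate∘lookup; tabulate-cong)

bool-≡ : ∀ {x y} → (x ≡ true → y ≡ true) → (y ≡ true → x ≡ true) → x ≡ y
bool-≡ {true} f g = sym (f refl)
bool-≡ {false} {false} f g = refl
bool-≡ {false} {true} f g = g refl

#-lookup : ∀ (e : Subset n) → # (lookup e) ≡ ∣ e ∣
#-lookup [] = refl
#-lookup (true ∷ e) = cong suc (#-lookup e)
#-lookup (false ∷ e) = #-lookup e

ord-sym₁₂ : ∀ (P : Pred n) a b c d → ord P (a , b , c , d) ≡ ord P (b , a , c , d)
ord-sym₁₂ P a b c d = bool-≡ (half a b) (half b a)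
  where
  half : ∀ a b → ord P (a , b , c , d) ≡ true → ord P (b , a , c , d) ≡ true
  half a b h with ord⇒ {P = P} {a} {b} {c} {d} h
  ... | (pa , pb , pc , pd) , (ab , ac , ad , bc , bd , cd) = ⇒ord {P = P} pb pa pc pd ((ab ∘ sym) , bc , bd , ac , ad , cd)

ord-sym₂₃ : ∀ (P : Pred n) a b c d → ord P (a , b , c , d) ≡ ord P (a , c , b , d)
ord-sym₂₃ P a b c d = bool-≡ (half b c) (half c b)
  where
  half : ∀ b c → ord P (a , b , c , d) ≡ true → ord P (a , c , b , d) ≡ true
  half b c h with ord⇒ {P = P} {a} {b} {c} {d} h
  ... | (pa , pb , pc , pd) , (ab , ac , ad , bc , bd , cd) = ⇒ord {P = P} pa pc pb pd (ac , ab , ad , (bc ∘ sym) , cd , bd)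

ord-sym₃₄ : ∀ (P : Pred n) a b c d → ord P (a , b , c , d) ≡ ord P (a , b , d , c)
ord-sym₃₄ P a b c d = bool-≡ (half c d) (half d c)
  where
  half : ∀ c d → ord P (a , b , c , d) ≡ true → ord P (a , b , d , c) ≡ true
  half c d h with ord⇒ {P = P} {a} {b} {c} {d} h
  ... | (pa , pb , pc , pd) , (ab , ac , ad , bc , bd , cd) = ⇒ord {P = P} pa pb pd pc (ab , ad , ac , bd , bc , (cd ∘ sym))

-- A set of size 4 has no elements besides those of an ordering of it.
ord-exhausts : ∀ (P : Pred n) {τ v} → # P ≡ 4 → ord P τ ≡ true → P v ≡ true → v ∈ entries τ
ord-exhausts P {a , b , c , d} {v} #P≡4 h pv with any? (v Fin.≟_) (entries (a , b , c , d))
... | yes p = p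
... | no v∉ with ord⇒ {P = P} {a} {b} {c} {d} h
... | (pa , pb , pc , pd) , (ab , ac , ad , bc , bd , cd) = ⊥-elim (<⇒≱ (≤-trans (≤-reflexive (sym (cong ⟦_⟧ v-left))) (term≤∑ (⟦_⟧ ∘ (((P ∖ a) ∖ b) ∖ c) ∖ d) v)) (≤-reflexive none))
  where
  b-in = true-∖ {P = P} pb (ab ∘ sym)
  c-in = true-∖ {P = P ∖ a} (true-∖ {P = P} pc (ac ∘ sym)) (bc ∘ sym)
  d-in = true-∖ {P = (P ∖ a) ∖ b} (true-∖ {P = P ∖ a} (true-∖ {P = P} pd (ad ∘ sym)) (bd ∘ sym)) (cd ∘ sym)
  none : # ((((P ∖ a) ∖ b) ∖ c) ∖ d) ≡ 0
  none = trans (#-∖ (((P ∖ a) ∖ b) ∖ c) d d-in) (cong (_∸ 1) (trans (#-∖ ((P ∖ a) ∖ b) c c-in) (cong (_∸ 1) (trans (#-∖ (P ∖ a) b b-in) (cong (_∸ 1) (trans (#-∖ P a pa) (cong (_∸ 1) #P≡4)))))))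
  v-left : ((((P ∖ a) ∖ b) ∖ c) ∖ d) v ≡ true
  v-left = true-∖ {P = ((P ∖ a) ∖ b) ∖ c} (true-∖ {P = (P ∖ a) ∖ b} (true-∖ {P = P ∖ a} (true-∖ {P = P} pv
    (v∉ ∘ here)) (v∉ ∘ there ∘ here)) (v∉ ∘ there ∘ there ∘ here)) (v∉ ∘ there ∘ there ∘ there ∘ here)

ord-entries : ∀ (P : Pred n) {τ v} → ord P τ ≡ true → v ∈ entries τ → P v ≡ true
ord-entries P {a , b , c , d} h p with proj₁ (ord⇒ {P = P} {a} {b} {c} {d} h)
ord-entries P h (here refl) | pa , pb , pc , pd = pa
ord-entries P h (there (here refl)) | pa , pb , pc , pd = pb
ord-entries P h (there (there (here refl))) | pa , pb , pc , pd = pc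
ord-entries P h (there (there (there (here refl)))) | pa , pb , pc , pd = pd

distinct⇒unique : ∀ {a b c d : Fin n} → Distinct a b c d → Unique (a ∷ b ∷ c ∷ d ∷ [])
distinct⇒unique (p , q , r , s , t , u) = (p ∷ q ∷ r ∷ []) ∷ (s ∷ t ∷ []) ∷ (u ∷ []) ∷ [] ∷ []

orderings : List (Subset n) → Rel n
orderings [] τ = false
orderings (e ∷ es) τ = ord (lookup e) τ ∨ orderings es τ

orderings-edge : ∀ (es : List (Subset n)) τ → orderings es τ ≡ true → ∃ λ e → e ∈ es × ord (lookup e) τ ≡ true
orderings-edge (e ∷ es) τ h with ord (lookup e) τ in eq
... | true = e , here refl , eq
... | false with orderings-edge es τ h
... | e′ , p , q = e′ , there p , q

orderings-sets : ∀ (es : List (Subset n)) → FourSets (orderings es)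
orderings-sets es = record
  { sym₁₂ = λ a b c d → go es _ _ (λ P → ord-sym₁₂ P a b c d)
  ; sym₂₃ = λ a b c d → go es _ _ (λ P → ord-sym₂₃ P a b c d)
  ; sym₃₄ = λ a b c d → go es _ _ (λ P → ord-sym₃₄ P a b c d)
  ; distinct = λ { (a , b , c , d) h → let e = orderings-edge es (a , b , c , d) h in distinct⇒unique (proj₂ (ord⇒ {P = lookup (proj₁ e)} (proj₂ (proj₂ e)))) }
  }
  where
  go : ∀ es τ σ → (∀ P → ord P τ ≡ ord P σ) → orderings es τ ≡ orderings es σ
  go [] τ σ h = refl
  go (e ∷ es) τ σ h = cong₂ _∨_ (h (lookup e)) (go es τ σ h)

-- Each tuple orders some edge and, by size, exhausts it; so disjoint tuples come from disjoint
-- edges. These edges are different because each contains the first entry of its own tuple.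
orderings-ν : ∀ (H : FourGraph n) {s} → νAtMost H s → νRel (orderings (edges H)) s
orderings-ν H {s} ν M all u = ≤-trans (≤-reflexive (sym (Chosen.len c))) (ν (Chosen.chosen c) (Chosen.edge c , Chosen.uniq c , Chosen.disj c))
  where
  record Chosen (M : List (Tup _)) : Set where
    field
      chosen : List (Subset _)
      len : length chosen ≡ length M
      edge : All (_∈ edges H) chosen
      uniq : Unique chosen
      disj : AllPairs Disjoint chosen
      inside : All (λ e → ∀ v → lookup e v ≡ true → v ∈ flat M) chosen
  choose : ∀ M → All (λ τ → orderings (edges H) τ ≡ true) M → Unique (flat M) → Chosen M
  choose [] [] u = record { chosen = [] ; len = refl ; edge = [] ; uniq = [] ; disj = [] ; inside = [] }
  choose (τ@(a , b , c , d) ∷ M) (h ∷ hs) u with orderings-edge (edges H) τ h | choose M hs (Unique-++ʳ (entries τ) u)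
  ... | e , e∈ , oe | C = record
    { chosen = e ∷ Chosen.chosen C
    ; len = cong suc (Chosen.len C)
    ; edge = e∈ ∷ Chosen.edge C
    ; uniq = All.map (λ ins eq → clash (ins a (subst (λ z → lookup z a ≡ true) eq a∈e))) (Chosen.inside C) ∷ Chosen.uniq C
    ; disj = All.map (λ {e′} ins → λ { (v , v∈) → Unique-++-disjoint {xs = entries τ} u
          (exhaust ([]=⇒lookup (proj₁ (Subₚ.x∈p∩q⁻ e e′ v∈)))) (ins v ([]=⇒lookup (proj₂ (Subₚ.x∈p∩q⁻ e e′ v∈)))) }) (Chosen.inside C) ∷ Chosen.disj C
    ; inside = (λ v p → ∈-++⁺ˡ (exhaust p)) ∷ All.map (λ ins v p → ∈-++⁺ʳ (entries τ) (ins v p)) (Chosen.inside C)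
    }
    where
    size : # (lookup e) ≡ 4
    size = trans (#-lookup e) (All.lookup (uniform H) e∈)
    exhaust : ∀ {v} → lookup e v ≡ true → v ∈ entries τ
    exhaust = ord-exhausts (lookup e) {τ} size oe
    a∈e : lookup e a ≡ true
    a∈e = ord-entries (lookup e) {τ} oe (here refl)
    clash : a ∈ flat M → ⊥
    clash p = Unique-++-disjoint {xs = entries τ} u (here refl) p
  c = choose M all u

-- A set of four has 24 orderings and is determined by any one of them, so orderings of different
-- edges never coincide.
orderings-count : ∀ (H : FourGraph n) → 24 * e H ≤ ∣ orderings (edges H) ∣ᵣ
orderings-count {n} H = ≤-trans (≤-reflexive (count (edges H) (uniform H))) (Στ-mono (λ τ → once τ (edges H) (unique H) (uniform H)))
  where
  count : ∀ es → All (λ e → ∣ e ∣ ≡ 4) es → 24 * length es ≡ Στ (λ τ → sumL (λ e → ⟦ ord (lookup e) τ ⟧) es)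
  count [] [] = sym (trans (Στ-const n 0) (*-zeroʳ (fourth n)))
  count (e ∷ es) (h ∷ hs) = trans (*-suc 24 (length es)) (trans (cong₂ _+_ (sym (trans (Στ-ord (lookup e)) (cong falling₄ (trans (#-lookup e) h)))) (count es hs))
    (sym (Στ-+ (⟦_⟧ ∘ ord (lookup e)) (λ τ → sumL (λ e → ⟦ ord (lookup e) τ ⟧) es))))
  same : ∀ τ {e e′ : Subset n} → ∣ e ∣ ≡ 4 → ∣ e′ ∣ ≡ 4 → ord (lookup e) τ ≡ true → ord (lookup e′) τ ≡ true → e ≡ e′
  same τ {e} {e′} h h′ o o′ = trans (sym (tabulate∘lookup e)) (trans (tabulate-cong (λ v → bool-≡ (λ p → ord-entries (lookup e′) {τ} o′ (ord-exhausts (lookup e) {τ} (trans (#-lookup e) h) o p))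
    (λ p → ord-entries (lookup e) {τ} o (ord-exhausts (lookup e′) {τ} (trans (#-lookup e′) h′) o′ p)))) (tabulate∘lookup e′))
  once : ∀ τ es → Unique es → All (λ e → ∣ e ∣ ≡ 4) es → sumL (λ e → ⟦ ord (lookup e) τ ⟧) es ≤ ⟦ orderings es τ ⟧
  once τ [] u h = z≤n
  once τ (e ∷ es) (ne ∷ u) (h ∷ hs) with ord (lookup e) τ in eq
  ... | false = once τ es u hs
  ... | true = s≤s (≤-reflexive (rest es ne hs))
    where
    rest : ∀ es → All (e ≢_) es → All (λ e → ∣ e ∣ ≡ 4) es → sumL (λ e → ⟦ ord (lookup e) τ ⟧) es ≡ 0
    rest [] [] [] = refl
    rest (e′ ∷ es) (ne ∷ nes) (h′ ∷ hs) with ord (lookup e′) τ in eq′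
    ... | true = ⊥-elim (ne (same τ h h′ eq eq′))
    ... | false = rest es nes hs

-- Binomial coefficients and the choice of constants

falling₂ : ℕ → ℕ
falling₂ p = p * (p ∸ 1)

C-2 : ∀ n → 2 * (n C 2) ≡ falling₂ n
C-2 zero = refl
C-2 (suc n) = trans (cong (2 *_) (sym (nCk+nC[k+1]≡[n+1]C[k+1] n 1))) (trans (*-distribˡ-+ 2 (n C 1) (n C 2)) (trans (cong₂ (λ x y → 2 * x + y) (nC1≡n n) (C-2 n)) (step n)))
  where
  step : ∀ n → 2 * n + n * (n ∸ 1) ≡ suc n * n
  step zero = refl
  step (suc n) = expand≡ n
    where
    expand≡ : ∀ n → 2 * (1 + n) + (1 + n) * n ≡ (2 + n) * (1 + n)
    expand≡ = solve-∀

C-3 : ∀ n → 6 * (n C 3) ≡ falling₃ n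
C-3 zero = refl
C-3 (suc n) = trans (cong (6 *_) (sym (nCk+nC[k+1]≡[n+1]C[k+1] n 2))) (trans (trans (*-distribˡ-+ 6 (n C 2) (n C 3)) (cong (_+ 6 * (n C 3)) (*-assoc 3 2 (n C 2)))) (trans (cong₂ (λ x y → 3 * x + y) (C-2 n) (C-3 n)) (step n)))
  where
  step : ∀ n → 3 * (n * (n ∸ 1)) + n * ((n ∸ 1) * (n ∸ 2)) ≡ suc n * (n * (n ∸ 1))
  step zero = refl
  step (suc zero) = refl
  step (suc (suc n)) = expand≡ n
    where
    expand≡ : ∀ n → 3 * ((2 + n) * (1 + n)) + (2 + n) * ((1 + n) * n) ≡ (3 + n) * ((2 + n) * (1 + n))
    expand≡ = solve-∀

C-4 : ∀ n → 24 * (n C 4) ≡ falling₄ n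
C-4 zero = refl
C-4 (suc n) = trans (cong (24 *_) (sym (nCk+nC[k+1]≡[n+1]C[k+1] n 3))) (trans (trans (*-distribˡ-+ 24 (n C 3) (n C 4)) (cong (_+ 24 * (n C 4)) (*-assoc 4 6 (n C 3)))) (trans (cong₂ (λ x y → 4 * x + y) (C-3 n) (C-4 n)) (step n)))
  where
  step : ∀ n → 4 * (n * ((n ∸ 1) * (n ∸ 2))) + n * ((n ∸ 1) * ((n ∸ 2) * (n ∸ 3))) ≡ suc n * (n * ((n ∸ 1) * (n ∸ 2)))
  step zero = refl
  step (suc zero) = refl
  step (suc (suc zero)) = refl
  step (suc (suc (suc n))) = expand≡ n
    where
    expand≡ : ∀ n → 4 * ((3 + n) * ((2 + n) * (1 + n))) + (3 + n) * ((2 + n) * ((1 + n) * n)) ≡ (4 + n) * ((3 + n) * ((2 + n) * (1 + n)))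
    expand≡ = solve-∀

falling₄≤fourth : ∀ p → falling₄ p ≤ fourth p
falling₄≤fourth p = ≤-trans (*-monoʳ-≤ p (*-mono-≤ (m∸n≤m p 1) (*-mono-≤ (m∸n≤m p 2) (m∸n≤m p 3)))) (≤-reflexive (expand≡ p))
  where
  expand≡ : ∀ p → p * (p * (p * p)) ≡ p * p * p * p
  expand≡ = solve-∀

-- The difference of p⁴ and p (p - 1) (p - 2) (p - 3) is 6 p³ - 11 p² + 6 p. Below 3 some
-- subtraction is truncated, hence the separate cases.
fourth≤falling₄ : ∀ p → fourth p ≤ falling₄ p + 6 * cube p
fourth≤falling₄ zero = z≤n
fourth≤falling₄ (suc zero) = s≤s z≤n
fourth≤falling₄ (suc (suc zero)) = m≤m+n 16 32
fourth≤falling₄ (suc (suc (suc p))) = ≤-trans (m≤m+n _ (11 * (p * p) + 60 * p + 81)) (≤-reflexive (expand≡ p))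
  where
  expand≡ : ∀ p → (3 + p) * (3 + p) * (3 + p) * (3 + p) + (11 * (p * p) + 60 * p + 81)
    ≡ (3 + p) * ((2 + p) * ((1 + p) * p)) + 6 * ((3 + p) * (3 + p) * (3 + p))
  expand≡ = solve-∀

-- `c₄` exceeds what `η-bound` permits, and `c₃` adds the possible deficit of heavy vertices, so
-- that the head s - c₃ κ is full. `finish` then needs 768 c₃ κ ≤ n. With q = 2 * 768 * c₃ and κ =
-- q⁴ + L, where L is about n / q, this follows from n ≥ q (q⁴ + 1). The 60 serves `free-sixth` and
-- `free-half`.
module Main (k c₁ c₃ c₄ q n₀ : ℕ) (k≥ : 256 * 6 + 20 * 500 ≤ k) (c₁≡ : c₁ ≡ 2 * k) (c₄> : 216 * (4 * c₁ + 10) < c₄) (c₃≡ : c₃ ≡ 8 * (4 * c₁ + 6) + c₄)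
  (q≡ : q ≡ 2 * (768 * c₃)) (n₀≡ : n₀ ≡ q * (q * (q * (q * q)) + 1) + 60) where

  0<c₃ : 0 < c₃
  0<c₃ = ≤-trans (≤-trans (s≤s z≤n) c₄>) (≤-trans (m≤n+m c₄ _) (≤-reflexive (sym c₃≡)))

  shifted-bound : ∀ {n s κ} L .{{_ : NonZero L}} {F : Rel n} → FourSets F → Shifted F → νRel F s → 5 * s ≤ n → 60 ≤ n →
    n ≤ q * L → κ ≡ q * (q * (q * q)) + L → 768 * (c₃ * κ) ≤ n → ∣ F ∣ᵣ + falling₄ (n ∸ s) ≤ falling₄ n
  -- Stability presupposes a large family, so the bound is derived from its own negation, which
  -- supplies `many`.
  shifted-bound {n} {s} {κ} L {F} S sh ν 5s≤n 60≤n n≤qL κ≡ small = ≮⇒≥ λ large → <⇒≱ large (dense large)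
    where
    open ≤-Reasoning
    D = duality F
    open Slackness D
    d = n ∸ s
    1≤κ : 1 ≤ κ
    1≤κ = ≤-trans (≤-trans (>-nonZero⁻¹ L) (m≤n+m L (q * (q * (q * q))))) (≤-reflexive (sym κ≡))
    s≤n : s ≤ n
    s≤n = ≤-trans (m≤n*m s 5) 5s≤n
    s<n : s < n
    s<n = ≤∧≢⇒< s≤n λ { refl → <⇒≱ (m<m+n s {4 * s} (≤-trans (≤-trans (s≤s z≤n) 60≤n) (m≤n*m s 4))) 5s≤n }
    n≡ : n ≡ s + d
    n≡ = sym (m+[n∸m]≡n s≤n)
    4s≤d : 4 * s ≤ d
    4s≤d = +-cancelˡ-≤ s _ _ (≤-trans 5s≤n (≤-reflexive n≡))
    20κ≤n : 20 * κ ≤ n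
    20κ≤n = ≤-trans (*-mono-≤ (m≤m+n 20 748) (m≤n*m κ c₃ {{>-nonZero 0<c₃}})) small
    Y≤ : Y ≤ t * (s + κ)
    Y≤ = ≤-trans (Rounding.rounding L S sh q t n≤qL ν 0<t B inF loads) (≤-reflexive (cong (λ k → t * (s + k)) (sym κ≡)))
    dense : falling₄ n < ∣ F ∣ᵣ + falling₄ (n ∸ s) → ∣ F ∣ᵣ + falling₄ (n ∸ s) ≤ falling₄ n
    dense large = Greedy.finish S sh s s<n ν (c₃ * κ) 5s≤n small 60≤n fullness
      where
      many : fourth n ≤ ∣ F ∣ᵣ + fourth d + 6 * cube n
      many = begin
        fourth n ≤⟨ fourth≤falling₄ n ⟩
        falling₄ n + 6 * cube n ≤⟨ +-monoˡ-≤ (6 * cube n) (<⇒≤ large) ⟩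
        ∣ F ∣ᵣ + falling₄ d + 6 * cube n ≤⟨ +-monoˡ-≤ (6 * cube n) (+-monoʳ-≤ ∣ F ∣ᵣ (falling₄≤fourth d)) ⟩
        ∣ F ∣ᵣ + fourth d + 6 * cube n ∎
      outside≤′ : ∑ (Stability.outside D s d κ n≡ 4s≤d 1≤κ 20κ≤n Y≤ many k k≥) ≤ c₁ * (κ * t)
      outside≤′ = ≤-trans (Stability.outside≤ D s d κ n≡ 4s≤d 1≤κ 20κ≤n Y≤ many k k≥) (≤-reflexive (cong (_* (κ * t)) (sym c₁≡)))
      fullness : s ≤ c₃ * κ ⊎ ∃ λ j → s ≡ toℕ j + c₃ * κ × Greedy.Full S sh s s<n ν j
      fullness = [ inj₁ , far ]′ (≤-<-connex s (c₃ * κ))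
        where
        far : c₃ * κ < s → s ≤ c₃ * κ ⊎ ∃ λ j → s ≡ toℕ j + c₃ * κ × Greedy.Full S sh s s<n ν j
        far s> = inj₂ (j , s≡ , λ X above n≤6x →
            Spread.full D s d κ n≡ 4s≤d 1≤κ 20κ≤n Y≤ many k k≥ c₁ c₄ outside≤′ c₄> S sh j (trans s≡ (cong (λ c → toℕ j + c * κ) c₃≡)) X (λ v h → ≤-<-trans j≤s (above v h)) n≤6x)
          where
          j<n : s ∸ c₃ * κ < n
          j<n = ≤-<-trans (m∸n≤m s (c₃ * κ)) s<n
          j : Fin n
          j = fromℕ< j<n
          s≡ : s ≡ toℕ j + c₃ * κ
          s≡ = sym (trans (cong (_+ c₃ * κ) (Finₚ.toℕ-fromℕ< j<n)) (m∸n+n≡m (<⇒≤ s>)))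
          j≤s : toℕ j ≤ s
          j≤s = ≤-trans (m≤m+n _ _) (≤-reflexive (sym s≡))

  bound : ∀ n s → 5 * s ≤ n → n₀ ≤ n → (H : FourGraph n) → νAtMost H s → e H ≤ (n C 4) ∸ ((n ∸ s) C 4)
  bound n s 5s≤n n₀≤n H νH with shifted-exists (orderings-sets (edges H)) (orderings-ν H νH)
  ... | G , S , ν , sh , size = m+n≤o⇒m≤o∸n (e H) (*-cancelˡ-≤ 24 (begin
      24 * (e H + (n ∸ s) C 4) ≡⟨ *-distribˡ-+ 24 (e H) _ ⟩
      24 * e H + 24 * ((n ∸ s) C 4) ≤⟨ +-mono-≤ (≤-trans (orderings-count H) (≤-reflexive (sym size))) (≤-reflexive (C-4 (n ∸ s))) ⟩
      ∣ G ∣ᵣ + falling₄ (n ∸ s) ≤⟨ shifted-bound L S sh ν 5s≤n (≤-trans (≤-trans (m≤n+m 60 _) (≤-reflexive (sym n₀≡))) n₀≤n) n≤qL refl small ⟩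
      falling₄ n ≡⟨ C-4 n ⟨
      24 * (n C 4) ∎))
    where
    open ≤-Reasoning
    0<K : 0 < 768 * c₃
    0<K = ≤-trans 0<c₃ (m≤n*m c₃ 768)
    instance
      q≢0 : NonZero q
      q≢0 = >-nonZero (≤-trans 0<K (≤-trans (m≤n*m (768 * c₃) 2) (≤-reflexive (sym q≡))))
    L = suc (n / q)
    n≤qL : n ≤ q * L
    n≤qL = begin
      n ≡⟨ m≡m%n+[m/n]*n n q ⟩
      n % q + n / q * q ≤⟨ +-monoˡ-≤ _ (<⇒≤ (m%n<n n q)) ⟩
      q + n / q * q ≡⟨ *-comm L q ⟩
      q * L ∎
    Q = q * (q * (q * q))
    small : 768 * (c₃ * (Q + L)) ≤ n
    small = *-cancelˡ-≤ 2 (begin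
      2 * (768 * (c₃ * (Q + L))) ≡⟨ cong (2 *_) (*-assoc 768 c₃ (Q + L)) ⟨
      2 * (768 * c₃ * (Q + L)) ≡⟨ *-assoc 2 (768 * c₃) (Q + L) ⟨
      2 * (768 * c₃) * (Q + L) ≡⟨ cong (_* (Q + L)) q≡ ⟨
      q * (Q + suc (n / q)) ≡⟨ expand≡ q Q (n / q) ⟩
      q * (Q + 1) + n / q * q ≤⟨ +-mono-≤ (≤-trans (≤-trans (m≤m+n _ 60) (≤-reflexive (sym n₀≡))) n₀≤n) (m/n*n≤m n q) ⟩
      n + n ≡⟨ cong (n +_) (+-identityʳ n) ⟨
      2 * n ∎)
      where
      expand≡ : ∀ q Q l → q * (Q + (1 + l)) ≡ q * (Q + 1) + l * q
      expand≡ = solve-∀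

Bound : Set
Bound = Σ ℕ (λ n₀ → (n s : ℕ) → 1 ≤ n → 1 ≤ s → 5 * s ≤ n → n₀ ≤ n →
    (H : FourGraph n) → νAtMost H s →
    e H ≤ (n C 4) ∸ ((n ∸ s) C 4))

-- Stated for variable constants, since concrete ones would be expanded to huge numerals.
bound-from : ∀ k c₄ → 256 * 6 + 20 * 500 ≤ k → 216 * (4 * (2 * k) + 10) < c₄ → Bound
bound-from k c₄ k≥ c₄> = _ , λ n s _ _ 5s≤n n₀≤n H νH → Main.bound k _ _ c₄ _ _ k≥ refl c₄> refl refl refl n s 5s≤n n₀≤n H νH

theorem1p1 : Σ ℕ (λ n₀ → (n s : ℕ) → 1 ≤ n → 1 ≤ s → 5 * s ≤ n → n₀ ≤ n →
    (H : FourGraph n) → νAtMost H s →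
    e H ≤ (n C 4) ∸ ((n ∸ s) C 4))
theorem1p1 = bound-from (256 * 6 + 20 * 500) (suc (216 * (4 * (2 * (256 * 6 + 20 * 500)) + 10))) ≤-refl ≤-refl
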